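{- Let $n\ge 5$ be an integer. Then $ex_{\mathcal{P}}(n,C_4^+)=ex_{\mathcal{P}}(n,C_4)$ if $n\ne 8$, and $ex_{\mathcal{P}}(8,C_4^+)=ex_{\mathcal{P}}(8,C_4)+1=12$.
   Context: All graphs are finite and simple. $C_4$ is the cycle on 4 vertices, and $C_4^+$ is the graph obtained from $C_4$ by adding exactly one pendant edge (joining a new vertex) to a vertex of degree two. For a graph $H$, $ex_{\mathcal{P}}(n,H)$ is the maximum number of edges in a planar graph on $n$ vertices that does not contain $H$ as a subgraph. -}

module Defs where

open import Data.Bool using (Bool; true; false; _∧_; _∨_; not; if_then_else_)
open import Data.Nat using (ℕ; zero; suc; _+_; _*_; _≤_; _<_; _≤ᵇ_; _<ᵇ_)
open import Data.Fin using (Fin; toℕ)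
import Data.Fin as F
open import Data.List using (List; []; _∷_; upTo)
import Data.List as L
open import Data.Product using (Σ; ∃; _×_; _,_)
open import Relation.Binary.PropositionalEquality using (_≡_; refl)
open import Relation.Nullary.Decidable using (⌊_⌋)
open import Function.Definitions using (Injective)
open import Relation.Nullary using (¬_)
open import Data.Bool.Properties using (∨-comm)

sumFin : ∀ {n} → (Fin n → ℕ) → ℕ
sumFin {zero}  f = 0
sumFin {suc n} f = f F.zero + sumFin (λ i → f (F.suc i))

countFin : ∀ {n} → (Fin n → Bool) → ℕ
countFin p = sumFin (λ i → if p i then 1 else 0)

allFinᵇ : ∀ {n} → (Fin n → Bool) → Bool
allFinᵇ {zero}  p = true
allFinᵇ {suc n} p = p F.zero ∧ allFinᵇ (λ i → p (F.suc i))

anyFinᵇ : ∀ {n} → (Fin n → Bool) → Bool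
anyFinᵇ p = not (allFinᵇ (λ i → not (p i)))

iter : ∀ {A : Set} → (A → A) → ℕ → A → A
iter f zero    x = x
iter f (suc k) x = f (iter f k x)

_==_ : ∀ {n} → Fin n → Fin n → Bool
i == j = ⌊ i F.≟ j ⌋

record Graph (n : ℕ) : Set where
  field
    adj    : Fin n → Fin n → Bool
    sym    : ∀ u v → adj u v ≡ adj v u
    irrefl : ∀ v → adj v v ≡ false
open Graph public

edges : ∀ {n} → Graph n → ℕ
edges G = sumFin (λ u → countFin (λ v → (toℕ u <ᵇ toℕ v) ∧ adj G u v))

_⊆ᴳ_ : ∀ {k n} → Graph k → Graph n → Set
_⊆ᴳ_ {k} {n} H G =
  Σ (Fin k → Fin n) λ f →
    Injective _≡_ _≡_ f × (∀ a b → adj H a b ≡ true → adj G (f a) (f b) ≡ true)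

-- Planarity, via combinatorial embeddings (rotation systems) of
-- Euler genus 0.

reachᵏ : ∀ {n} → Graph n → ℕ → Fin n → Fin n → Bool
reachᵏ G zero    u v = u == v
reachᵏ G (suc k) u v = reachᵏ G k u v ∨ anyFinᵇ (λ w → reachᵏ G k u w ∧ adj G w v)

reach : ∀ {n} → Graph n → Fin n → Fin n → Bool
reach {n} G = reachᵏ G n

-- number of connected components (count the least vertex of each)
components : ∀ {n} → Graph n → ℕ
components {n} G = countFin (λ v → allFinᵇ (λ u → not (reach G u v) ∨ (toℕ v ≤ᵇ toℕ u)))

isolated : ∀ {n} → Graph n → ℕ
isolated G = countFin (λ v → allFinᵇ (λ u → not (adj G v u)))

record Rotation {n : ℕ} (G : Graph n) : Set where
  field
    ρ      : Fin n → Fin n → Fin n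
    closed : ∀ v u → adj G v u ≡ true → adj G v (ρ v u) ≡ true
    inj    : ∀ v u w → adj G v u ≡ true → adj G v w ≡ true → ρ v u ≡ ρ v w → u ≡ w
    cyclic : ∀ v u w → adj G v u ≡ true → adj G v w ≡ true →
             Σ ℕ λ k → iter (ρ v) k u ≡ w
open Rotation public

-- darts (u , v) with u ~ v; face permutation φ (u , v) = (v , ρ v u)
faceStep : ∀ {n} {G : Graph n} → Rotation G → Fin n × Fin n → Fin n × Fin n
faceStep R (u , v) = (v , ρ R v u)

dartKey : ∀ {n} → Fin n × Fin n → ℕ
dartKey {n} (u , v) = toℕ u * n + toℕ v

-- number of faces = number of orbits of φ on darts
-- (counted by the dart of least key in each orbit; orbits have length ≤ n*n)
faces : ∀ {n} {G : Graph n} → Rotation G → ℕ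
faces {n} {G} R =
  sumFin λ u → countFin λ v →
    adj G u v ∧
    allFinᵇ {n * n} (λ k → dartKey (u , v) ≤ᵇ dartKey (iter (faceStep R) (toℕ k) (u , v)))

-- Euler's formula for a (possibly disconnected) embedding in the sphere:
-- V - E + F = 2C, where each isolated vertex contributes its own face.
Planar : ∀ {n} → Graph n → Set
Planar {n} G = Σ (Rotation G) λ R →
  n + faces R + isolated G ≡ edges G + 2 * components G

Free : ∀ {k n} → Graph k → Graph n → Set
Free H G = ¬ (H ⊆ᴳ G)

IsExP : (n : ℕ) → ∀ {k} → Graph k → ℕ → Set
IsExP n H m =
  (Σ (Graph n) λ G → Planar G × Free H G × edges G ≡ m) ×
  (∀ (G : Graph n) → Planar G → Free H G → edges G ≤ m)

hasEdge : ∀ {k} → List (Fin k × Fin k) → Fin k → Fin k → Bool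
hasEdge []             a b = false
hasEdge ((x , y) ∷ es) a b = ((x == a) ∧ (y == b)) ∨ hasEdge es a b

symAdj : ∀ {k} → List (Fin k × Fin k) → Fin k → Fin k → Bool
symAdj es a b = hasEdge es a b ∨ hasEdge es b a

c4Edges : List (Fin 4 × Fin 4)
c4Edges = (F.zero , F.suc F.zero) ∷ (F.suc F.zero , F.suc (F.suc F.zero))
        ∷ (F.suc (F.suc F.zero) , F.suc (F.suc (F.suc F.zero)))
        ∷ (F.suc (F.suc (F.suc F.zero)) , F.zero) ∷ []

C4 : Graph 4
C4 = record
  { adj = symAdj c4Edges
  ; sym = λ u v → ∨-comm (hasEdge c4Edges u v) (hasEdge c4Edges v u)
  ; irrefl = λ { F.zero → refl ; (F.suc F.zero) → refl ; (F.suc (F.suc F.zero)) → refl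
               ; (F.suc (F.suc (F.suc F.zero))) → refl } }

c4pEdges : List (Fin 5 × Fin 5)
c4pEdges = (F.zero , F.suc F.zero) ∷ (F.suc F.zero , F.suc (F.suc F.zero))
         ∷ (F.suc (F.suc F.zero) , F.suc (F.suc (F.suc F.zero)))
         ∷ (F.suc (F.suc (F.suc F.zero)) , F.zero)
         ∷ (F.zero , F.suc (F.suc (F.suc (F.suc F.zero)))) ∷ []

C4⁺ : Graph 5
C4⁺ = record
  { adj = symAdj c4pEdges
  ; sym = λ u v → ∨-comm (hasEdge c4pEdges u v) (hasEdge c4pEdges v u)
  ; irrefl = λ { F.zero → refl ; (F.suc F.zero) → refl ; (F.suc (F.suc F.zero)) → refl
               ; (F.suc (F.suc (F.suc F.zero))) → refl
               ; (F.suc (F.suc (F.suc (F.suc F.zero)))) → refl } }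

{-# OPTIONS --safe #-}
module Submission where

-- A 4-cycle of a C4⁺-free graph has no neighbours outside it, so it spans a component with at most
-- six edges.  If some vertex x lies on no 4-cycle, such a component can be replaced by two triangles
-- sharing x (six edges on the same four vertices and x), which creates no 4-cycle; after finitely many
-- steps the graph is C4-free.  Otherwise n = 4a and all degrees are at most three, so there are at most
-- 6a edges.  For a ≥ 3 a truncated tetrahedron with a - 3 pairs of triangles attached to a vertex is
-- planar, C4-free and has 6a edges, while n = 8 is the exception 2K₄.  That a C4-free graph on eight
-- vertices has at most eleven edges is checked by a search that starts from a vertex of maximal degree.
--
-- Cutting a component out of an embedding and gluing another one in at a corner change the number of
-- faces by explicit amounts.  The components are not known to be embedded in the sphere (this would need
-- that genera are not negative), but a graph on four vertices has genus 0 or 1, and two triangles sharing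
-- a vertex can be embedded with either genus, so the total in Euler's formula can be preserved.

open import Defs
open import Data.Bool using (Bool; true; false; T; _∧_; _∨_; not; if_then_else_)
open import Data.Bool.Properties using (∧-comm; ∧-zeroʳ) renaming (_≟_ to _≟ᵇ_)
open import Data.Empty using (⊥; ⊥-elim)
open import Data.Fin as Fin using (Fin; zero; suc; toℕ; fromℕ<; _↑ˡ_; _↑ʳ_; splitAt; punchIn; punchOut; combine; remQuot; #_)
open import Data.Fin.Patterns
open import Data.Fin.Properties as Finₚ
  using (any?; all?; injective⇒≤; join-splitAt; splitAt⁻¹-↑ˡ; splitAt⁻¹-↑ʳ; splitAt-↑ˡ; splitAt-↑ʳ; pigeonhole; toℕ-injective; toℕ-fromℕ<)
open import Data.List using (List; []; _∷_)
open import Data.List.Relation.Unary.All using (All; []; _∷_)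
open import Data.Nat
open import Data.Nat.DivMod using (_%_; _/_; m≡m%n+[m/n]*n; m%n<n)
open import Data.Nat.Induction using (<-wellFounded)
open import Data.Nat.Properties
open import Data.Nat.Solver using (module +-*-Solver)
open import Data.Product using (Σ; ∃; _×_; _,_; proj₁; proj₂)
open import Data.Product.Properties using (≡-dec)
open import Data.Sum as Sum using (_⊎_; inj₁; inj₂; [_,_]′)
open import Data.Unit using (⊤; tt)
open import Data.Vec as Vec using (Vec; []; _∷_)
open import Data.Vec.Properties using (lookup∘tabulate)
open import Function using (_∘_; id; case_of_)
open import Induction.WellFounded using (Acc; acc)
open import Relation.Binary.Definitions using (tri<; tri≈; tri>)
open import Relation.Binary.PropositionalEquality
  using (_≡_; _≢_; refl; cong; cong₂; subst; trans; module ≡-Reasoning) renaming (sym to ≡-sym)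
open import Relation.Nullary using (¬_; Dec; yes; no; contradiction)
open import Relation.Nullary.Decidable using (isNo; ⌊_⌋; map′; ¬?; _×-dec_; _→-dec_)
open +-*-Solver using (solve; _:=_; _:+_; _:*_; con)

-- For n ≠ 8 neither number is computed: it is enough that every planar C4⁺-free graph is matched by
-- a planar C4-free graph on as many vertices with at least as many edges. The common value still
-- has to be exhibited. It is the maximum of a bounded set of numbers, found constructively because
-- planarity is decidable, by enumeration of all rotation systems.
--
-- K₄ and two triangles sharing x agree in what matters for the exchange: six edges, and four
-- vertices besides x. The new part meets the rest only in x, so each 4-cycle lies on one side. That
-- x is on no 4-cycle puts it outside the removed component and lets it gain neighbours without
-- giving a 4-cycle a pendant edge.
--
-- The same ratio explains the chain: a pair of triangles adds four vertices and six edges, so only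
-- a first planar C4-free graph with 4a vertices and 6a edges is wanted. For a = 2 there is none,
-- because twelve edges on eight vertices force a 4-cycle; for a = 3 the truncated tetrahedron, a
-- cubic graph with triangular and hexagonal faces, is one.

private variable
  j k l m n : ℕ
  A B C : Set

-- Finite sums and Boolean quantifiers.

sumFin-cong : {f g : Fin n → ℕ} → (∀ i → f i ≡ g i) → sumFin f ≡ sumFin g
sumFin-cong {zero}  e = refl
sumFin-cong {suc n} e = cong₂ _+_ (e zero) (sumFin-cong (e ∘ suc))

sumFin-mono : {f g : Fin n → ℕ} → (∀ i → f i ≤ g i) → sumFin f ≤ sumFin g
sumFin-mono {zero}  e = z≤n
sumFin-mono {suc n} e = +-mono-≤ (e zero) (sumFin-mono (e ∘ suc))

sumFin-const : ∀ n c → sumFin {n} (λ _ → c) ≡ n * c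
sumFin-const zero    c = refl
sumFin-const (suc n) c = cong (c +_) (sumFin-const n c)

+-interchange : ∀ a b c d → (a + b) + (c + d) ≡ (a + c) + (b + d)
+-interchange a b c d = begin
  (a + b) + (c + d)  ≡⟨ +-assoc a b (c + d) ⟩
  a + (b + (c + d))  ≡⟨ cong (a +_) (+-assoc b c d) ⟨
  a + ((b + c) + d)  ≡⟨ cong (λ t → a + (t + d)) (+-comm b c) ⟩
  a + ((c + b) + d)  ≡⟨ cong (a +_) (+-assoc c b d) ⟩
  a + (c + (b + d))  ≡⟨ +-assoc a c (b + d) ⟨
  (a + c) + (b + d)  ∎
  where open ≡-Reasoning

sumFin-+ : (f g : Fin n → ℕ) → sumFin (λ i → f i + g i) ≡ sumFin f + sumFin g
sumFin-+ {zero}  f g = refl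
sumFin-+ {suc n} f g = trans (cong (f zero + g zero +_) (sumFin-+ (f ∘ suc) (g ∘ suc)))
                             (+-interchange (f zero) (g zero) _ _)

sumFin-swap : (f : Fin m → Fin n → ℕ) →
              sumFin (λ i → sumFin (f i)) ≡ sumFin (λ j → sumFin (λ i → f i j))
sumFin-swap {zero}  {n} f = ≡-sym (trans (sumFin-const n 0) (*-zeroʳ n))
sumFin-swap {suc m}     f = trans (cong (sumFin (f zero) +_) (sumFin-swap (f ∘ suc)))
                                  (≡-sym (sumFin-+ (f zero) _))

countFin-cong : {p q : Fin n → Bool} → (∀ i → p i ≡ q i) → countFin p ≡ countFin q
countFin-cong e = sumFin-cong λ i → cong (if_then 1 else 0) (e i)

allFinᵇ-cong : {p q : Fin n → Bool} → (∀ i → p i ≡ q i) → allFinᵇ p ≡ allFinᵇ q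
allFinᵇ-cong {zero}  e = refl
allFinᵇ-cong {suc n} e = cong₂ _∧_ (e zero) (allFinᵇ-cong (e ∘ suc))

∧-true : ∀ {a b} → a ∧ b ≡ true → a ≡ true × b ≡ true
∧-true {true} {true} e = refl , refl

∧-intro : ∀ {a b} → a ≡ true → b ≡ true → a ∧ b ≡ true
∧-intro refl refl = refl

∨-true : ∀ {a b} → a ∨ b ≡ true → a ≡ true ⊎ b ≡ true
∨-true {true}  e = inj₁ refl
∨-true {false} e = inj₂ e

∨-introˡ : ∀ {a b} → a ≡ true → a ∨ b ≡ true
∨-introˡ refl = refl

∨-introʳ : ∀ {a b} → b ≡ true → a ∨ b ≡ true
∨-introʳ {true}  e = refl
∨-introʳ {false} e = e

true≢false : ∀ {b} {X : Set} → b ≡ true → b ≡ false → X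
true≢false refl ()

allFinᵇ-sound : (p : Fin n → Bool) → allFinᵇ p ≡ true → ∀ i → p i ≡ true
allFinᵇ-sound p e zero    = proj₁ (∧-true e)
allFinᵇ-sound p e (suc i) = allFinᵇ-sound (p ∘ suc) (proj₂ (∧-true {p zero} e)) i

allFinᵇ-complete : (p : Fin n → Bool) → (∀ i → p i ≡ true) → allFinᵇ p ≡ true
allFinᵇ-complete {zero}  p h = refl
allFinᵇ-complete {suc n} p h = ∧-intro (h zero) (allFinᵇ-complete (p ∘ suc) (h ∘ suc))

allFinᵇ-false : (p : Fin n → Bool) → allFinᵇ p ≡ false → ∃ λ i → p i ≡ false
allFinᵇ-false {suc n} p e with p zero in eq
... | false = zero , eq
... | true  with allFinᵇ-false (p ∘ suc) e
...   | i , h = suc i , h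

not-true : ∀ {b} → not b ≡ true → b ≡ false
not-true {false} e = refl

not-false : ∀ {b} → not b ≡ false → b ≡ true
not-false {true} e = refl

anyFinᵇ-true : (p : Fin n → Bool) → anyFinᵇ p ≡ true → ∃ λ i → p i ≡ true
anyFinᵇ-true p e with allFinᵇ-false (not ∘ p) (not-true e)
... | i , h = i , not-false h

anyFinᵇ-intro : (p : Fin n → Bool) → ∀ i → p i ≡ true → anyFinᵇ p ≡ true
anyFinᵇ-intro p i h with allFinᵇ (not ∘ p) in eq
... | false = refl
... | true  = ⊥-elim (true≢false h (not-true (allFinᵇ-sound (not ∘ p) eq i)))

==-refl : (i : Fin n) → (i == i) ≡ true
==-refl i with i Fin.≟ i
... | yes _ = refl
... | no ¬p = contradiction refl ¬p

==-sound : (i j : Fin n) → (i == j) ≡ true → i ≡ j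
==-sound i j e with i Fin.≟ j
... | yes p = p

-- Counting by systems of representatives.

-- A system of k representatives for the restriction of _~_ to P.  All numbers in the Euler
-- formula are counts of this kind.
record Classes {A : Set} (P : A → Set) (_~_ : A → A → Set) (k : ℕ) : Set where
  field
    rep   : Fin k → A
    rep∈  : ∀ i → P (rep i)
    cover : ∀ {a} → P a → Σ (Fin k) λ i → a ~ rep i
    uniq  : ∀ {i j} → rep i ~ rep j → i ≡ j

-- Symmetry is relativised to `P` because `faceStep` is a permutation only on darts: elsewhere an
-- orbit need not be reversible.
record PER {A : Set} (P : A → Set) (_~_ : A → A → Set) : Set where
  field
    ~-sym   : ∀ {a b} → P a → P b → a ~ b → b ~ a
    ~-trans : ∀ {a b c} → a ~ b → b ~ c → a ~ c

≡-PER : {P : A → Set} → PER P _≡_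
≡-PER = record { ~-sym = λ _ _ → ≡-sym ; ~-trans = trans }

module _ {P : A → Set} {_~_ : A → A → Set} (per : PER P _~_) where
  open PER per
  open Classes

  classes-≤ : Classes P _~_ k → Classes P _~_ l → k ≤ l
  classes-≤ {k} {l} c d = injective⇒≤ {f = λ i → proj₁ (cover d (rep∈ c i))} λ {i} {j} e →
    let (x , p) = cover d (rep∈ c i)
        (y , q) = cover d (rep∈ c j)
    in uniq c (~-trans (subst (λ z → rep c i ~ rep d z) e p) (~-sym (rep∈ c j) (rep∈ d y) q))

  -- The counting identities below rest on this: the sum on one side is shown to be the size of
  -- another system of representatives for the classes counted on the other side.
  classes-unique : Classes P _~_ k → Classes P _~_ l → k ≡ l
  classes-unique c d = ≤-antisym (classes-≤ c d) (classes-≤ d c)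

  same? : Classes P _~_ k → ∀ {a b} → P a → P b → Dec (a ~ b)
  same? c {a} {b} p q with cover c p | cover c q
  ... | i , u | j , v with i Fin.≟ j
  ... | yes refl = yes (~-trans u (~-sym q (rep∈ c i) v))
  ... | no i≢j = no λ w → i≢j (uniq c (~-trans (~-sym p (rep∈ c i) u) (~-trans w v)))

  -- Serves the case where gluing merges two faces and one class has to be taken out of the count.
  dropClass : Classes P _~_ k → ∀ {a} → P a →
              Σ ℕ λ l → k ≡ suc l × Classes (λ b → P b × ¬ (b ~ a)) _~_ l
  dropClass {zero} c p with () ← proj₁ (cover c p)
  dropClass {suc l} c {a} p with cover c p
  ... | i , u = l , refl , record
    { rep   = rep c ∘ punchIn i
    ; rep∈  = λ j → rep∈ c _ , λ v → Finₚ.punchInᵢ≢i i j (uniq c (~-trans v u))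
    ; cover = λ { {b} (q , ¬v) → let (j , w) = cover c q
                                     i≢j : i ≢ j
                                     i≢j e = ¬v (~-trans (subst (λ z → b ~ rep c z) (≡-sym e) w)
                                                        (~-sym p (rep∈ c i) u))
                in punchOut i≢j , subst (λ z → b ~ rep c z) (≡-sym (Finₚ.punchIn-punchOut i≢j)) w }
    ; uniq  = λ e → Finₚ.punchIn-injective i _ _ (uniq c e)
    }

module _ {P : A → Set} {_~_ : A → A → Set} {Q : B → Set} {_≈_ : B → B → Set}
         {R : C → Set} {_≋_ : C → C → Set} where
  open Classes

  -- Both families of representatives are transported to C and put side by side. The covering
  -- hypothesis compares `c` with the images of all elements equivalent to `a`, so the
  -- representative of that class is reached in one step, and `f` may move elements, as the
  -- contraction `π` does below.
  glueClasses : Classes P _~_ k → Classes Q _≈_ l → (f : A → C) (g : B → C) →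
    (∀ {a} → P a → R (f a)) → (∀ {b} → Q b → R (g b)) →
    (∀ {c} → R c → (Σ A λ a → P a × (∀ {r} → P r → a ~ r → c ≋ f r))
                 ⊎ (Σ B λ b → Q b × (∀ {r} → Q r → b ≈ r → c ≋ g r))) →
    (∀ {a a'} → P a → P a' → f a ≋ f a' → a ~ a') →
    (∀ {b b'} → Q b → Q b' → g b ≋ g b' → b ≈ b') →
    (∀ {a b} → P a → Q b → ¬ (f a ≋ g b)) →
    (∀ {a b} → P a → Q b → ¬ (g b ≋ f a)) →
    Classes R _≋_ (k + l)
  glueClasses {k} {l} c d f g f∈ g∈ cov ff gg fg gf = record
    { rep   = λ i → h (splitAt k i)
    ; rep∈  = λ i → h∈ (splitAt k i)
    ; cover = λ r → case cov r of λ where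
        (inj₁ (a , p , w)) → let (i , u) = cover c p in
           i ↑ˡ l , subst (λ s → _ ≋ h s) (≡-sym (splitAt-↑ˡ k i l)) (w (rep∈ c i) u)
        (inj₂ (b , q , w)) → let (i , u) = cover d q in
           k ↑ʳ i , subst (λ s → _ ≋ h s) (≡-sym (splitAt-↑ʳ k l i)) (w (rep∈ d i) u)
    ; uniq  = λ {i} {j} e → trans (≡-sym (join-splitAt k l i))
        (trans (cong (Fin.join k l) (h-uniq (splitAt k i) (splitAt k j) e)) (join-splitAt k l j))
    }
    where
    h : Fin k ⊎ Fin l → C
    h = [ f ∘ rep c , g ∘ rep d ]′
    h∈ : ∀ s → R (h s)
    h∈ (inj₁ i) = f∈ (rep∈ c i)
    h∈ (inj₂ i) = g∈ (rep∈ d i)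
    h-uniq : ∀ s t → h s ≋ h t → s ≡ t
    h-uniq (inj₁ i) (inj₁ j) e = cong inj₁ (uniq c (ff (rep∈ c i) (rep∈ c j) e))
    h-uniq (inj₂ i) (inj₂ j) e = cong inj₂ (uniq d (gg (rep∈ d i) (rep∈ d j) e))
    h-uniq (inj₁ i) (inj₂ j) e = ⊥-elim (fg (rep∈ c i) (rep∈ d j) e)
    h-uniq (inj₂ j) (inj₁ i) e = ⊥-elim (gf (rep∈ c i) (rep∈ d j) e)

mapClasses : {P : A → Set} {Q : B → Set} → Classes P _≡_ k → (f : A → B) →
  (∀ {a} → P a → Q (f a)) → (∀ {b} → Q b → Σ A λ a → P a × b ≡ f a) →
  (∀ {a a'} → P a → P a' → f a ≡ f a' → a ≡ a') → Classes Q _≡_ k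
mapClasses c f f∈ g f-inj = record
  { rep   = f ∘ rep
  ; rep∈  = f∈ ∘ rep∈
  ; cover = λ q → let (a , p , e) = g q ; (i , u) = cover p in i , trans e (cong f u)
  ; uniq  = λ e → uniq (f-inj (rep∈ _) (rep∈ _) e)
  } where open Classes c

noClasses : {P : A → Set} {_~_ : A → A → Set} → (∀ {a} → ¬ P a) → Classes P _~_ 0
noClasses h = record { rep = λ () ; rep∈ = λ () ; cover = λ p → ⊥-elim (h p) ; uniq = λ { {()} } }

finClasses : ∀ n → Classes {Fin n} (λ _ → ⊤) _≡_ n
finClasses n = record { rep = id ; rep∈ = λ _ → tt ; cover = λ _ → _ , refl ; uniq = id }

sumClasses : {P : Fin n → B → Set} (c : Fin n → ℕ) → (∀ i → Classes (P i) _≡_ (c i)) →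
  Classes {Fin n × B} (λ { (i , b) → P i b }) _≡_ (sumFin c)
sumClasses {zero} c h = noClasses λ { {() , _} }
sumClasses {suc n} {P = P} c h = glueClasses (h zero) (sumClasses (c ∘ suc) (h ∘ suc))
  (zero ,_) (λ { (i , b) → suc i , b })
  id id
  (λ { {zero , b} p → inj₁ (b , p , λ _ → cong (zero ,_))
     ; {suc i , b} p → inj₂ ((i , b) , p , λ { _ refl → refl }) })
  (λ { _ _ refl → refl })
  (λ { {i , b} _ _ refl → refl })
  (λ _ _ ()) (λ _ _ ())

boolClasses : ∀ b → Classes {⊤} (λ _ → b ≡ true) _≡_ (if b then 1 else 0)
boolClasses true  = record
  { rep = λ _ → tt ; rep∈ = λ _ → refl ; cover = λ _ → zero , refl ; uniq = λ { {zero} {zero} _ → refl } }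
boolClasses false = noClasses λ ()

countClasses : (p : Fin n → Bool) → Classes (λ i → p i ≡ true) _≡_ (countFin p)
countClasses p = mapClasses (sumClasses _ (boolClasses ∘ p)) proj₁ id
  (λ {i} e → (i , tt) , e , refl) (λ { _ _ refl → refl })

count₂ : (Fin m → Fin n → Bool) → ℕ
count₂ p = sumFin λ i → countFin (p i)

count₂Classes : (p : Fin m → Fin n → Bool) →
  Classes {Fin m × Fin n} (λ { (i , j) → p i j ≡ true }) _≡_ (count₂ p)
count₂Classes p = sumClasses _ (countClasses ∘ p)

countFin-mono : {p q : Fin n → Bool} → (∀ i → p i ≡ true → q i ≡ true) → countFin p ≤ countFin q
countFin-mono {p = p} {q} h = sumFin-mono λ i → aux (p i) (q i) (h i)
  where
  aux : ∀ a b → (a ≡ true → b ≡ true) → (if a then 1 else 0) ≤ (if b then 1 else 0)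
  aux true  b h rewrite h refl = ≤-refl
  aux false b h = z≤n

countFin-strict : {p q : Fin n → Bool} → (∀ i → p i ≡ true → q i ≡ true) →
                  ∀ j → p j ≡ false → q j ≡ true → countFin p < countFin q
countFin-strict {p = p} {q} h zero pj qj rewrite pj | qj = s≤s (countFin-mono (λ i → h (suc i)))
countFin-strict {p = p} {q} h (suc j) pj qj with p zero in e | q zero in e'
... | true  | true  = s≤s (countFin-strict (λ i → h (suc i)) j pj qj)
... | false | true  = <-trans (countFin-strict (λ i → h (suc i)) j pj qj) (n<1+n _)
... | false | false = countFin-strict (λ i → h (suc i)) j pj qj
... | true  | false = true≢false (h zero e) e'

countFin-≤ : (p : Fin n → Bool) → countFin p ≤ n
countFin-≤ {zero}  p = z≤n
countFin-≤ {suc n} p with p zero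
... | true  = s≤s (countFin-≤ (p ∘ suc))
... | false = m≤n⇒m≤1+n (countFin-≤ (p ∘ suc))

reClasses : {P Q : A → Set} {_~_ : A → A → Set} → Classes P _~_ k →
  (∀ {a} → P a → Q a) → (∀ {a} → Q a → P a) → Classes Q _~_ k
reClasses c f g = record { rep = rep ; rep∈ = f ∘ rep∈ ; cover = cover ∘ g ; uniq = uniq }
  where open Classes c

-- The counts in the definitions single out the element of least key in each class. Descent to ever
-- smaller keys reaches it from anywhere in the class, and two such elements of one class have the
-- same key.
leastClasses : {P : A → Set} {_~_ : A → A → Set} (key : A → ℕ) (least : A → Bool) → PER P _~_ →
  (∀ {a} → P a → a ~ a) → (∀ {a b} → key a ≡ key b → a ≡ b) →
  (∀ {a} → P a → least a ≡ true → ∀ {b} → P b → a ~ b → key a ≤ key b) →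
  (∀ {a} → P a → least a ≡ false → Σ A λ b → P b × a ~ b × key b < key a) →
  Classes (λ a → P a × least a ≡ true) _≡_ k → Classes P _~_ k
leastClasses {A = A} {P = P} {_~_} key least per ~-refl key-inj below above c = record
  { rep   = rep
  ; rep∈  = proj₁ ∘ rep∈
  ; cover = λ p → descend p (<-wellFounded _)
  ; uniq  = λ {i} {j} e → let (p , x) = rep∈ i ; (q , y) = rep∈ j in
      uniq (key-inj (≤-antisym (below p x q e) (below q y p (~-sym p q e))))
  }
  where
  open Classes c
  open PER per
  descend : ∀ {a} → P a → Acc _<_ (key a) → Σ _ λ i → a ~ rep i
  descend {a} p (acc rs) with least a in eq
  ... | true  = let (i , e) = cover (p , eq) in i , subst (a ~_) e (~-refl p)
  ... | false = let (b , q , u , lt) = above p eq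
                    (i , v) = descend q (rs lt)
                in i , ~-trans u v

-- Orbits of iterated maps

iter-+ : (f : A → A) → ∀ j k a → iter f (j + k) a ≡ iter f j (iter f k a)
iter-+ f zero    k a = refl
iter-+ f (suc j) k a = cong f (iter-+ f j k a)

iter-suc : (f : A → A) → ∀ k a → iter f k (f a) ≡ f (iter f k a)
iter-suc f zero    a = refl
iter-suc f (suc k) a = cong f (iter-suc f k a)

iter-* : (f : A → A) → ∀ {p a} → iter f p a ≡ a → ∀ k → iter f (k * p) a ≡ a
iter-* f e zero    = refl
iter-* f {p} {a} e (suc k) = trans (iter-+ f p (k * p) a) (trans (cong (iter f p) (iter-* f e k)) e)

Orb : (A → A) → A → A → Set
Orb f a b = Σ ℕ λ k → iter f k a ≡ b

orb-refl : {f : A → A} → ∀ {a} → Orb f a a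
orb-refl = 0 , refl

orb-step : {f : A → A} → ∀ {a} → Orb f a (f a)
orb-step = 1 , refl

orb-trans : {f : A → A} → ∀ {a b c} → Orb f a b → Orb f b c → Orb f a c
orb-trans {f = f} (j , refl) (k , refl) = k + j , iter-+ f k j _

module Permutation {A : Set} (N : ℕ) (code : A → Fin N) (code-inj : ∀ {a b} → code a ≡ code b → a ≡ b)
  (f : A → A) (P : A → Set) (f-closed : ∀ {a} → P a → P (f a))
  (f-inj : ∀ {a b} → P a → P b → f a ≡ f b → a ≡ b) where

  iter-closed : ∀ k {a} → P a → P (iter f k a)
  iter-closed zero    p = p
  iter-closed (suc k) p = f-closed (iter-closed k p)

  iter-inj : ∀ k {a b} → P a → P b → iter f k a ≡ iter f k b → a ≡ b
  iter-inj zero    p q e = e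
  iter-inj (suc k) p q e = iter-inj k p q (f-inj (iter-closed k p) (iter-closed k q) e)

  -- Two of the N + 1 points a, f a, ..., f^N a have the same code; the iterations before the first
  -- of them are cancelled by injectivity.
  period : ∀ {a} → P a → Σ ℕ λ p → p < N × iter f (suc p) a ≡ a
  period {a} pa with pigeonhole (n<1+n N) (λ i → code (iter f (toℕ i) a))
  ... | i , j , i<j , e = pred d , ≤-trans (≤-reflexive suc-pred-d) d≤N , trans (cong (λ t → iter f t a) suc-pred-d) back
    where
    d : ℕ
    d = toℕ j ∸ toℕ i
    suc-pred-d : suc (pred d) ≡ d
    suc-pred-d = suc-pred d {{>-nonZero (m<n⇒0<n∸m i<j)}}
    d≤N : d ≤ N
    d≤N = ≤-trans (m∸n≤m (toℕ j) (toℕ i)) (s≤s⁻¹ (Finₚ.toℕ<n j))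
    back : iter f d a ≡ a
    back = ≡-sym (iter-inj (toℕ i) pa (iter-closed d pa) (trans (code-inj e)
      (trans (cong (λ t → iter f t a) (≡-sym (m+[n∸m]≡n (<⇒≤ i<j)))) (iter-+ f (toℕ i) d a))))

  orb-sym : ∀ {a b} → P a → Orb f a b → Orb f b a
  orb-sym {a} pa (k , refl) with period pa
  -- The `k` steps are completed to `k` full periods.
  ... | p , _ , e = k * suc p ∸ k ,
    trans (≡-sym (iter-+ f (k * suc p ∸ k) k a))
      (trans (cong (λ t → iter f t a) (m∸n+n≡m (m≤m*n k (suc p)))) (iter-* f e k))

  -- Reduction of the number of steps modulo the period. The bound N becomes n * n for darts, which
  -- is the range of iterates inspected by `faces`.
  orb-bounded : ∀ {a b} → P a → Orb f a b → Σ (Fin N) λ k → iter f (toℕ k) a ≡ b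
  orb-bounded {a} pa (k , refl) with period pa
  ... | p , p<N , e = fromℕ< r<N , trans (cong (λ t → iter f t a) (toℕ-fromℕ< r<N)) (≡-sym (begin
      iter f k a                             ≡⟨ cong (λ t → iter f t a) (m≡m%n+[m/n]*n k (suc p)) ⟩
      iter f (k % suc p + (k / suc p) * suc p) a ≡⟨ iter-+ f (k % suc p) _ a ⟩
      iter f (k % suc p) (iter f ((k / suc p) * suc p) a) ≡⟨ cong (iter f (k % suc p)) (iter-* f e (k / suc p)) ⟩
      iter f (k % suc p) a ∎))
    where
    open ≡-Reasoning
    r<N : k % suc p < N
    r<N = <-≤-trans (m%n<n k (suc p)) p<N

  orb-PER : PER P (Orb f)
  orb-PER = record { ~-sym = λ pa _ → orb-sym pa ; ~-trans = orb-trans }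

-- Faces

Dart : Graph n → Fin n × Fin n → Set
Dart G (u , v) = adj G u v ≡ true

dart-sym : (G : Graph n) → ∀ {u v} → adj G u v ≡ true → adj G v u ≡ true
dart-sym G {u} {v} e = trans (sym G v u) e

dart-irrefl : (G : Graph n) → ∀ {u v} → adj G u v ≡ true → u ≢ v
dart-irrefl G {u} e refl = true≢false e (irrefl G u)

dartKey-combine : (d : Fin n × Fin n) → dartKey d ≡ toℕ (combine (proj₁ d) (proj₂ d))
dartKey-combine {n} (u , v) = trans (cong (_+ toℕ v) (*-comm (toℕ u) n)) (≡-sym (Finₚ.toℕ-combine u v))

pairCode : Fin n × Fin n → Fin (n * n)
pairCode (u , v) = combine u v

pairCode-inj : {d e : Fin n × Fin n} → pairCode d ≡ pairCode e → d ≡ e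
pairCode-inj {d = u , v} {u' , v'} e with Finₚ.combine-injective u v u' v' e
... | refl , refl = refl

dartKey-inj : {d e : Fin n × Fin n} → dartKey d ≡ dartKey e → d ≡ e
dartKey-inj {d = d} {e} eq = pairCode-inj (toℕ-injective
  (trans (≡-sym (dartKey-combine d)) (trans eq (dartKey-combine e))))

≤ᵇ-sound : ∀ {a b} → (a ≤ᵇ b) ≡ true → a ≤ b
≤ᵇ-sound {a} {b} e = ≤ᵇ⇒≤ a b (subst T (≡-sym e) tt)

≤ᵇ-false : ∀ {a b} → (a ≤ᵇ b) ≡ false → b < a
≤ᵇ-false {a} {b} e = ≰⇒> λ p → subst T e (≤⇒≤ᵇ p)

module Faces {n} {G : Graph n} (R : Rotation G) where

  faceStep-closed : ∀ {d} → Dart G d → Dart G (faceStep R d)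
  faceStep-closed {u , v} e = closed R v u (dart-sym G e)

  faceStep-inj : ∀ {d d'} → Dart G d → Dart G d' → faceStep R d ≡ faceStep R d' → d ≡ d'
  faceStep-inj {u , v} {u' , v'} e e' eq with cong proj₁ eq
  ... | refl = cong (_, v) (inj R v u u' (dart-sym G e) (dart-sym G e') (cong proj₂ eq))

  open Permutation (n * n) pairCode pairCode-inj (faceStep R) (Dart G) faceStep-closed faceStep-inj public

  belowIter : Fin n × Fin n → Fin (n * n) → Bool
  belowIter d k = dartKey d ≤ᵇ dartKey (iter (faceStep R) (toℕ k) d)

  faceClasses : Classes (Dart G) (Orb (faceStep R)) (faces R)
  faceClasses = leastClasses dartKey (allFinᵇ ∘ belowIter) orb-PER (λ _ → orb-refl) dartKey-inj
    (λ {a} p e q o → let (k , eq) = orb-bounded p o in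
       ≤ᵇ-sound (subst (λ b → (dartKey a ≤ᵇ dartKey b) ≡ true) eq (allFinᵇ-sound (belowIter a) e k)))
    (λ {a} p e → let (k , lt) = allFinᵇ-false (belowIter a) e in
       _ , iter-closed (toℕ k) p , (toℕ k , refl) , ≤ᵇ-false lt)
    (reClasses (count₂Classes _) ∧-true (λ { (p , q) → ∧-intro p q }))

darts : Graph n → ℕ
darts G = count₂ (adj G)

dartClasses : (G : Graph n) → Classes (Dart G) _≡_ (darts G)
dartClasses G = reClasses (count₂Classes (adj G)) id id

-- Edges are counted by pairs with increasing index, which an injection of vertices need not
-- respect. Darts involve no such choice, so edge counts are compared through darts and then halved.
darts≡2edges : (G : Graph n) → darts G ≡ edges G + edges G
darts≡2edges {n} G = begin
  count₂ (adj G)                                              ≡⟨ sumFin-cong (λ u → trans (sumFin-cong (split u)) (sumFin-+ {n} _ _)) ⟩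
  sumFin (λ u → countFin (up u) + countFin (λ v → up v u))     ≡⟨ sumFin-+ {n} _ _ ⟩
  edges G + sumFin (λ u → countFin (λ v → up v u))             ≡⟨ cong (edges G +_) (sumFin-swap {n} {n} _) ⟩
  edges G + edges G ∎
  where
  open ≡-Reasoning
  up : Fin n → Fin n → Bool
  up u v = (toℕ u <ᵇ toℕ v) ∧ adj G u v
  bit : Bool → ℕ
  bit b = if b then 1 else 0
  <ᵇ-true : ∀ {a b} → a < b → (a <ᵇ b) ≡ true
  <ᵇ-true {a} {b} p with a <ᵇ b | <⇒<ᵇ p
  ... | true | _ = refl
  <ᵇ-false : ∀ {a b} → ¬ (a < b) → (a <ᵇ b) ≡ false
  <ᵇ-false {a} {b} p with a <ᵇ b in e
  ... | false = refl
  ... | true  = ⊥-elim (p (<ᵇ⇒< a b (subst T (≡-sym e) tt)))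
  split : ∀ u v → bit (adj G u v) ≡ bit (up u v) + bit (up v u)
  split u v with <-cmp (toℕ u) (toℕ v)
  ... | tri< a _ c rewrite <ᵇ-true a | <ᵇ-false c = ≡-sym (+-identityʳ _)
  ... | tri> a _ c rewrite <ᵇ-true c | <ᵇ-false a = cong bit (sym G u v)
  ... | tri≈ a b c rewrite toℕ-injective b | <ᵇ-false (<-irrefl {toℕ v} refl) | irrefl G v = refl

isolatedClasses : (G : Graph n) → Classes (λ v → ∀ u → adj G v u ≡ false) _≡_ (isolated G)
isolatedClasses G = reClasses (countClasses _)
  (λ e u → not-true (allFinᵇ-sound _ e u))
  (λ h → allFinᵇ-complete _ λ u → cong not (h u))

-- Connected components

data Walk (G : Graph n) (u : Fin n) : Fin n → Set where
  here : Walk G u u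
  _▷_  : ∀ {v w} → Walk G u v → adj G v w ≡ true → Walk G u w

walk-trans : {G : Graph n} → ∀ {u v w} → Walk G u v → Walk G v w → Walk G u w
walk-trans p here    = p
walk-trans p (q ▷ e) = walk-trans p q ▷ e

walk-sym : {G : Graph n} → ∀ {u v} → Walk G u v → Walk G v u
walk-sym here = here
walk-sym {G = G} (p ▷ e) = walk-trans (here ▷ dart-sym G e) (walk-sym p)

reach-sound : (G : Graph n) → ∀ k u v → reachᵏ G k u v ≡ true → Walk G u v
reach-sound G zero    u v e = subst (Walk G u) (==-sound u v e) here
reach-sound G (suc k) u v e with ∨-true {reachᵏ G k u v} e
... | inj₁ p = reach-sound G k u v p
... | inj₂ q with anyFinᵇ-true _ q
...   | w , h = let (p , a) = ∧-true {reachᵏ G k u w} h in reach-sound G k u w p ▷ a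

reach-step : (G : Graph n) → ∀ k u {v w} → reachᵏ G k u v ≡ true → adj G v w ≡ true → reachᵏ G (suc k) u w ≡ true
reach-step G k u {v} {w} p e = ∨-introʳ {reachᵏ G k u w} (anyFinᵇ-intro _ v (∧-intro p e))

-- Hence all of the component of u is reached in n steps.
reach-grows : (G : Graph n) → ∀ u k →
  (∀ v w → reachᵏ G k u v ≡ true → adj G v w ≡ true → reachᵏ G k u w ≡ true) ⊎ k < countFin (reachᵏ G k u)
reach-grows G u zero = inj₂ (≤-trans (s≤s z≤n)
  (countFin-strict {p = λ _ → false} {q = u ==_} (λ _ ()) u refl (==-refl u)))
reach-grows G u (suc k) with any? (λ v → any? (λ w →
    (reachᵏ G k u v ≟ᵇ true) ×-dec ((adj G v w ≟ᵇ true) ×-dec (reachᵏ G k u w ≟ᵇ false))))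
... | no ¬x = inj₁ λ v w p e → ∨-introˡ {reachᵏ G k u w} (k-closed v w (back v p) e)
  where
  k-closed : ∀ v w → reachᵏ G k u v ≡ true → adj G v w ≡ true → reachᵏ G k u w ≡ true
  k-closed v w p e with reachᵏ G k u w in eq
  ... | true  = refl
  ... | false = ⊥-elim (¬x (v , w , p , e , eq))
  back : ∀ v → reachᵏ G (suc k) u v ≡ true → reachᵏ G k u v ≡ true
  back v p with ∨-true {reachᵏ G k u v} p
  ... | inj₁ q = q
  ... | inj₂ q with anyFinᵇ-true _ q
  ...   | w , h = let (r , a) = ∧-true {reachᵏ G k u w} h in k-closed w v r a
... | yes (v , w , p , e , f) with reach-grows G u k
...   | inj₁ c = true≢false (c v w p e) f
...   | inj₂ c = inj₂ (<-≤-trans (s≤s c)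
          (countFin-strict (λ i → ∨-introˡ {reachᵏ G k u i}) w f (reach-step G k u p e)))

reach-complete : (G : Graph n) → ∀ {u v} → Walk G u v → reach G u v ≡ true
reach-complete {n} G {u} here = start n
  where
  start : ∀ k → reachᵏ G k u u ≡ true
  start zero    = ==-refl u
  start (suc k) = ∨-introˡ (start k)
reach-complete {n} G {u} (_▷_ {v} {w} p e) with reach-grows G u n
... | inj₁ c = c v w (reach-complete G p) e
... | inj₂ c = ⊥-elim (<⇒≱ c (countFin-≤ (reachᵏ G n u)))

walk-PER : {G : Graph n} → PER (λ _ → ⊤) (Walk G)
walk-PER = record { ~-sym = λ _ _ → walk-sym ; ~-trans = walk-trans }

componentClasses : (G : Graph n) → Classes (λ _ → ⊤) (Walk G) (components G)
componentClasses {n} G = leastClasses toℕ (λ v → allFinᵇ (λ u → not (reach G u v) ∨ (toℕ v ≤ᵇ toℕ u)))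
  walk-PER (λ _ → here) toℕ-injective below above
  (reClasses (countClasses _) (tt ,_) proj₂)
  where
  below : ∀ {a} → ⊤ → allFinᵇ (λ u → not (reach G u a) ∨ (toℕ a ≤ᵇ toℕ u)) ≡ true →
          ∀ {b} → ⊤ → Walk G a b → toℕ a ≤ toℕ b
  below {a} _ h {b} _ w with ∨-true {not (reach G b a)} (allFinᵇ-sound _ h b)
  ... | inj₁ e = true≢false (reach-complete G (walk-sym w)) (not-true e)
  ... | inj₂ e = ≤ᵇ-sound e
  above : ∀ {a} → ⊤ → allFinᵇ (λ u → not (reach G u a) ∨ (toℕ a ≤ᵇ toℕ u)) ≡ false →
          Σ (Fin n) λ b → ⊤ × Walk G a b × toℕ b < toℕ a
  above {a} _ h with allFinᵇ-false _ h
  ... | b , e with reach G b a in r | toℕ a ≤ᵇ toℕ b in s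
  ...   | true | false = b , tt , walk-sym (reach-sound G n b a r) , ≤ᵇ-false s

-- Merging two permutations at one point of each.

orb-cong : (f : A → A) (h : A → B) (g : B → B) (P : A → Set) → (∀ {a} → P a → P (f a)) →
  (∀ {a} → P a → Orb g (h a) (h (f a))) → ∀ {a b} → P a → Orb f a b → Orb g (h a) (h b)
orb-cong f h g P closed step p (k , e) = go k p e
  where
  go : ∀ k {a b} → P a → iter f k a ≡ b → Orb g (h a) (h b)
  go zero        p refl = orb-refl
  go (suc k) {a} p e    = orb-trans (step p) (go k (closed p) (trans (iter-suc f k a) e))

-- α on A and β on B are merged by redirecting p to the successor of q and q to that of p,
-- which joins the orbits of p and q and keeps all others.
module Splice {A B C : Set} (P : A → Set) (Q : B → Set) (α : A → A) (β : B → B) (γ : C → C)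
  (α-closed : ∀ {a} → P a → P (α a)) (β-closed : ∀ {b} → Q b → Q (β b))
  (α-sym : ∀ {a a'} → P a → Orb α a a' → Orb α a' a)
  (β-sym : ∀ {b b'} → Q b → Orb β b b' → Orb β b' b)
  (_≟₁_ : (a a' : A) → Dec (a ≡ a')) (_≟₂_ : (b b' : B) → Dec (b ≡ b'))
  (ι : A → C) (κ : B → C)
  (ι-inj : ∀ {a a'} → ι a ≡ ι a' → a ≡ a') (κ-inj : ∀ {b b'} → κ b ≡ κ b' → b ≡ b')
  (disjoint : ∀ {a b} → P a → Q b → ι a ≢ κ b)
  (p : A) (Pp : P p) (q : B) (Qq : Q q)
  (γ-ι : ∀ {a} → P a → a ≢ p → γ (ι a) ≡ ι (α a))
  (γ-κ : ∀ {b} → Q b → b ≢ q → γ (κ b) ≡ κ (β b))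
  (γ-p : γ (ι p) ≡ κ (β q)) (γ-q : γ (κ q) ≡ ι (α p)) where

  private
    untilᵖ : ∀ k {a} → P a → iter α k a ≡ p → Orb γ (ι a) (ι p)
    untilᵖ zero    _ refl = orb-refl
    untilᵖ (suc k) {a} Pa e with a ≟₁ p
    ... | yes refl = orb-refl
    ... | no a≢p = orb-trans (1 , γ-ι Pa a≢p) (untilᵖ k (α-closed Pa) (trans (iter-suc α k a) e))

    until-q : ∀ k {b} → Q b → iter β k b ≡ q → Orb γ (κ b) (κ q)
    until-q zero    _ refl = orb-refl
    until-q (suc k) {b} Qb e with b ≟₂ q
    ... | yes refl = orb-refl
    ... | no b≢q = orb-trans (1 , γ-κ Qb b≢q) (until-q k (β-closed Qb) (trans (iter-suc β k b) e))

  p⇝q : Orb γ (ι p) (κ q)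
  p⇝q = let (k , e) = β-sym Qq orb-step in orb-trans (1 , γ-p) (until-q k (β-closed Qq) e)

  q⇝p : Orb γ (κ q) (ι p)
  q⇝p = let (k , e) = α-sym Pp orb-step in orb-trans (1 , γ-q) (untilᵖ k (α-closed Pp) e)

  orb-ι : ∀ {a a'} → P a → Orb α a a' → Orb γ (ι a) (ι a')
  orb-ι = orb-cong α ι γ P α-closed step
    where
    step : ∀ {a} → P a → Orb γ (ι a) (ι (α a))
    step {a} Pa with a ≟₁ p
    ... | yes refl = orb-trans p⇝q (1 , γ-q)
    ... | no a≢p = 1 , γ-ι Pa a≢p

  orb-κ : ∀ {b b'} → Q b → Orb β b b' → Orb γ (κ b) (κ b')
  orb-κ = orb-cong β κ γ Q β-closed step
    where
    step : ∀ {b} → Q b → Orb γ (κ b) (κ (β b))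
    step {b} Qb with b ≟₂ q
    ... | yes refl = orb-trans q⇝p (1 , γ-p)
    ... | no b≢q = 1 , γ-κ Qb b≢q

  private
    -- A set closed under γ, given on the two sides by S and T; at the crossings behind `p` and `q`
    -- membership passes to the other side. Small sets of this kind show which orbits are not
    -- joined.
    module Invariant (S : A → Set) (T : B → Set)
      (S-step : ∀ {a} → S a → S (α a)) (T-step : ∀ {b} → T b → T (β b))
      (S-p : S p → T (β q)) (T-q : T q → S (α p)) where

      data In : C → Set where
        left  : ∀ {a} → P a → S a → In (ι a)
        right : ∀ {b} → Q b → T b → In (κ b)

      step : ∀ {c} → In c → In (γ c)
      step (left {a} Pa s) with a ≟₁ p
      ... | yes refl = subst In (≡-sym γ-p) (right (β-closed Qq) (S-p s))
      ... | no a≢p = subst In (≡-sym (γ-ι Pa a≢p)) (left (α-closed Pa) (S-step s))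
      step (right {b} Qb t) with b ≟₂ q
      ... | yes refl = subst In (≡-sym γ-q) (left (α-closed Pp) (T-q t))
      ... | no b≢q = subst In (≡-sym (γ-κ Qb b≢q)) (right (β-closed Qb) (T-step t))

      steps : ∀ k {c} → In c → In (iter γ k c)
      steps zero    i = i
      steps (suc k) i = step (steps k i)

      fromLeft : ∀ {a c} → P a → In c → c ≡ ι a → S a
      fromLeft Pa (left Pa' s)  e = subst S (ι-inj e) s
      fromLeft Pa (right Qb t) e = ⊥-elim (disjoint Pa Qb (≡-sym e))

      fromRight : ∀ {b c} → Q b → In c → c ≡ κ b → T b
      fromRight Qb (left Pa s)   e = ⊥-elim (disjoint Pa Qb e)
      fromRight Qb (right Qb' t) e = subst T (κ-inj e) t

    -- From `a` one meets the α-orbit of `a` and, provided that it contains `p`, the β-orbit of `q`.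
    module FromA (a : A) = Invariant (Orb α a) (λ b → Orb α a p × Orb β q b)
      (λ o → orb-trans o orb-step) (λ o → proj₁ o , orb-trans (proj₂ o) orb-step)
      (λ o → o , orb-step) (λ o → orb-trans (proj₁ o) orb-step)

    -- An orbit that misses `q` has no way out of B, so the invariant is empty on the side of A.
    module FromB (b : B) (b≁q : ¬ Orb β b q) = Invariant (λ _ → ⊥) (Orb β b)
      (λ ()) (λ o → orb-trans o orb-step) (λ ()) b≁q

  orb-ι⁻¹ : ∀ {a a'} → P a → P a' → Orb γ (ι a) (ι a') → Orb α a a'
  orb-ι⁻¹ {a} Pa Pa' (k , e) = fromLeft Pa' (steps k (left Pa orb-refl)) e
    where open FromA a

  orb-κ⁻¹ : ∀ {b b'} → Q b → Q b' → ¬ Orb β b q → Orb γ (κ b) (κ b') → Orb β b b'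
  orb-κ⁻¹ {b} Qb Qb' h (k , e) = fromRight Qb' (steps k (right Qb orb-refl)) e
    where open FromB b h

  ¬orb-ικ : ∀ {a b} → P a → Q b → ¬ Orb β b q → ¬ Orb γ (ι a) (κ b)
  ¬orb-ικ {a} Pa Qb h (k , e) = h (β-sym Qq (proj₂ (fromRight Qb (steps k (left Pa orb-refl)) e)))
    where open FromA a

  ¬orb-κι : ∀ {a b} → P a → Q b → ¬ Orb β b q → ¬ Orb γ (κ b) (ι a)
  ¬orb-κι {a} {b} Pa Qb h (k , e) = fromLeft Pa (steps k (right Qb orb-refl)) e
    where open FromB b h

  module _ (α-inj : ∀ {a a'} → P a → P a' → α a ≡ α a' → a ≡ a')
           (β-inj : ∀ {b b'} → Q b → Q b' → β b ≡ β b' → b ≡ b') where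

    -- For faces only the orbits of the splice matter. Its other use is the cyclic order at the root
    -- of a gluing, where γ itself has to be injective.
    γ-inj-ι : ∀ {a a'} → P a → P a' → γ (ι a) ≡ γ (ι a') → a ≡ a'
    γ-inj-ι {a} {a'} Pa Pa' e with a ≟₁ p | a' ≟₁ p
    ... | yes refl | yes refl = refl
    ... | yes refl | no n  = ⊥-elim (disjoint (α-closed Pa') (β-closed Qq)
                               (trans (≡-sym (γ-ι Pa' n)) (trans (≡-sym e) γ-p)))
    ... | no n  | yes refl = ⊥-elim (disjoint (α-closed Pa) (β-closed Qq)
                               (trans (≡-sym (γ-ι Pa n)) (trans e γ-p)))
    ... | no n  | no n' = α-inj Pa Pa' (ι-inj (trans (≡-sym (γ-ι Pa n)) (trans e (γ-ι Pa' n'))))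

    γ-inj-κ : ∀ {b b'} → Q b → Q b' → γ (κ b) ≡ γ (κ b') → b ≡ b'
    γ-inj-κ {b} {b'} Qb Qb' e with b ≟₂ q | b' ≟₂ q
    ... | yes refl | yes refl = refl
    ... | yes refl | no n  = ⊥-elim (disjoint (α-closed Pp) (β-closed Qb')
                               (trans (≡-sym γ-q) (trans e (γ-κ Qb' n))))
    ... | no n  | yes refl = ⊥-elim (disjoint (α-closed Pp) (β-closed Qb)
                               (trans (≡-sym γ-q) (trans (≡-sym e) (γ-κ Qb n))))
    ... | no n  | no n' = β-inj Qb Qb' (κ-inj (trans (≡-sym (γ-κ Qb n)) (trans e (γ-κ Qb' n'))))

    γ-inj-ικ : ∀ {a b} → P a → Q b → γ (ι a) ≢ γ (κ b)
    γ-inj-ικ {a} {b} Pa Qb e with a ≟₁ p | b ≟₂ q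
    ... | yes refl | yes refl = disjoint (α-closed Pa) (β-closed Qb) (trans (≡-sym γ-q) (trans (≡-sym e) γ-p))
    ... | yes refl | no n  = n (≡-sym (β-inj Qq Qb (κ-inj (trans (≡-sym γ-p) (trans e (γ-κ Qb n))))))
    ... | no n  | yes refl = n (α-inj Pa Pp (ι-inj (trans (≡-sym (γ-ι Pa n)) (trans e γ-q))))
    ... | no n  | no n' = disjoint (α-closed Pa) (β-closed Qb) (trans (≡-sym (γ-ι Pa n)) (trans e (γ-κ Qb n')))

-- The union of two graphs in a vertex.

≢true : ∀ {b} → b ≢ true → b ≡ false
≢true {true}  h = ⊥-elim (h refl)
≢true {false} h = refl

find : (f : Fin k → Fin n) → ∀ u → Dec (Σ (Fin k) λ i → f i ≡ u)
find f u = any? (λ i → f i Fin.≟ u)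

walk-map : {G : Graph m} {H : Graph n} (π : Fin m → Fin n) →
  (∀ {u v} → adj G u v ≡ true → Walk H (π u) (π v)) → ∀ {u v} → Walk G u v → Walk H (π u) (π v)
walk-map π h here    = here
walk-map π h (w ▷ e) = walk-trans (walk-map π h w) (h e)

walk-isolated : {G : Graph n} → ∀ {u v} → (∀ w → adj G u w ≡ false) → Walk G u v → u ≡ v
walk-isolated h here = refl
walk-isolated h (w ▷ e) with walk-isolated h w
... | refl = true≢false e (h _)

-- Every vertex but the first has a neighbour that precedes it; in particular L is connected.
Rooted : Graph (suc n) → Set
Rooted {n} L = ∀ (i : Fin n) → Σ (Fin (suc n)) λ j → toℕ j ≤ toℕ i × adj L (suc i) j ≡ true

rooted-walk : (L : Graph (suc n)) → Rooted L → ∀ i → Walk L zero i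
rooted-walk {n} L r i = go i (<-wellFounded _)
  where
  go : ∀ i → Acc _<_ (toℕ i) → Walk L zero i
  go zero    _ = here
  go (suc i) (acc rs) = let (j , j≤i , e) = r i in go j (rs (s≤s j≤i)) ▷ dart-sym L e

-- G is the union of H and of a copy of L that meets H in (at most) the vertex f zero.
module Union {n k} (H : Graph n) (L : Graph (suc (suc k))) (f : Fin (suc (suc k)) → Fin n)
  (f-inj : ∀ {i j} → f i ≡ f j → i ≡ j)
  (isolatedH : ∀ i v → adj H (f (suc i)) v ≡ false) (rooted : Rooted L) (G : Graph n)
  (split : ∀ {u v} → adj G u v ≡ true →
    adj H u v ≡ true ⊎ (Σ _ λ i → Σ _ λ j → u ≡ f i × v ≡ f j × adj L i j ≡ true))
  (H⊆G : ∀ {u v} → adj H u v ≡ true → adj G u v ≡ true)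
  (L⊆G : ∀ {i j} → adj L i j ≡ true → adj G (f i) (f j) ≡ true) where

  root : Fin n
  root = f zero

  H-root : ∀ {u v i} → adj H u v ≡ true → u ≡ f i → u ≡ root
  H-root {i = zero}  e refl = refl
  H-root {i = suc i} e refl = true≢false e (isolatedH i _)

  H∩L : ∀ {u v i j} → adj H u v ≡ true → u ≡ f i → v ≢ f j
  H∩L e p q = dart-irrefl H e (trans (H-root e p) (≡-sym (H-root (dart-sym H e) q)))

  private
    -- The contraction of the copy of L onto its root; it turns walks in G into walks in H.
    π : Fin n → Fin n
    π u with find f u
    ... | yes _ = root
    ... | no _  = u

    π-image : ∀ i → π (f i) ≡ root
    π-image i with find f (f i)
    ... | yes _ = refl
    ... | no ¬p = ⊥-elim (¬p (i , refl))

    π-H : ∀ {u} → (∀ i → f (suc i) ≢ u) → π u ≡ u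
    π-H {u} h with find f u
    ... | yes (zero , p)  = p
    ... | yes (suc i , p) = ⊥-elim (h i p)
    ... | no _ = refl

    π-≢ : ∀ u i → f (suc i) ≢ π u
    π-≢ u i e with find f u
    ... | yes _ with () ← f-inj e
    ... | no ¬p = ¬p (suc i , e)

    fromRoot : ∀ i → Walk G root (f i)
    fromRoot i = walk-map f (λ e → here ▷ L⊆G e) (rooted-walk L rooted i)

    π-walk : ∀ u → Walk G u (π u)
    π-walk u with find f u
    ... | yes (i , refl) = walk-sym (fromRoot i)
    ... | no _ = here

    π-step : ∀ {u v} → adj G u v ≡ true → Walk H (π u) (π v)
    π-step {u} {v} e with split e
    ... | inj₁ h = subst (λ s → Walk H s (π v)) (≡-sym (πu h))
                     (subst (Walk H u) (≡-sym (πu (dart-sym H h))) (here ▷ h))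
      where
      πu : ∀ {u v} → adj H u v ≡ true → π u ≡ u
      πu h = π-H λ { i refl → true≢false h (isolatedH i _) }
    ... | inj₂ (i , j , refl , refl , _) =
      subst (λ s → Walk H s (π (f j))) (≡-sym (π-image i)) (subst (Walk H root) (≡-sym (π-image j)) here)

  L-neighbour : ∀ i → Σ _ λ j → adj L i j ≡ true
  L-neighbour (suc i) = let (j , _ , e) = rooted i in j , e
  L-neighbour zero with rooted zero
  ... | zero , _ , e = suc zero , dart-sym L e

  H-isolated : ∀ {v} → (∀ u → adj G v u ≡ false) → ∀ u → adj H v u ≡ false
  H-isolated h u = ≢true λ e → true≢false (H⊆G e) (h u)

  G-isolated : ∀ {v} → (∀ i → f i ≢ v) → (∀ u → adj H v u ≡ false) → ∀ u → adj G v u ≡ false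
  G-isolated h iso u = ≢true λ e → case split e of λ where
    (inj₁ e') → true≢false e' (iso u)
    (inj₂ (i , _ , refl , _)) → h i refl

  ¬image-isolated : ∀ i → ¬ (∀ u → adj G (f i) u ≡ false)
  ¬image-isolated i h = let (j , e) = L-neighbour i in true≢false (L⊆G e) (h _)

  darts-union : darts G ≡ darts H + darts L
  darts-union = classes-unique ≡-PER (dartClasses G)
    (glueClasses (dartClasses H) (dartClasses L) id (λ { (i , j) → f i , f j }) H⊆G L⊆G
      (λ {d} e → case split e of λ where
        (inj₁ h) → inj₁ (d , h , λ {_} _ → id)
        (inj₂ (i , j , refl , refl , h)) → inj₂ ((i , j) , h , λ { {_} _ refl → refl }))
      (λ _ _ → id)
      (λ _ _ e → cong₂ _,_ (f-inj (cong proj₁ e)) (f-inj (cong proj₂ e)))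
      (λ { h _ refl → H∩L h refl refl })
      (λ { h _ refl → H∩L h refl refl }))

  -- The `suc k` vertices of the copy other than the root are components of their own in H and join
  -- the component of the root in G.
  components-union : components G + suc k ≡ components H
  components-union = classes-unique walk-PER
    (glueClasses (componentClasses G) (finClasses (suc k)) π (f ∘ suc) (λ _ → tt) (λ _ → tt)
      (λ {u} _ → cov u)
      (λ {a} {a'} _ _ w → walk-trans (walk-trans (π-walk a) (walk-map id (λ e → here ▷ H⊆G e) w)) (walk-sym (π-walk a')))
      (λ {i} _ _ w → Finₚ.suc-injective (f-inj (walk-isolated (isolatedH i) w)))
      (λ {a} {i} _ _ w → π-≢ a i (walk-isolated (isolatedH i) (walk-sym w)))
      (λ {a} {i} _ _ w → π-≢ a i (walk-isolated (isolatedH i) w)))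
    (componentClasses H)
    where
    cov : ∀ u → (Σ (Fin n) λ a → ⊤ × (∀ {r} → ⊤ → Walk G a r → Walk H u (π r)))
              ⊎ (Σ (Fin (suc k)) λ i → ⊤ × (∀ {r} → ⊤ → i ≡ r → Walk H u (f (suc r))))
    cov u with any? (λ i → f (suc i) Fin.≟ u)
    ... | yes (i , refl) = inj₂ (i , tt , λ { _ refl → here })
    ... | no ¬p = inj₁ (u , tt , λ {r} _ w →
            subst (λ s → Walk H s (π r)) (π-H λ i e → ¬p (i , e)) (walk-map π π-step w))

  isolated-union⁺ : ∀ {y} → adj H root y ≡ true → isolated G + suc k ≡ isolated H
  isolated-union⁺ {y} ry = classes-unique ≡-PER
    (glueClasses (isolatedClasses G) (finClasses (suc k)) id (f ∘ suc) H-isolated (λ {i} _ → isolatedH i)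
      (λ {v} → cov v)
      (λ _ _ → id) (λ _ _ e → Finₚ.suc-injective (f-inj e))
      (λ { h _ refl → ¬image-isolated _ h }) (λ { h _ refl → ¬image-isolated _ h }))
    (isolatedClasses H)
    where
    cov : ∀ v → (∀ u → adj H v u ≡ false) →
      (Σ (Fin n) λ a → (∀ u → adj G a u ≡ false) × (∀ {r} → (∀ u → adj G r u ≡ false) → a ≡ r → v ≡ r))
      ⊎ (Σ (Fin (suc k)) λ i → ⊤ × (∀ {r} → ⊤ → i ≡ r → v ≡ f (suc r)))
    cov v iso with find f v
    ... | yes (zero , refl)  = true≢false ry (iso y)
    ... | yes (suc i , refl) = inj₂ (i , tt , λ { _ refl → refl })
    ... | no ¬p = inj₁ (v , G-isolated (λ i e → ¬p (i , e)) iso , λ _ → id)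

  isolated-union⁰ : (∀ v → adj H root v ≡ false) → isolated G + suc (suc k) ≡ isolated H
  isolated-union⁰ rv = classes-unique ≡-PER
    (glueClasses (isolatedClasses G) (finClasses (suc (suc k))) id f H-isolated
      (λ { {zero} _ → rv ; {suc i} _ → isolatedH i })
      (λ {v} → cov v)
      (λ _ _ → id) (λ _ _ → f-inj)
      (λ { h _ refl → ¬image-isolated _ h }) (λ { h _ refl → ¬image-isolated _ h }))
    (isolatedClasses H)
    where
    cov : ∀ v → (∀ u → adj H v u ≡ false) →
      (Σ (Fin n) λ a → (∀ u → adj G a u ≡ false) × (∀ {r} → (∀ u → adj G r u ≡ false) → a ≡ r → v ≡ r))
      ⊎ (Σ (Fin (suc (suc k))) λ i → ⊤ × (∀ {r} → ⊤ → i ≡ r → v ≡ f r))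
    cov v iso with find f v
    ... | yes (i , refl) = inj₂ (i , tt , λ { _ refl → refl })
    ... | no ¬p = inj₁ (v , G-isolated (λ i e → ¬p (i , e)) iso , λ _ → id)

  -- The cyclic order of G at the root is that of H and L when one of them is trivial there;
  -- otherwise L is inserted between y and its successor.
  data Corner : Set where
    none : (∀ v → adj H root v ≡ false) → Corner
    at   : ∀ y z → adj H root y ≡ true → adj L zero z ≡ true → Corner

  module Embedded (RH : Rotation H) (RL : Rotation L) where

    Merged : (Fin n → Fin n → Fin n) → Corner → Set
    Merged σ (none _) =
      (∀ {v u} → adj H v u ≡ true → σ v u ≡ ρ RH v u) ×
      (∀ {i j} → adj L i j ≡ true → σ (f i) (f j) ≡ f (ρ RL i j))
    Merged σ (at y z _ _) =
      ((∀ {v u} → adj H v u ≡ true → (v , u) ≢ (root , y) → σ v u ≡ ρ RH v u) ×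
       (∀ {i j} → adj L i j ≡ true → (i , j) ≢ (zero , z) → σ (f i) (f j) ≡ f (ρ RL i j))) ×
      (σ root y ≡ f (ρ RL zero z)) × (σ root (f z) ≡ ρ RH root y)

    private
      module FH = Faces RH
      module FL = Faces RL

    module _ (RG : Rotation G) where
      private
        module FG = Faces RG
        φ : Fin n × Fin n → Fin n × Fin n
        φ = faceStep RG
        f² : Fin (suc (suc k)) × Fin (suc (suc k)) → Fin n × Fin n
        f² (i , j) = f i , f j
        f²-inj : ∀ {d e} → f² d ≡ f² e → d ≡ e
        f²-inj e = cong₂ _,_ (f-inj (cong proj₁ e)) (f-inj (cong proj₂ e))
        _≟²_ : ∀ {m} (d e : Fin m × Fin m) → Dec (d ≡ e)
        _≟²_ = ≡-dec Fin._≟_ Fin._≟_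
        disjoint : ∀ {d e} → Dart H d → Dart L e → d ≢ f² e
        disjoint h _ refl = H∩L h refl refl
        flip : ∀ {m} {a b c d : Fin m} → (a , b) ≡ (c , d) → (b , a) ≡ (d , c)
        flip refl = refl

      faces-union⁰ : ∀ {iso} → Merged (ρ RG) (none iso) → faces RG ≡ faces RH + faces RL
      faces-union⁰ (onH , onL) = classes-unique FG.orb-PER FG.faceClasses
        (glueClasses FH.faceClasses FL.faceClasses id f² H⊆G L⊆G
          (λ {d} e → case split e of λ where
             (inj₁ h) → inj₁ (d , h , λ {_} _ o → orbH h o)
             (inj₂ (i , j , refl , refl , h)) → inj₂ ((i , j) , h , λ {_} _ o → orbL h o))
          (λ { {d} h h' (k , e) → k , trans (≡-sym (iterH k h)) e })
          (λ { {d} h h' (k , e) → k , f²-inj (trans (≡-sym (iterL k h)) e) })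
          (λ { {d} h h' (k , e) → disjoint (FH.iter-closed k h) h' (trans (≡-sym (iterH k h)) e) })
          (λ { {d} {d'} h h' (k , e) → disjoint h (FL.iter-closed k h') (≡-sym (trans (≡-sym (iterL k h')) e)) }))
        where
        iterH : ∀ k {d} → Dart H d → iter φ k d ≡ iter (faceStep RH) k d
        iterH zero    h = refl
        iterH (suc k) {d} h = trans (cong φ (iterH k h)) (cong (_ ,_) (onH (dart-sym H (FH.iter-closed k h))))
        iterL : ∀ k {d} → Dart L d → iter φ k (f² d) ≡ f² (iter (faceStep RL) k d)
        iterL zero    h = refl
        iterL (suc k) {d} h = trans (cong φ (iterL k h)) (cong (_ ,_) (onL (dart-sym L (FL.iter-closed k h))))
        orbH : ∀ {d e} → Dart H d → Orb (faceStep RH) d e → Orb φ d e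
        orbH h (k , e) = k , trans (iterH k h) e
        orbL : ∀ {d e} → Dart L d → Orb (faceStep RL) d e → Orb φ (f² d) (f² e)
        orbL h (k , e) = k , trans (iterL k h) (cong f² e)

      -- The face step from a dart (u, v) consults the rotation at v. Exchanging the successors of
      -- `y` and `z` at the root therefore redirects only the darts from `y` and `z` into the root,
      -- and the two faces through them become one.
      faces-union⁺ : ∀ {y z ry rz} → Merged (ρ RG) (at y z ry rz) → suc (faces RG) ≡ faces RH + faces RL
      faces-union⁺ {y} {z} {ry} {rz} ((onH , onL) , onY , onZ)
        with dropClass FL.orb-PER FL.faceClasses {z , zero} (dart-sym L rz)
      ... | l , FL≡ , rest = trans (cong suc (classes-unique FG.orb-PER FG.faceClasses glued))
                                   (trans (≡-sym (+-suc (faces RH) l)) (cong (faces RH +_) (≡-sym FL≡)))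
        where
        φ-H : ∀ {d} → Dart H d → d ≢ (y , root) → φ d ≡ faceStep RH d
        φ-H {u , v} h ne = cong (v ,_) (onH (dart-sym H h) (ne ∘ flip))
        φ-L : ∀ {d} → Dart L d → d ≢ (z , zero) → φ (f² d) ≡ f² (faceStep RL d)
        φ-L {i , j} h ne = cong (f j ,_) (onL (dart-sym L h) (ne ∘ flip))
        module S = Splice (Dart H) (Dart L) (faceStep RH) (faceStep RL) φ
          FH.faceStep-closed FL.faceStep-closed FH.orb-sym FL.orb-sym _≟²_ _≟²_ id f² id f²-inj disjoint
          (y , root) (dart-sym H ry) (z , zero) (dart-sym L rz)
          φ-H φ-L (cong (root ,_) onY) (cong (root ,_) onZ)
        glued : Classes (Dart G) (Orb φ) (faces RH + l)
        glued = glueClasses FH.faceClasses rest id f² H⊆G (λ { (h , _) → L⊆G h })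
          (λ {d} e → case split e of λ where
             (inj₁ h) → inj₁ (d , h , λ {_} _ → S.orb-ι h)
             (inj₂ (i , j , refl , refl , h)) →
               -- A dart of L in the merged face is represented on the side of H; the other faces of
               -- L are those left by `dropClass`.
               case same? FL.orb-PER FL.faceClasses h (dart-sym L rz) of λ where
                 (yes o) → inj₁ ((y , root) , dart-sym H ry , λ {_} _ o' →
                    orb-trans (S.orb-κ h o) (orb-trans S.q⇝p (S.orb-ι (dart-sym H ry) o')))
                 (no ¬o) → inj₂ ((i , j) , (h , ¬o) , λ {_} _ → S.orb-κ h))
          S.orb-ι⁻¹
          (λ { (h , ¬o) (h' , _) → S.orb-κ⁻¹ h h' ¬o })
          (λ { h (h' , ¬o) → S.¬orb-ικ h h' ¬o })
          (λ { h (h' , ¬o) → S.¬orb-κι h h' ¬o })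

      -- If the root is isolated in H, no faces merge but one more isolated vertex is lost;
      -- otherwise two faces become one and the root was not isolated. The sum of both counts
      -- changes by the same amount in either case, so Euler's formula needs no case distinction.
      faces+isolated-union : ∀ c → Merged (ρ RG) c →
        faces RG + isolated G + suc (suc k) ≡ faces RH + faces RL + isolated H
      faces+isolated-union (none iso) m = trans (+-assoc (faces RG) _ _)
        (cong₂ _+_ (faces-union⁰ {iso} m) (isolated-union⁰ iso))
      faces+isolated-union (at y z ry rz) m = trans (+-suc _ (suc k)) (trans (cong suc (+-assoc (faces RG) _ _))
        (cong₂ _+_ (faces-union⁺ {ry = ry} {rz} m) (isolated-union⁺ ry)))

-- Cyclic orders

record CyclicOn {A : Set} (P : A → Set) (σ : A → A) : Set where
  field
    stays     : ∀ {a} → P a → P (σ a)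
    injective : ∀ {a b} → P a → P b → σ a ≡ σ b → a ≡ b
    transit   : ∀ {a b} → P a → P b → Orb σ a b
open CyclicOn

Nbr : Graph n → Fin n → Fin n → Set
Nbr G v u = adj G v u ≡ true

rotation : {G : Graph n} (σ : Fin n → Fin n → Fin n) → (∀ v → CyclicOn (Nbr G v) (σ v)) → Rotation G
rotation σ c = record
  { ρ = σ ; closed = λ v u → stays (c v) ; inj = λ v u w → injective (c v) ; cyclic = λ v u w → transit (c v) }

cyclicAt : {G : Graph n} (R : Rotation G) → ∀ v → CyclicOn (Nbr G v) (ρ R v)
cyclicAt R v = record { stays = closed R v _ ; injective = inj R v _ _ ; transit = cyclic R v _ _ }

cyclic-sym : {P : Fin n → Set} {σ : Fin n → Fin n} → CyclicOn P σ → ∀ {a b} → P a → Orb σ a b → Orb σ b a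
cyclic-sym {n} {P} {σ} c = Permutation.orb-sym n id id σ P (stays c) (injective c)

cyclic-empty : {P : A → Set} {σ : A → A} → (∀ {a} → ¬ P a) → CyclicOn P σ
cyclic-empty h = record
  { stays = λ p → ⊥-elim (h p) ; injective = λ p → ⊥-elim (h p) ; transit = λ p → ⊥-elim (h p) }

cyclic-image : {P : A → Set} {σ : A → A} {Q : B → Set} {τ : B → B} (f : A → B) → CyclicOn P σ →
  (∀ {a} → P a → τ (f a) ≡ f (σ a)) → (∀ {a b} → f a ≡ f b → a ≡ b) →
  (∀ {b} → Q b → Σ A λ a → b ≡ f a × P a) → (∀ {a} → P a → Q (f a)) → CyclicOn Q τ
cyclic-image {P = P} {σ} {Q} {τ} f c e f-inj pre P⇒Q = record
  { stays = λ q → case pre q of λ { (a , refl , p) → subst Q (≡-sym (e p)) (P⇒Q (stays c p)) }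
  ; injective = λ q q' eq → case (pre q , pre q') of λ { ((a , refl , p) , (a' , refl , p')) →
      cong f (injective c p p' (f-inj (trans (≡-sym (e p)) (trans eq (e p'))))) }
  ; transit = λ q q' → case (pre q , pre q') of λ { ((a , refl , p) , (a' , refl , p')) →
      orb-cong σ f τ P (stays c) (λ p → 1 , e p) p (transit c p p') }
  }

cyclic-preimage : {P : A → Set} {σ : A → A} {Q : B → Set} {τ : B → B} (f : A → B) → CyclicOn Q τ →
  (∀ {a} → P a → f (σ a) ≡ τ (f a)) → (∀ {a b} → f a ≡ f b → a ≡ b) →
  (∀ {a} → P a → Q (f a)) → (∀ {a} → Q (f a) → P a) → CyclicOn P σ
cyclic-preimage {P = P} {σ} {Q} {τ} f c e f-inj P⇒Q Q⇒P = record
  { stays = stays'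
  ; injective = λ p p' eq → f-inj (injective c (P⇒Q p) (P⇒Q p') (trans (≡-sym (e p)) (trans (cong f eq) (e p'))))
  ; transit = λ p p' → let (k , o) = transit c (P⇒Q p) (P⇒Q p') in k , f-inj (trans (iterate k p) o)
  }
  where
  stays' : ∀ {a} → P a → P (σ a)
  stays' p = Q⇒P (subst Q (≡-sym (e p)) (stays c (P⇒Q p)))
  P-iter : ∀ k {a} → P a → P (iter σ k a)
  P-iter zero p = p
  P-iter (suc k) p = stays' (P-iter k p)
  iterate : ∀ k {a} → P a → f (iter σ k a) ≡ iter τ k (f a)
  iterate zero    p = refl
  iterate (suc k) p = trans (e (P-iter k p)) (cong τ (iterate k p))

-- Gluing an embedded graph to another one.

copyAdj : (L : Graph k) {f : Fin k → Fin n} → ∀ {u v} →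
          Dec (Σ (Fin k) λ i → f i ≡ u) → Dec (Σ (Fin k) λ i → f i ≡ v) → Bool
copyAdj L (yes (i , _)) (yes (j , _)) = adj L i j
copyAdj L (yes _)       (no _)        = false
copyAdj L (no _)        _             = false

-- An equation between decisions, so that rewriting with it evaluates adjacency and rotation at the
-- vertices of the copy.
find-image : (f : Fin k → Fin n) → (∀ {i j} → f i ≡ f j → i ≡ j) → ∀ i → find f (f i) ≡ yes (i , refl)
find-image f f-inj i with find f (f i)
... | no ¬p = ⊥-elim (¬p (i , refl))
... | yes (j , p) with f-inj p
...   | refl with p
...     | refl = refl

module Glue {n k} (H : Graph n) (RH : Rotation H) (L : Graph (suc (suc k))) (RL : Rotation L)
  (f : Fin (suc (suc k)) → Fin n) (f-inj : ∀ {i j} → f i ≡ f j → i ≡ j)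
  (isolatedH : ∀ i v → adj H (f (suc i)) v ≡ false) (rooted : Rooted L) where

  glued : Graph n
  glued = record
    { adj    = λ u v → adj H u v ∨ copyAdj L (find f u) (find f v)
    ; sym    = λ u v → cong₂ _∨_ (sym H u v) (copy-sym (find f u) (find f v))
    ; irrefl = λ v → trans (cong (_∨ _) (irrefl H v)) (copy-irrefl (find f v))
    }
    where
    copy-sym : ∀ {u v} (p : Dec (Σ _ λ i → f i ≡ u)) (q : Dec (Σ _ λ i → f i ≡ v)) → copyAdj L p q ≡ copyAdj L q p
    copy-sym (yes (i , _)) (yes (j , _)) = sym L i j
    copy-sym (yes _) (no _)  = refl
    copy-sym (no _)  (yes _) = refl
    copy-sym (no _)  (no _)  = refl
    copy-irrefl : ∀ {v} (p : Dec (Σ _ λ i → f i ≡ v)) → copyAdj L p p ≡ false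
    copy-irrefl (yes (i , _)) = irrefl L i
    copy-irrefl (no _) = refl

  H⊆glued : ∀ {u v} → adj H u v ≡ true → adj glued u v ≡ true
  H⊆glued = ∨-introˡ

  L⊆glued : ∀ {i j} → adj L i j ≡ true → adj glued (f i) (f j) ≡ true
  L⊆glued {i} {j} e rewrite find-image f f-inj i | find-image f f-inj j = ∨-introʳ {adj H (f i) (f j)} e

  split : ∀ {u v} → adj glued u v ≡ true →
    adj H u v ≡ true ⊎ (Σ _ λ i → Σ _ λ j → u ≡ f i × v ≡ f j × adj L i j ≡ true)
  split {u} {v} e with ∨-true {adj H u v} e
  ... | inj₁ h = inj₁ h
  ... | inj₂ c with find f u | find f v
  ...   | yes (i , p) | yes (j , q) = inj₂ (i , j , ≡-sym p , ≡-sym q , c)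

  open Union H L f f-inj isolatedH rooted glued split H⊆glued L⊆glued public
  open Embedded RH RL public

  private
    σ' : Corner → ∀ u v → Dec (Σ _ λ i → f i ≡ u) → Dec (Σ _ λ i → f i ≡ v) → Fin n
    σ' c u v (no _) _ = ρ RH u v
    σ' c u v (yes (suc i , _)) (yes (j , _)) = f (ρ RL (suc i) j)
    -- Here `v` is not a neighbour of `u`, and the value is a mere default.
    σ' c u v (yes (suc i , _)) (no _) = v
    σ' (none _) u v (yes (zero , _)) (yes (j , _)) = f (ρ RL zero j)
    σ' (none _) u v (yes (zero , _)) (no _) = v
    σ' (at y z _ _) u v (yes (zero , _)) (yes (j , _)) with j Fin.≟ z
    ... | yes _ = ρ RH u y
    ... | no _  = f (ρ RL zero j)
    σ' (at y z _ _) u v (yes (zero , _)) (no _) with v Fin.≟ y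
    ... | yes _ = f (ρ RL zero z)
    ... | no _  = ρ RH u v

    σ : Corner → Fin n → Fin n → Fin n
    σ c u v = σ' c u v (find f u) (find f v)

    σ-outside : ∀ c {v u} → (∀ i → f i ≢ v) → σ c v u ≡ ρ RH v u
    σ-outside c {v} {u} h with find f v
    ... | yes (i , p) = ⊥-elim (h i p)
    ... | no _ = refl

    σ-suc : ∀ c i j → σ c (f (suc i)) (f j) ≡ f (ρ RL (suc i) j)
    σ-suc c i j rewrite find-image f f-inj (suc i) | find-image f f-inj j = refl

    merged : ∀ c → Merged (σ c) c
    merged c@(none iso) = (λ {v} {u} h → onH h) , λ {i} {j} _ → onL i j
      where
      onH : ∀ {v u} → adj H v u ≡ true → σ c v u ≡ ρ RH v u
      onH {v} {u} h with find f v
      ... | yes (zero , refl)  = true≢false h (iso u)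
      ... | yes (suc i , refl) = true≢false h (isolatedH i u)
      ... | no _ = refl
      onL : ∀ i j → σ c (f i) (f j) ≡ f (ρ RL i j)
      onL (suc i) j = σ-suc c i j
      onL zero    j rewrite find-image f f-inj zero | find-image f f-inj j = refl
    merged c@(at y z ry rz) = ((λ {v} {u} → onH) , λ {i} {j} _ → onL i j) , onY , onZ
      where
      onH : ∀ {v u} → adj H v u ≡ true → (v , u) ≢ (root , y) → σ c v u ≡ ρ RH v u
      onH {v} {u} h ne with find f v
      ... | no _ = refl
      ... | yes (suc i , refl) = true≢false h (isolatedH i u)
      ... | yes (zero , refl) with find f u
      ...   | yes (j , q) = ⊥-elim (H∩L h refl (≡-sym q))
      ...   | no _ with u Fin.≟ y
      ...     | yes refl = ⊥-elim (ne refl)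
      ...     | no _ = refl
      onL : ∀ i j → (i , j) ≢ (zero , z) → σ c (f i) (f j) ≡ f (ρ RL i j)
      onL (suc i) j ne = σ-suc c i j
      onL zero    j ne rewrite find-image f f-inj zero | find-image f f-inj j with j Fin.≟ z
      ... | yes refl = ⊥-elim (ne refl)
      ... | no _ = refl
      onY : σ c root y ≡ f (ρ RL zero z)
      onY rewrite find-image f f-inj zero with find f y
      ... | yes (j , q) = ⊥-elim (H∩L ry refl (≡-sym q))
      ... | no _ with y Fin.≟ y
      ...   | yes _ = refl
      ...   | no ne = ⊥-elim (ne refl)
      onZ : σ c root (f z) ≡ ρ RH root y
      onZ rewrite find-image f f-inj zero | find-image f f-inj z with z Fin.≟ z
      ... | yes _ = refl
      ... | no ne = ⊥-elim (ne refl)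

    onlyL : ∀ i → (∀ v → adj H (f i) v ≡ false) → ∀ {τ : Fin n → Fin n} →
      (∀ {j} → adj L i j ≡ true → τ (f j) ≡ f (ρ RL i j)) → CyclicOn (Nbr glued (f i)) τ
    onlyL i iso e = cyclic-image f (cyclicAt RL i) e f-inj
      (λ q → case split q of λ where
        (inj₁ h) → true≢false h (iso _)
        (inj₂ (i' , j , p , refl , l)) → j , refl , subst (λ t → adj L t j ≡ true) (≡-sym (f-inj p)) l)
      L⊆glued

    cyclicAt' : ∀ c v → Dec (Σ _ λ i → f i ≡ v) → CyclicOn (Nbr glued v) (σ c v)
    cyclicAt' c v (no ¬p) = cyclic-image id (cyclicAt RH v) (λ _ → σ-outside c λ i e → ¬p (i , e)) id
      (λ q → case split q of λ where
        (inj₁ h) → _ , refl , h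
        (inj₂ (i , _ , e , _)) → ⊥-elim (¬p (i , ≡-sym e)))
      H⊆glued
    cyclicAt' c v (yes (suc i , refl)) = onlyL (suc i) (isolatedH i) λ {j} _ → σ-suc c i j
    cyclicAt' c@(none iso) v (yes (zero , refl)) = onlyL zero iso (proj₂ (merged c))
    cyclicAt' c@(at y z ry rz) v (yes (zero , refl)) = record
      { stays = λ q → case split q of λ where
          (inj₁ h) → st h
          (inj₂ (i , j , e , refl , l)) → stL (toL e l)
      ; injective = λ q q' → case (split q , split q') of λ where
          (inj₁ h , inj₁ h') → S.γ-inj-ι iH iL h h'
          (inj₁ h , inj₂ (i , j , e , refl , l)) eq → ⊥-elim (S.γ-inj-ικ iH iL h (toL e l) eq)
          (inj₂ (i , j , e , refl , l) , inj₁ h) eq → ⊥-elim (S.γ-inj-ικ iH iL h (toL e l) (≡-sym eq))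
          (inj₂ (i , j , e , refl , l) , inj₂ (i' , j' , e' , refl , l')) eq →
            cong f (S.γ-inj-κ iH iL (toL e l) (toL e' l') eq)
      ; transit = λ q q' → case (split q , split q') of λ where
          (inj₁ h , inj₁ h') → S.orb-ι h (transit cH h h')
          (inj₁ h , inj₂ (i , j , e , refl , l)) → orb-trans (S.orb-ι h (transit cH h ry))
             (orb-trans S.p⇝q (S.orb-κ rz (transit cL rz (toL e l))))
          (inj₂ (i , j , e , refl , l) , inj₁ h) → orb-trans (S.orb-κ (toL e l) (transit cL (toL e l) rz))
             (orb-trans S.q⇝p (S.orb-ι ry (transit cH ry h)))
          (inj₂ (i , j , e , refl , l) , inj₂ (i' , j' , e' , refl , l')) →
             S.orb-κ (toL e l) (transit cL (toL e l) (toL e' l'))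
      }
      where
      γ : Fin n → Fin n
      γ = σ c root
      cH : CyclicOn (Nbr H root) (ρ RH root)
      cH = cyclicAt RH root
      cL : CyclicOn (Nbr L zero) (ρ RL zero)
      cL = cyclicAt RL zero
      iH : ∀ {a b} → adj H root a ≡ true → adj H root b ≡ true → ρ RH root a ≡ ρ RH root b → a ≡ b
      iH = injective cH
      iL : ∀ {a b} → adj L zero a ≡ true → adj L zero b ≡ true → ρ RL zero a ≡ ρ RL zero b → a ≡ b
      iL = injective cL
      toL : ∀ {i j} → root ≡ f i → adj L i j ≡ true → adj L zero j ≡ true
      toL {j = j} e l = subst (λ t → adj L t j ≡ true) (≡-sym (f-inj e)) l
      γ-H : ∀ {a} → adj H root a ≡ true → a ≢ y → γ a ≡ ρ RH root a
      γ-H h ne = proj₁ (proj₁ (merged c)) h λ { refl → ne refl }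
      γ-L : ∀ {b} → adj L zero b ≡ true → b ≢ z → γ (f b) ≡ f (ρ RL zero b)
      γ-L h ne = proj₂ (proj₁ (merged c)) h λ { refl → ne refl }
      -- The splice is now applied to the neighbours of the root instead of the darts: two cycles
      -- merged at one point of each form one cycle.
      module S = Splice (Nbr H root) (Nbr L zero) (ρ RH root) (ρ RL zero) γ
        (stays cH) (stays cL) (cyclic-sym cH) (cyclic-sym cL) Fin._≟_ Fin._≟_ id f id f-inj
        (λ h _ → H∩L h refl) y ry z rz
        γ-H γ-L (proj₁ (proj₂ (merged c))) (proj₂ (proj₂ (merged c)))
      st : ∀ {a} → adj H root a ≡ true → adj glued root (γ a) ≡ true
      st {a} h with a Fin.≟ y
      ... | yes refl = subst (Nbr glued root) (≡-sym (proj₁ (proj₂ (merged c)))) (L⊆glued (stays cL rz))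
      ... | no ne = subst (Nbr glued root) (≡-sym (γ-H h ne)) (H⊆glued (stays cH h))
      stL : ∀ {b} → adj L zero b ≡ true → adj glued root (γ (f b)) ≡ true
      stL {b} h with b Fin.≟ z
      ... | yes refl = subst (Nbr glued root) (≡-sym (proj₂ (proj₂ (merged c)))) (H⊆glued (stays cH ry))
      ... | no ne = subst (Nbr glued root) (≡-sym (γ-L h ne)) (L⊆glued (stays cL h))

  corner : Corner
  corner with any? (λ y → adj H root y ≟ᵇ true)
  ... | yes (y , ry) = let (z , rz) = L-neighbour zero in at y z ry rz
  ... | no ¬y = none λ v → ≢true λ e → ¬y (v , e)

  gluedRotation : Rotation glued
  gluedRotation = rotation (σ corner) λ v → cyclicAt' corner v (find f v)

  faces+isolated-glued : faces gluedRotation + isolated glued + suc (suc k) ≡ faces RH + faces RL + isolated H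
  faces+isolated-glued = faces+isolated-union gluedRotation corner (merged corner)

-- Cutting a union of components out of an embedding.

module Remove {n k} (G : Graph n) (RG : Rotation G) (f : Fin k → Fin n)
  (f-inj : ∀ {i j} → f i ≡ f j → i ≡ j)
  (f-closed : ∀ {i v} → adj G (f i) v ≡ true → Σ (Fin k) λ j → f j ≡ v) where

  removed : Graph k
  removed = record
    { adj = λ i j → adj G (f i) (f j) ; sym = λ i j → sym G (f i) (f j) ; irrefl = λ i → irrefl G (f i) }

  private
    out : Fin n → Bool
    out u with find f u
    ... | yes _ = false
    ... | no _  = true

    out-image : ∀ i → out (f i) ≡ false
    out-image i with find f (f i)
    ... | yes _ = refl
    ... | no ¬p = ⊥-elim (¬p (i , refl))

    out-true : ∀ {u} → (∀ i → f i ≢ u) → out u ≡ true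
    out-true {u} h with find f u
    ... | yes (i , p) = ⊥-elim (h i p)
    ... | no _ = refl

    image-back : ∀ {u v i} → adj G u v ≡ true → f i ≡ v → Σ (Fin k) λ j → f j ≡ u
    image-back e refl = f-closed (dart-sym G e)

  -- All n vertices are kept and those of the part become isolated, so that a new piece can be glued
  -- in on top of them.
  rest : Graph n
  rest = record
    { adj    = λ u v → (out u ∧ out v) ∧ adj G u v
    ; sym    = λ u v → cong₂ _∧_ (∧-comm (out u) (out v)) (sym G u v)
    ; irrefl = λ v → trans (cong ((out v ∧ out v) ∧_) (irrefl G v)) (∧-zeroʳ _)
    }

  rest-isolated : ∀ i v → adj rest (f i) v ≡ false
  rest-isolated i v = cong (λ b → (b ∧ out v) ∧ adj G (f i) v) (out-image i)

  rest⊆G : ∀ {u v} → adj rest u v ≡ true → adj G u v ≡ true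
  rest⊆G {u} {v} e = proj₂ (∧-true {out u ∧ out v} e)

  G⊆rest : ∀ {u v} → (∀ i → f i ≢ u) → adj G u v ≡ true → adj rest u v ≡ true
  G⊆rest h e = ∧-intro (∧-intro (out-true h) (out-true λ i p → let (j , q) = image-back e p in h j q)) e

  splitG : ∀ {u v} → adj G u v ≡ true →
    adj rest u v ≡ true ⊎ (Σ _ λ i → Σ _ λ j → u ≡ f i × v ≡ f j × adj removed i j ≡ true)
  splitG {u} {v} e = case find f u of λ where
    (no ¬p) → inj₁ (G⊆rest (λ i p → ¬p (i , p)) e)
    (yes (i , refl)) → case f-closed e of λ { (j , refl) → inj₂ (i , j , refl , refl , e) }

  restRotation : Rotation rest
  restRotation = rotation (ρ RG) λ v → case find f v of λ where
    (yes (i , refl)) → cyclic-empty λ e → true≢false e (rest-isolated i _)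
    (no ¬p) → cyclic-image id (cyclicAt RG v) (λ _ → refl) id (λ e → _ , refl , rest⊆G e)
                    (G⊆rest λ i p → ¬p (i , p))

  private
    pre : Fin k → Fin n → Fin k
    pre i u with find f u
    ... | yes (j , _) = j
    -- A default: `f-σ` looks only at neighbours, and these lie in the image.
    ... | no _        = i

    f-pre : ∀ i {u} → (Σ (Fin k) λ j → f j ≡ u) → f (pre i u) ≡ u
    f-pre i {u} p with find f u
    ... | yes (_ , q) = q
    ... | no ¬p = ⊥-elim (¬p p)

    σ : Fin k → Fin k → Fin k
    σ i j = pre i (ρ RG (f i) (f j))

    f-σ : ∀ {i j} → adj removed i j ≡ true → f (σ i j) ≡ ρ RG (f i) (f j)
    f-σ {i} {j} e = f-pre i (f-closed (closed RG (f i) (f j) e))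

  removedRotation : Rotation removed
  removedRotation = rotation σ λ i → cyclic-preimage f (cyclicAt RG (f i)) f-σ f-inj id id

  agree : (∀ {v u} → adj rest v u ≡ true → ρ RG v u ≡ ρ restRotation v u) ×
          (∀ {i j} → adj removed i j ≡ true → ρ RG (f i) (f j) ≡ f (ρ removedRotation i j))
  agree = (λ _ → refl) , λ e → ≡-sym (f-σ e)

-- The field `agree` is `Merged` for the trivial corner: G is the union of `rest` and `part` with
-- nothing spliced, so the gluing formulas also describe the cut.
record Separation {n k} (G : Graph n) (RG : Rotation G) (f : Fin k → Fin n) : Set where
  field
    rest          : Graph n
    restRotation  : Rotation rest
    part          : Graph k
    partRotation  : Rotation part
    rest-isolated : ∀ i v → adj rest (f i) v ≡ false
    rest⊆G        : ∀ {u v} → adj rest u v ≡ true → adj G u v ≡ true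
    part≡G        : ∀ i j → adj part i j ≡ adj G (f i) (f j)
    splitG        : ∀ {u v} → adj G u v ≡ true →
      adj rest u v ≡ true ⊎ (Σ _ λ i → Σ _ λ j → u ≡ f i × v ≡ f j × adj part i j ≡ true)
    agree         : (∀ {v u} → adj rest v u ≡ true → ρ RG v u ≡ ρ restRotation v u) ×
                    (∀ {i j} → adj part i j ≡ true → ρ RG (f i) (f j) ≡ f (ρ partRotation i j))

separation : (G : Graph n) (RG : Rotation G) (f : Fin k → Fin n) → (∀ {i j} → f i ≡ f j → i ≡ j) →
  (∀ {i v} → adj G (f i) v ≡ true → Σ (Fin k) λ j → f j ≡ v) → Separation G RG f
separation G RG f f-inj f-closed = record
  { rest = rest ; restRotation = restRotation ; part = removed ; partRotation = removedRotation
  ; rest-isolated = rest-isolated ; rest⊆G = rest⊆G ; part≡G = λ _ _ → refl ; splitG = splitG ; agree = agree }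
  where open Remove G RG f f-inj f-closed

-- Euler's formula for unions.

double-injective : ∀ {a b} → a + a ≡ b + b → a ≡ b
double-injective {a} {b} e = *-cancelˡ-≡ a b 2 (trans (two a) (trans e (≡-sym (two b))))
  where
  two : ∀ a → 2 * a ≡ a + a
  two a = cong (a +_) (+-identityʳ a)

-- In truth only g = 0 is possible, but this inequality is not needed.
Surplus : {G : Graph n} → Rotation G → ℕ → Set
Surplus {n} {G} R g = n + faces R + isolated G ≡ edges G + 2 * components G + g

-- A connected graph with at least one edge is embedded in the orientable surface of genus g / 2.
Deficit : {G : Graph n} → Rotation G → ℕ → Set
Deficit {n} {G} R g = n + faces R + g ≡ edges G + 2

module UnionEuler {n k g} {G H : Graph n} {L : Graph (suc (suc k))}
  (RG : Rotation G) (RH : Rotation H) (RL : Rotation L)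
  (fs : faces RG + isolated G + suc (suc k) ≡ faces RH + faces RL + isolated H)
  (ds : darts G ≡ darts H + darts L) (cs : components G + suc k ≡ components H) (def : Deficit RL g) where

  edges-union : edges G ≡ edges H + edges L
  edges-union = double-injective (begin
    edges G + edges G                           ≡⟨ darts≡2edges G ⟨
    darts G                                     ≡⟨ ds ⟩
    darts H + darts L                           ≡⟨ cong₂ _+_ (darts≡2edges H) (darts≡2edges L) ⟩
    (edges H + edges H) + (edges L + edges L)   ≡⟨ +-interchange (edges H) (edges H) (edges L) (edges L) ⟩
    (edges H + edges L) + (edges H + edges L)   ∎)
    where open ≡-Reasoning

  private
    K : ℕ
    K = suc (suc k)
    lhs : (n + faces RG + isolated G) + K ≡ (n + faces RH + isolated H) + faces RL
    lhs = begin
      (n + faces RG + isolated G) + K             ≡⟨ solve 4 (λ a b c d → a :+ b :+ c :+ d := a :+ (b :+ c :+ d)) refl n (faces RG) (isolated G) K ⟩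
      n + (faces RG + isolated G + K)             ≡⟨ cong (n +_) fs ⟩
      n + (faces RH + faces RL + isolated H)      ≡⟨ solve 4 (λ a b c d → a :+ (b :+ c :+ d) := a :+ b :+ d :+ c) refl n (faces RH) (faces RL) (isolated H) ⟩
      (n + faces RH + isolated H) + faces RL      ∎
      where open ≡-Reasoning
    rhs : (edges G + 2 * components G) + K ≡ (edges H + 2 * components H + g) + faces RL
    rhs = +-cancelʳ-≡ K _ _ (begin
      edges G + 2 * components G + K + K
        ≡⟨ cong (λ e → e + 2 * components G + K + K) edges-union ⟩
      edges H + edges L + 2 * components G + K + K
        ≡⟨ solve 4 (λ a b c d → a :+ b :+ con 2 :* c :+ (con 2 :+ d) :+ (con 2 :+ d)
                                  := a :+ con 2 :* (c :+ (con 1 :+ d)) :+ (b :+ con 2)) refl (edges H) (edges L) (components G) k ⟩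
      edges H + 2 * (components G + suc k) + (edges L + 2)
        ≡⟨ cong₂ (λ c d → edges H + 2 * c + d) cs (≡-sym def) ⟩
      edges H + 2 * components H + (K + faces RL + g)
        ≡⟨ solve 4 (λ a b c d → a :+ (b :+ c :+ d) := a :+ d :+ c :+ b) refl (edges H + 2 * components H) K (faces RL) g ⟩
      edges H + 2 * components H + g + faces RL + K ∎)
      where open ≡-Reasoning

  -- By `lhs` and `rhs`, adding L changes the two sides of Euler's formula equally up to g. Read
  -- backwards, taking a part of deficit g out of a planar G leaves surplus g; read forwards, in
  -- `planar`, any piece of the same deficit repairs it.
  surplus : n + faces RG + isolated G ≡ edges G + 2 * components G → Surplus RH g
  surplus e = +-cancelʳ-≡ (faces RL) _ _ (trans (≡-sym lhs) (trans (cong (_+ K) e) rhs))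

  planar : Surplus RH g → n + faces RG + isolated G ≡ edges G + 2 * components G
  planar e = +-cancelʳ-≡ K _ _ (trans lhs (trans (cong (_+ faces RL) e) (≡-sym rhs)))

-- Embedded graphs given by tables.

-- An embedded graph given by the cyclically ordered neighbourhoods of its vertices.
Table : ℕ → Set
Table n = Vec (List (Fin n)) n

elem : Fin n → List (Fin n) → Bool
elem u []       = false
elem u (v ∷ vs) = (u == v) ∨ elem u vs

next : Fin n → Fin n → List (Fin n) → Fin n
next first u []           = first
next first u (v ∷ [])     = first
next first u (v ∷ w ∷ vs) = if u == v then w else next first u (w ∷ vs)

tableAdj : Table n → Fin n → Fin n → Bool
tableAdj t u v = elem v (Vec.lookup t u)

tableNext : Table n → Fin n → Fin n → Fin n
tableNext t v u with Vec.lookup t v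
... | []     = u
... | w ∷ ws = next w u (w ∷ ws)

_⇒ᵇ_ : Bool → Bool → Bool
a ⇒ᵇ b = not a ∨ b

⇒ᵇ-elim : ∀ {a b} → (a ⇒ᵇ b) ≡ true → a ≡ true → b ≡ true
⇒ᵇ-elim e refl = e

_≡ᵇᵇ_ : Bool → Bool → Bool
true  ≡ᵇᵇ b = b
false ≡ᵇᵇ b = not b

≡ᵇᵇ-sound : ∀ a b → (a ≡ᵇᵇ b) ≡ true → a ≡ b
≡ᵇᵇ-sound true  true  _ = refl
≡ᵇᵇ-sound false false _ = refl

all₂ : (Fin n → Fin n → Bool) → Bool
all₂ p = allFinᵇ λ u → allFinᵇ (p u)

all₂-sound : (p : Fin n → Fin n → Bool) → all₂ p ≡ true → ∀ u v → p u v ≡ true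
all₂-sound p e u = allFinᵇ-sound (p u) (allFinᵇ-sound _ e u)

module FromTable {n} (t : Table (suc n)) where
  private
    V : Set
    V = Fin (suc n)
    a : V → V → Bool
    a = tableAdj t
    σ : V → V → V
    σ = tableNext t
    symᵇ closedᵇ : V → V → Bool
    symᵇ u v    = a u v ≡ᵇᵇ a v u
    closedᵇ v u = a v u ⇒ᵇ a v (σ v u)
    injᵇ cyclicᵇ : V → V → V → Bool
    injᵇ v u w    = a v w ⇒ᵇ ((σ v u == σ v w) ⇒ᵇ (u == w))
    cyclicᵇ v u w = a v w ⇒ᵇ anyFinᵇ {suc n} (λ k → iter (σ v) (toℕ k) u == w)
    all₃ : (V → V → V → Bool) → Bool
    all₃ p = all₂ λ v u → a v u ⇒ᵇ allFinᵇ (p v u)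
    all₃-sound : ∀ p → all₃ p ≡ true → ∀ v u w → a v u ≡ true → p v u w ≡ true
    all₃-sound p e v u w h =
      allFinᵇ-sound (p v u) (⇒ᵇ-elim {a v u} (all₂-sound (λ v u → a v u ⇒ᵇ allFinᵇ (p v u)) e v u) h) w
    precedes : Fin n → V → Bool
    precedes i j = (toℕ j ≤ᵇ toℕ i) ∧ a (suc i) j

  simpleᵇ cyclicOrderᵇ rootedᵇ : Bool
  simpleᵇ      = all₂ symᵇ ∧ allFinᵇ λ v → not (a v v)
  cyclicOrderᵇ = all₂ closedᵇ ∧ (all₃ injᵇ ∧ all₃ cyclicᵇ)
  rootedᵇ      = allFinᵇ λ i → anyFinᵇ (precedes i)

  module _ (simple : simpleᵇ ≡ true) where
    graph : Graph (suc n)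
    graph = record
      { adj    = a
      ; sym    = λ u v → ≡ᵇᵇ-sound (a u v) (a v u) (all₂-sound symᵇ (proj₁ (∧-true simple)) u v)
      ; irrefl = λ v → not-true (allFinᵇ-sound (λ v → not (a v v)) (proj₂ (∧-true {all₂ symᵇ} simple)) v) }

    table-rooted : rootedᵇ ≡ true → Rooted graph
    table-rooted e i with anyFinᵇ-true (precedes i) (allFinᵇ-sound (λ i → anyFinᵇ (precedes i)) e i)
    ... | j , h = let (p , q) = ∧-true {toℕ j ≤ᵇ toℕ i} h in j , ≤ᵇ-sound p , q

    tableRotation : cyclicOrderᵇ ≡ true → Rotation graph
    tableRotation e = record
      { ρ      = σ
      ; closed = λ v u → ⇒ᵇ-elim {a v u} (all₂-sound closedᵇ (proj₁ (∧-true e)) v u)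
      ; inj    = λ v u w p q eq → ==-sound u w (⇒ᵇ-elim {σ v u == σ v w}
          (⇒ᵇ-elim {a v w} (all₃-sound injᵇ (proj₁ e') v u w p) q)
          (subst (λ s → (σ v u == s) ≡ true) eq (==-refl (σ v u))))
      ; cyclic = λ v u w p q →
          let (k , h) = anyFinᵇ-true {suc n} (λ k → iter (σ v) (toℕ k) u == w)
                          (⇒ᵇ-elim {a v w} (all₃-sound cyclicᵇ (proj₂ e') v u w p) q)
          in toℕ k , ==-sound _ w h
      }
      where
      e' : all₃ injᵇ ≡ true × all₃ cyclicᵇ ≡ true
      e' = ∧-true {all₃ injᵇ} (proj₂ (∧-true {all₂ closedᵇ} e))

bowtieTable : Table 5
bowtieTable = (1F ∷ 2F ∷ 3F ∷ 4F ∷ []) ∷ (0F ∷ 2F ∷ []) ∷ (0F ∷ 1F ∷ []) ∷ (0F ∷ 4F ∷ []) ∷ (0F ∷ 3F ∷ []) ∷ []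

-- The two triangles alternate around their common vertex. This leaves a single face, and 5 - 6 + 1
-- = 0 is the Euler characteristic of the torus.
torusBowtieTable : Table 5
torusBowtieTable = (1F ∷ 3F ∷ 2F ∷ 4F ∷ []) ∷ (0F ∷ 2F ∷ []) ∷ (0F ∷ 1F ∷ []) ∷ (0F ∷ 4F ∷ []) ∷ (0F ∷ 3F ∷ []) ∷ []

tetrahedronTable : Table 4
tetrahedronTable = (1F ∷ 2F ∷ 3F ∷ []) ∷ (0F ∷ 3F ∷ 2F ∷ []) ∷ (0F ∷ 1F ∷ 3F ∷ []) ∷ (0F ∷ 2F ∷ 1F ∷ []) ∷ []

-- The triangles are 0 1 2, 3 4 5, 6 7 8 and 9 10 11. Each pair of them is joined by one edge and
-- each vertex lies on one such edge, which leaves no room for a 4-cycle.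
truncatedTetrahedronTable : Table 12
truncatedTetrahedronTable =
  (3F ∷ 1F ∷ 2F ∷ []) ∷ (0F ∷ 6F ∷ 2F ∷ []) ∷ (0F ∷ 1F ∷ 9F ∷ []) ∷ (0F ∷ 5F ∷ 4F ∷ []) ∷
  (3F ∷ 5F ∷ 7F ∷ []) ∷ (3F ∷ # 10 ∷ 4F ∷ []) ∷ (1F ∷ 7F ∷ 8F ∷ []) ∷ (4F ∷ 8F ∷ 6F ∷ []) ∷
  (6F ∷ 7F ∷ # 11 ∷ []) ∷ (2F ∷ # 11 ∷ # 10 ∷ []) ∷ (5F ∷ 9F ∷ # 11 ∷ []) ∷ (8F ∷ # 10 ∷ 9F ∷ []) ∷ []

-- Three triangles 0 1 2, 2 4 5 and 3 6 7, the first two sharing a vertex, and the edges 1 3 and 5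
-- 6, which close the pentagon 1 2 5 6 3.
example8Table : Table 8
example8Table = (1F ∷ 2F ∷ []) ∷ (0F ∷ 3F ∷ 2F ∷ []) ∷ (4F ∷ 0F ∷ 1F ∷ 5F ∷ []) ∷ (6F ∷ 1F ∷ 7F ∷ []) ∷
  (2F ∷ 5F ∷ []) ∷ (2F ∷ 6F ∷ 4F ∷ []) ∷ (7F ∷ 5F ∷ 3F ∷ []) ∷ (6F ∷ 3F ∷ []) ∷ []

module Bowtie = FromTable bowtieTable

bowtie : Graph 5
bowtie = Bowtie.graph refl

bowtieRotation : Rotation bowtie
bowtieRotation = Bowtie.tableRotation refl refl

bowtie-rooted : Rooted bowtie
bowtie-rooted = Bowtie.table-rooted refl refl

bowtie-deficit : Deficit bowtieRotation 0
bowtie-deficit = refl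

module TorusBowtie = FromTable torusBowtieTable

torusBowtie : Graph 5
torusBowtie = TorusBowtie.graph refl

torusBowtieRotation : Rotation torusBowtie
torusBowtieRotation = TorusBowtie.tableRotation refl refl

torusBowtie-rooted : Rooted torusBowtie
torusBowtie-rooted = TorusBowtie.table-rooted refl refl

torusBowtie-deficit : Deficit torusBowtieRotation 2
torusBowtie-deficit = refl

module Tetrahedron = FromTable tetrahedronTable

tetrahedron : Graph 4
tetrahedron = Tetrahedron.graph refl

tetrahedronRotation : Rotation tetrahedron
tetrahedronRotation = Tetrahedron.tableRotation refl refl

tetrahedron-rooted : Rooted tetrahedron
tetrahedron-rooted = Tetrahedron.table-rooted refl refl

tetrahedron-deficit : Deficit tetrahedronRotation 0
tetrahedron-deficit = refl

module TruncatedTetrahedron = FromTable truncatedTetrahedronTable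

truncatedTetrahedron : Graph 12
truncatedTetrahedron = TruncatedTetrahedron.graph refl

truncatedTetrahedronRotation : Rotation truncatedTetrahedron
truncatedTetrahedronRotation = TruncatedTetrahedron.tableRotation refl refl

truncatedTetrahedron-rooted : Rooted truncatedTetrahedron
truncatedTetrahedron-rooted = TruncatedTetrahedron.table-rooted refl refl

truncatedTetrahedron-deficit : Deficit truncatedTetrahedronRotation 0
truncatedTetrahedron-deficit = refl

module Example8 = FromTable example8Table

example8 : Graph 8
example8 = Example8.graph refl

example8Rotation : Rotation example8
example8Rotation = Example8.tableRotation refl refl

example8-rooted : Rooted example8
example8-rooted = Example8.table-rooted refl refl

example8-deficit : Deficit example8Rotation 0
example8-deficit = refl

-- 4-cycles and local forms of the two forbidden subgraphs.

record C4At (G : Graph n) (v p q r : Fin n) : Set where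
  constructor c4At
  field
    vp : adj G v p ≡ true
    pq : adj G p q ≡ true
    qr : adj G q r ≡ true
    rv : adj G r v ≡ true
    v≢q : v ≢ q
    p≢r : p ≢ r

InC4 : Graph n → Fin n → Set
InC4 G v = Σ _ λ p → Σ _ λ q → Σ _ λ r → C4At G v p q r

inC4? : (G : Graph n) → ∀ v → Dec (InC4 G v)
inC4? G v = any? λ p → any? λ q → any? λ r → c4At? p q r
  where
  c4At? : ∀ p q r → Dec (C4At G v p q r)
  c4At? p q r with adj G v p ≟ᵇ true
  ... | no ¬e = no (¬e ∘ C4At.vp)
  ... | yes vp with adj G p q ≟ᵇ true
  ...   | no ¬e = no (¬e ∘ C4At.pq)
  ...   | yes pq with adj G q r ≟ᵇ true
  ...     | no ¬e = no (¬e ∘ C4At.qr)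
  ...     | yes qr with adj G r v ≟ᵇ true
  ...       | no ¬e = no (¬e ∘ C4At.rv)
  ...       | yes rv with v Fin.≟ q
  ...         | yes e = no λ c → C4At.v≢q c e
  ...         | no v≢q with p Fin.≟ r
  ...           | yes e = no λ c → C4At.p≢r c e
  ...           | no p≢r = yes (c4At vp pq qr rv v≢q p≢r)

C4-free : Graph n → Set
C4-free G = ∀ v → ¬ InC4 G v

-- The answer `yes` exhibits a 4-cycle; the answer `no` means that G is C4-free.
C4-free? : (G : Graph n) → Dec (Σ _ (InC4 G))
C4-free? G = any? (inC4? G)

rotate : {G : Graph n} → ∀ {v p q r} → C4At G v p q r → C4At G p q r v
rotate (c4At a b c d e f) = c4At b c d a f (e ∘ ≡-sym)

C4At-mono : {G H : Graph n} → (∀ {u v} → adj G u v ≡ true → adj H u v ≡ true) →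
            ∀ {v p q r} → C4At G v p q r → C4At H v p q r
C4At-mono h (c4At a b c d e f) = c4At (h a) (h b) (h c) (h d) e f

-- A graph without C4⁺, expressed locally: the vertices of a 4-cycle have no neighbours outside it.
C4-closed : Graph n → Set
C4-closed G = ∀ {v p q r w} → C4At G v p q r → adj G v w ≡ true → w ≡ p ⊎ w ≡ q ⊎ w ≡ r

edgewise : (es : List (Fin k × Fin k)) (G : Graph n) (f : Fin k → Fin n) →
  All (λ { (x , y) → adj G (f x) (f y) ≡ true }) es →
  ∀ a b → symAdj es a b ≡ true → adj G (f a) (f b) ≡ true
edgewise {k} es G f h a b e = case ∨-true {hasEdge es a b} e of λ where
    (inj₁ e') → go es h a b e'
    (inj₂ e') → dart-sym G (go es h b a e')
  where
  go : ∀ es → All (λ { (x , y) → adj G (f x) (f y) ≡ true }) es →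
       ∀ a b → hasEdge es a b ≡ true → adj G (f a) (f b) ≡ true
  go ((x , y) ∷ es) (p ∷ ps) a b e with ∨-true {(x == a) ∧ (y == b)} e
  ... | inj₂ e' = go es ps a b e'
  ... | inj₁ e' with ∧-true {x == a} e'
  ...   | xa , yb = subst (λ s → adj G (f a) (f s) ≡ true) (==-sound y b yb)
                      (subst (λ s → adj G (f s) (f y) ≡ true) (==-sound x a xa) p)

distinct⇒injective : (f : Fin k → Fin n) → (∀ i j → toℕ i < toℕ j → f i ≢ f j) → ∀ {i j} → f i ≡ f j → i ≡ j
distinct⇒injective f h {i} {j} e with <-cmp (toℕ i) (toℕ j)
... | tri< a _ _ = ⊥-elim (h i j a e)
... | tri≈ _ b _ = toℕ-injective b
... | tri> _ _ c = ⊥-elim (h j i c (≡-sym e))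

module _ {G : Graph n} {v p q r : Fin n} (c : C4At G v p q r) where
  open C4At c

  square : Fin 4 → Fin n
  square 0F = v
  square 1F = p
  square 2F = q
  square 3F = r

  square-inj : ∀ {i j} → square i ≡ square j → i ≡ j
  square-inj = distinct⇒injective square λ where
    0F 1F _ → dart-irrefl G vp
    0F 2F _ → v≢q
    0F 3F _ → dart-irrefl G rv ∘ ≡-sym
    1F 2F _ → dart-irrefl G pq
    1F 3F _ → p≢r
    2F 3F _ → dart-irrefl G qr
    1F 1F (s≤s ())
    2F 1F (s≤s ())
    2F 2F (s≤s (s≤s ()))
    3F 1F (s≤s ())
    3F 2F (s≤s (s≤s ()))
    3F 3F (s≤s (s≤s (s≤s ())))

  square-⊆ : C4 ⊆ᴳ G
  square-⊆ = square , square-inj , edgewise c4Edges G square (vp ∷ pq ∷ qr ∷ rv ∷ [])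

  pendant-⊆ : ∀ w → adj G v w ≡ true → w ≢ p → w ≢ q → w ≢ r → C4⁺ ⊆ᴳ G
  pendant-⊆ w vw w≢p w≢q w≢r = f , f-inj , edgewise c4pEdges G f (vp ∷ pq ∷ qr ∷ rv ∷ vw ∷ [])
    where
    f : Fin 5 → Fin n
    f 0F = v
    f 1F = p
    f 2F = q
    f 3F = r
    f 4F = w
    f-inj : ∀ {i j} → f i ≡ f j → i ≡ j
    f-inj = distinct⇒injective f λ where
      0F 1F _ → dart-irrefl G vp
      0F 2F _ → v≢q
      0F 3F _ → dart-irrefl G rv ∘ ≡-sym
      0F 4F _ → dart-irrefl G vw
      1F 2F _ → dart-irrefl G pq
      1F 3F _ → p≢r
      1F 4F _ → w≢p ∘ ≡-sym
      2F 3F _ → dart-irrefl G qr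
      2F 4F _ → w≢q ∘ ≡-sym
      3F 4F _ → w≢r ∘ ≡-sym
      1F 1F (s≤s ())
      2F 1F (s≤s ())
      2F 2F (s≤s (s≤s ()))
      3F 1F (s≤s ())
      3F 2F (s≤s (s≤s ()))
      3F 3F (s≤s (s≤s (s≤s ())))
      4F 1F (s≤s ())
      4F 2F (s≤s (s≤s ()))
      4F 3F (s≤s (s≤s (s≤s ())))
      4F 4F (s≤s (s≤s (s≤s (s≤s ()))))

  square-closed : C4-closed G → ∀ {i w} → adj G (square i) w ≡ true → Σ (Fin 4) λ j → square j ≡ w
  square-closed h {0F} e with h c e
  ... | inj₁ refl        = 1F , refl
  ... | inj₂ (inj₁ refl) = 2F , refl
  ... | inj₂ (inj₂ refl) = 3F , refl
  square-closed h {1F} e with h (rotate c) e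
  ... | inj₁ refl        = 2F , refl
  ... | inj₂ (inj₁ refl) = 3F , refl
  ... | inj₂ (inj₂ refl) = 0F , refl
  square-closed h {2F} e with h (rotate (rotate c)) e
  ... | inj₁ refl        = 3F , refl
  ... | inj₂ (inj₁ refl) = 0F , refl
  ... | inj₂ (inj₂ refl) = 1F , refl
  square-closed h {3F} e with h (rotate (rotate (rotate c))) e
  ... | inj₁ refl        = 0F , refl
  ... | inj₂ (inj₁ refl) = 1F , refl
  ... | inj₂ (inj₂ refl) = 2F , refl

⊆-square : {G : Graph n} → C4 ⊆ᴳ G → Σ (Fin n) (InC4 G)
⊆-square (f , f-inj , h) = f 0F , f 1F , f 2F , f 3F ,
  c4At (h 0F 1F refl) (h 1F 2F refl) (h 2F 3F refl) (h 3F 0F refl) (λ e → case f-inj e of λ ()) (λ e → case f-inj e of λ ())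

C4-free⇒Free : {G : Graph n} → C4-free G → Free C4 G
C4-free⇒Free h s = let (v , c) = ⊆-square s in h v c

Free⇒C4-free : {G : Graph n} → Free C4 G → C4-free G
Free⇒C4-free h v (p , q , r , c) = h (square-⊆ c)

Free⇒C4-closed : {G : Graph n} → Free C4⁺ G → C4-closed G
Free⇒C4-closed {G = G} h {v} {p} {q} {r} {w} c e with w Fin.≟ p | w Fin.≟ q | w Fin.≟ r
... | yes x | _ | _ = inj₁ x
... | no _ | yes y | _ = inj₂ (inj₁ y)
... | no _ | no _ | yes z = inj₂ (inj₂ z)
... | no x | no y | no z = ⊥-elim (h (pendant-⊆ c w e x y z))

C4⊆C4⁺ : C4 ⊆ᴳ C4⁺
C4⊆C4⁺ = (λ i → Fin.inject₁ i) , Finₚ.inject₁-injective ,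
  edgewise c4Edges C4⁺ (λ i → Fin.inject₁ i) (refl ∷ refl ∷ refl ∷ refl ∷ [])

C4-free⇒Free⁺ : {G : Graph n} → C4-free G → Free C4⁺ G
C4-free⇒Free⁺ h (f , f-inj , e) = let (g , g-inj , e') = C4⊆C4⁺ in
  C4-free⇒Free h ((f ∘ g) , g-inj ∘ f-inj , λ a b x → e (g a) (g b) (e' a b x))

-- Finite check on embeddings of graphs on four vertices that contain a 4-cycle

dartStep : (Fin n → Fin n → Fin n) → Fin n × Fin n → Fin n × Fin n
dartStep σ (u , v) = v , σ v u

-- The same sum as `faces`, for bare functions: candidates can be enumerated without first proving
-- that they are rotations.
facesOf : (Fin n → Fin n → Bool) → (Fin n → Fin n → Fin n) → ℕ
facesOf {n} a σ = sumFin λ u → countFin λ v →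
  a u v ∧ allFinᵇ {n * n} (λ k → dartKey (u , v) ≤ᵇ dartKey (iter (dartStep σ) (toℕ k) (u , v)))

facesOf-cong : {G : Graph n} (R : Rotation G) {a : Fin n → Fin n → Bool} {σ : Fin n → Fin n → Fin n} →
  (∀ u v → adj G u v ≡ a u v) → (∀ {v u} → adj G v u ≡ true → ρ R v u ≡ σ v u) → faces R ≡ facesOf a σ
facesOf-cong {n} {G} R {a} {σ} ea eσ = sumFin-cong λ u → countFin-cong λ v →
  ∧-cong (ea u v) λ e → allFinᵇ-cong {n * n} λ k → cong (λ d → dartKey (u , v) ≤ᵇ dartKey d) (steps (toℕ k) e)
  where
  open Faces R
  step : ∀ {d} → Dart G d → faceStep R d ≡ (proj₂ d , σ (proj₂ d) (proj₁ d))
  step {u , v} h = cong (v ,_) (eσ (dart-sym G h))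
  steps : ∀ k {d} → Dart G d → iter (faceStep R) k d ≡ iter (dartStep σ) k d
  steps zero    h = refl
  steps (suc k) h = trans (step (iter-closed k h)) (cong (dartStep σ) (steps k h))
  ∧-cong : ∀ {x y p q} → x ≡ y → (x ≡ true → p ≡ q) → x ∧ p ≡ y ∧ q
  ∧-cong {true}  refl h = h refl
  ∧-cong {false} refl h = refl

edgesOf : (Fin n → Fin n → Bool) → ℕ
edgesOf a = sumFin (λ u → countFin (λ v → (toℕ u <ᵇ toℕ v) ∧ a u v))

edgesOf-cong : (G : Graph n) {a : Fin n → Fin n → Bool} → (∀ u v → adj G u v ≡ a u v) → edges G ≡ edgesOf a
edgesOf-cong G e = sumFin-cong λ u → countFin-cong λ v → cong ((toℕ u <ᵇ toℕ v) ∧_) (e u v)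

allVecᵇ : ∀ k → (Fin k → Fin m → Bool) → (Vec (Fin m) k → Bool) → Bool
allVecᵇ zero    ok p = p []
allVecᵇ (suc k) ok p = allFinᵇ λ x → ok zero x ⇒ᵇ allVecᵇ k (ok ∘ suc) λ xs → p (x ∷ xs)

allVecᵇ-sound : ∀ k (ok : Fin k → Fin m → Bool) p → allVecᵇ k ok p ≡ true →
  ∀ xs → (∀ i → ok i (Vec.lookup xs i) ≡ true) → p xs ≡ true
allVecᵇ-sound zero    ok p e []       h = e
allVecᵇ-sound (suc k) ok p e (x ∷ xs) h =
  allVecᵇ-sound k (ok ∘ suc) (λ xs → p (x ∷ xs)) (⇒ᵇ-elim {ok zero x} (allFinᵇ-sound _ e x) (h zero)) xs (h ∘ suc)

-- The 4-cycle 0 1 2 3 with the chord 02 if d is true and 13 if e is true.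
chords : Bool → Bool → Fin 4 → Fin 4 → Bool
chords d e 0F 2F = d
chords d e 2F 0F = d
chords d e 1F 3F = e
chords d e 3F 1F = e
chords d e 0F 0F = false
chords d e 1F 1F = false
chords d e 2F 2F = false
chords d e 3F 3F = false
chords d e _  _  = true

-- On two or three neighbours a fixed-point-free injection is a cyclic order.
moveᵇ : (Fin 4 → Bool) → Fin 4 → Fin 4 → Bool
moveᵇ N i x = if N i then (N x ∧ not (x == i)) else (x == i)

injectiveᵇ : (Fin 4 → Bool) → Vec (Fin 4) 4 → Bool
injectiveᵇ N r = all₂ λ i j → ((N i ∧ N j) ∧ (Vec.lookup r i == Vec.lookup r j)) ⇒ᵇ (i == j)

deficitᵇ : ℕ → ℕ → Bool
deficitᵇ F E = ((4 + F + 0 ≡ᵇ E + 2) ∨ (4 + F + 2 ≡ᵇ E + 2)) ∧ (E ≤ᵇ 6)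

deficitᵇ-sound : ∀ F E → deficitᵇ F E ≡ true → (4 + F + 0 ≡ E + 2 ⊎ 4 + F + 2 ≡ E + 2) × E ≤ 6
deficitᵇ-sound F E h with ∧-true {(4 + F + 0 ≡ᵇ E + 2) ∨ (4 + F + 2 ≡ᵇ E + 2)} h
... | x , y = Sum.map (≡ᵇ-sound (4 + F + 0) (E + 2)) (≡ᵇ-sound (4 + F + 2) (E + 2)) (∨-true {4 + F + 0 ≡ᵇ E + 2} x) , ≤ᵇ-sound {E} y
  where
  ≡ᵇ-sound : ∀ a b → (a ≡ᵇ b) ≡ true → a ≡ b
  ≡ᵇ-sound a b e = ≡ᵇ⇒≡ a b (subst T (≡-sym e) tt)

embeddingᵇ : (Fin 4 → Fin 4 → Bool) → (Fin 4 → Fin 4 → Fin 4) → Bool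
embeddingᵇ a σ = deficitᵇ (facesOf a σ) (edgesOf a)

embeddingᵇ-sound : ∀ a σ {F E} → F ≡ facesOf a σ → E ≡ edgesOf a → embeddingᵇ a σ ≡ true →
  (4 + F + 0 ≡ E + 2 ⊎ 4 + F + 2 ≡ E + 2) × E ≤ 6
embeddingᵇ-sound a σ refl refl = deficitᵇ-sound (facesOf a σ) (edgesOf a)

rows : (r₀ r₁ r₂ r₃ : Vec (Fin 4) 4) → Fin 4 → Fin 4 → Fin 4
rows r₀ r₁ r₂ r₃ 0F = Vec.lookup r₀
rows r₀ r₁ r₂ r₃ 1F = Vec.lookup r₁
rows r₀ r₁ r₂ r₃ 2F = Vec.lookup r₂
rows r₀ r₁ r₂ r₃ 3F = Vec.lookup r₃

Order : (Fin 4 → Bool) → Vec (Fin 4) 4 → Set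
Order N r = (∀ i → moveᵇ N i (Vec.lookup r i) ≡ true) × injectiveᵇ N r ≡ true

opaque
  orders : (Fin 4 → Bool) → (Vec (Fin 4) 4 → Bool) → Bool
  orders N p = allVecᵇ 4 (moveᵇ N) λ r → injectiveᵇ N r ⇒ᵇ p r

  orders-sound : ∀ N p → orders N p ≡ true → ∀ r → Order N r → p r ≡ true
  orders-sound N p e r (m , i) = ⇒ᵇ-elim {injectiveᵇ N r} (allVecᵇ-sound 4 (moveᵇ N) (λ r → injectiveᵇ N r ⇒ᵇ p r) e r m) i

allOrders : (Fin 4 → Fin 4 → Bool) → ((r₀ r₁ r₂ r₃ : Vec (Fin 4) 4) → Bool) → Bool
allOrders a p = orders (a 0F) λ r₀ → orders (a 1F) λ r₁ → orders (a 2F) λ r₂ → orders (a 3F) λ r₃ → p r₀ r₁ r₂ r₃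

allOrders-sound : ∀ a p → allOrders a p ≡ true → ∀ r₀ r₁ r₂ r₃ →
  Order (a 0F) r₀ → Order (a 1F) r₁ → Order (a 2F) r₂ → Order (a 3F) r₃ →
  p r₀ r₁ r₂ r₃ ≡ true
allOrders-sound a p e r₀ r₁ r₂ r₃ o₀ o₁ o₂ =
  orders-sound (a 3F) (λ r₃ → p r₀ r₁ r₂ r₃)
    (orders-sound (a 2F) (λ r₂ → orders (a 3F) λ r₃ → p r₀ r₁ r₂ r₃)
      (orders-sound (a 1F) (λ r₁ → orders (a 2F) λ r₂ → orders (a 3F) λ r₃ → p r₀ r₁ r₂ r₃)
        (orders-sound (a 0F) (λ r₀ → orders (a 1F) λ r₁ → orders (a 2F) λ r₂ → orders (a 3F) λ r₃ → p r₀ r₁ r₂ r₃)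
          e r₀ o₀)
        r₁ o₁)
      r₂ o₂)
    r₃

opaque
  unfolding orders

  -- The deficit g is E - 2 - F, at most 3 as there is a face; parity and nonnegativity of the genus
  -- would leave 0 and 2. Enumeration replaces both facts: a vertex has one cyclic order if its
  -- degree is 2 and two if it is 3, so each of the four graphs has at most 16 embeddings.
  check-true : ∀ d e → allOrders (chords d e) (λ r₀ r₁ r₂ r₃ → embeddingᵇ (chords d e) (rows r₀ r₁ r₂ r₃)) ≡ true
  check-true true  true  = refl
  check-true true  false = refl
  check-true false true  = refl
  check-true false false = refl

module FourVertices (L : Graph 4) (RL : Rotation L)
  (e₀₁ : adj L 0F 1F ≡ true) (e₁₂ : adj L 1F 2F ≡ true)
  (e₂₃ : adj L 2F 3F ≡ true) (e₃₀ : adj L 3F 0F ≡ true) where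
  private
    a : Fin 4 → Fin 4 → Bool
    a = chords (adj L 0F 2F) (adj L 1F 3F)

    adj≡ : ∀ u v → adj L u v ≡ a u v
    adj≡ 0F 0F = irrefl L _
    adj≡ 0F 1F = e₀₁
    adj≡ 0F 2F = refl
    adj≡ 0F 3F = dart-sym L e₃₀
    adj≡ 1F 0F = dart-sym L e₀₁
    adj≡ 1F 1F = irrefl L _
    adj≡ 1F 2F = e₁₂
    adj≡ 1F 3F = refl
    adj≡ 2F 0F = sym L _ _
    adj≡ 2F 1F = dart-sym L e₁₂
    adj≡ 2F 2F = irrefl L _
    adj≡ 2F 3F = e₂₃
    adj≡ 3F 0F = e₃₀
    adj≡ 3F 1F = sym L _ _
    adj≡ 3F 2F = dart-sym L e₂₃
    adj≡ 3F 3F = irrefl L _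

    -- Outside the neighbourhood the successor is normalised to the identity, the only value that
    -- `moveᵇ` admits there.
    entry : Fin 4 → Fin 4 → Fin 4
    entry v u = if adj L v u then ρ RL v u else u

    row : Fin 4 → Vec (Fin 4) 4
    row v = Vec.tabulate (entry v)

    row-adj : ∀ {v u} → adj L v u ≡ true → Vec.lookup (row v) u ≡ ρ RL v u
    row-adj {v} {u} e = trans (lookup∘tabulate (entry v) u) (cong (if_then ρ RL v u else u) e)

    row-¬adj : ∀ {v u} → adj L v u ≡ false → Vec.lookup (row v) u ≡ u
    row-¬adj {v} {u} e = trans (lookup∘tabulate (entry v) u) (cong (if_then ρ RL v u else u) e)

    iter-fixed : {f : A → A} → ∀ {x} → f x ≡ x → ∀ k → iter f k x ≡ x
    iter-fixed e zero    = refl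
    iter-fixed {f = f} e (suc k) = trans (cong f (iter-fixed e k)) e

    order : ∀ v → Order (a v) (row v)
    order v = move , all₂-complete λ i j → ⇒ᵇ-intro _ λ e →
        let (ij , q) = ∧-true {a v i ∧ a v j} e
            (vi , vj) = ∧-true {a v i} ij
            vi' = trans (adj≡ v i) vi
            vj' = trans (adj≡ v j) vj
        in subst (λ s → (i == s) ≡ true)
             (inj RL v i j vi' vj' (trans (≡-sym (row-adj vi')) (trans (==-sound _ _ q) (row-adj vj')))) (==-refl i)
      where
      ⇒ᵇ-intro : ∀ x {y} → (x ≡ true → y ≡ true) → (x ⇒ᵇ y) ≡ true
      ⇒ᵇ-intro true  h = h refl
      ⇒ᵇ-intro false h = refl
      all₂-complete : {p : Fin 4 → Fin 4 → Bool} → (∀ i j → p i j ≡ true) → all₂ p ≡ true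
      all₂-complete {p} h = allFinᵇ-complete _ λ i → allFinᵇ-complete (p i) (h i)
      -- Every vertex has two neighbours on the 4-cycle. Hence the cyclic order fixes no neighbour,
      -- because a fixed one would never lead to another.
      another : ∀ i → adj L v i ≡ true → Σ (Fin 4) λ j → j ≢ i × adj L v j ≡ true
      another = two v
        where
        two : ∀ v i → adj L v i ≡ true → Σ (Fin 4) λ j → j ≢ i × adj L v j ≡ true
        two 0F 1F _ = 3F , (λ ()) , dart-sym L e₃₀
        two 0F 2F _ = 1F , (λ ()) , e₀₁
        two 0F 3F _ = 1F , (λ ()) , e₀₁
        two 1F 0F _ = 2F , (λ ()) , e₁₂
        two 1F 2F _ = 0F , (λ ()) , dart-sym L e₀₁
        two 1F 3F _ = 2F , (λ ()) , e₁₂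
        two 2F 0F _ = 3F , (λ ()) , e₂₃
        two 2F 1F _ = 3F , (λ ()) , e₂₃
        two 2F 3F _ = 1F , (λ ()) , dart-sym L e₁₂
        two 3F 0F _ = 2F , (λ ()) , dart-sym L e₂₃
        two 3F 1F _ = 0F , (λ ()) , e₃₀
        two 3F 2F _ = 0F , (λ ()) , e₃₀
        two 0F 0F e = ⊥-elim (dart-irrefl L e refl)
        two 1F 1F e = ⊥-elim (dart-irrefl L e refl)
        two 2F 2F e = ⊥-elim (dart-irrefl L e refl)
        two 3F 3F e = ⊥-elim (dart-irrefl L e refl)
      move : ∀ i → moveᵇ (a v) i (Vec.lookup (row v) i) ≡ true
      move i with a v i in e
      ... | false = trans (cong (_== i) (row-¬adj (trans (adj≡ v i) e))) (==-refl i)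
      ... | true  = let e' = trans (adj≡ v i) e in
        trans (cong₂ (λ x y → a v x ∧ not (y == i)) (row-adj e') (row-adj e'))
          (∧-intro (trans (≡-sym (adj≡ v _)) (closed RL v i e'))
            (cong not (≢true λ q → let (j , j≢i , vj) = another i e'
                                       (k , o) = cyclic RL v i j e' vj
                                   in j≢i (trans (≡-sym o) (iter-fixed (==-sound _ _ q) k)))))

    σ : Fin 4 → Fin 4 → Fin 4
    σ = rows (row 0F) (row 1F) (row 2F) (row 3F)

    σ≡ : ∀ {v u} → adj L v u ≡ true → ρ RL v u ≡ σ v u
    σ≡ {0F} e = ≡-sym (row-adj e)
    σ≡ {1F} e = ≡-sym (row-adj e)
    σ≡ {2F} e = ≡-sym (row-adj e)
    σ≡ {3F} e = ≡-sym (row-adj e)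

    checked : embeddingᵇ a σ ≡ true
    checked = allOrders-sound a (λ r₀ r₁ r₂ r₃ → embeddingᵇ a (rows r₀ r₁ r₂ r₃))
      (check-true (adj L 0F 2F) (adj L 1F 3F)) (row 0F) (row 1F) (row 2F) (row 3F)
      (order 0F) (order 1F) (order 2F) (order 3F)

  deficit₀₂×edges≤6 : (Deficit RL 0 ⊎ Deficit RL 2) × edges L ≤ 6
  deficit₀₂×edges≤6 = embeddingᵇ-sound a σ {faces RL} {edges L} (facesOf-cong RL {a} {σ} adj≡ σ≡) (edgesOf-cong L {a} adj≡) checked

  four-rooted : Rooted L
  four-rooted 0F = 0F , z≤n , dart-sym L e₀₁
  four-rooted 1F = 1F , s≤s z≤n , dart-sym L e₁₂
  four-rooted 2F = 2F , s≤s (s≤s z≤n) , dart-sym L e₂₃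

-- A 4-cycle of the union cannot use both parts, since it would pass twice through their common vertex.
module UnionC4 {n k} (H : Graph n) (L : Graph (suc (suc k))) (f : Fin (suc (suc k)) → Fin n)
  (f-inj : ∀ {i j} → f i ≡ f j → i ≡ j)
  (isolatedH : ∀ i v → adj H (f (suc i)) v ≡ false) (rooted : Rooted L) (G : Graph n)
  (split : ∀ {u v} → adj G u v ≡ true →
    adj H u v ≡ true ⊎ (Σ _ λ i → Σ _ λ j → u ≡ f i × v ≡ f j × adj L i j ≡ true))
  (H⊆G : ∀ {u v} → adj H u v ≡ true → adj G u v ≡ true)
  (L⊆G : ∀ {i j} → adj L i j ≡ true → adj G (f i) (f j) ≡ true) where

  open Union H L f f-inj isolatedH rooted G split H⊆G L⊆G using (H-root)

  C4At-split : ∀ {v p q r} → C4At G v p q r → C4At H v p q r ⊎ (Σ _ λ i → InC4 L i)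
  C4At-split {v} {p} {q} {r} (c4At vp pq qr rv v≢q p≢r) = go (split vp) (split pq) (split qr) (split rv)
    where
    Side : Fin n → Fin n → Set
    Side u v = adj H u v ≡ true ⊎ (Σ _ λ i → Σ _ λ j → u ≡ f i × v ≡ f j × adj L i j ≡ true)
    go : Side v p → Side p q → Side q r → Side r v → C4At H v p q r ⊎ (Σ _ λ i → InC4 L i)
    go (inj₁ h0) (inj₁ h1) (inj₁ h2) (inj₁ h3) = inj₁ (c4At h0 h1 h2 h3 v≢q p≢r)
    go (inj₂ (i , j , refl , refl , l0)) (inj₂ (_ , k , y , refl , l1)) (inj₂ (_ , l , z , refl , l2)) (inj₂ (_ , _ , x , w , l3))
      with f-inj y | f-inj z | f-inj x | f-inj w
    ... | refl | refl | refl | refl = inj₂ (i , j , k , l , c4At l0 l1 l2 l3 (v≢q ∘ cong f) (p≢r ∘ cong f))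
    go (inj₁ h0) (inj₁ _) (inj₁ h2) (inj₂ (_ , _ , x3 , y3 , _)) =
      ⊥-elim ((dart-irrefl G rv) (trans (H-root (dart-sym H h2) x3) (≡-sym (H-root h0 y3))))
    go (inj₁ _) (inj₁ h1) (inj₂ (_ , _ , x2 , y2 , _)) (inj₁ h3) =
      ⊥-elim ((dart-irrefl G qr) (trans (H-root (dart-sym H h1) x2) (≡-sym (H-root h3 y2))))
    go (inj₁ h0) (inj₁ h1) (inj₂ (_ , _ , x2 , _ , _)) (inj₂ (_ , _ , _ , y3 , _)) =
      ⊥-elim ((v≢q ∘ ≡-sym) (trans (H-root (dart-sym H h1) x2) (≡-sym (H-root h0 y3))))
    go (inj₁ h0) (inj₂ (_ , _ , x1 , y1 , _)) (inj₁ h2) (inj₁ _) =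
      ⊥-elim ((dart-irrefl G pq) (trans (H-root (dart-sym H h0) x1) (≡-sym (H-root h2 y1))))
    go (inj₁ h0) (inj₂ (_ , _ , x1 , y1 , _)) (inj₁ h2) (inj₂ (_ , _ , _ , _ , _)) =
      ⊥-elim ((dart-irrefl G pq) (trans (H-root (dart-sym H h0) x1) (≡-sym (H-root h2 y1))))
    go (inj₁ h0) (inj₂ (_ , _ , x1 , _ , _)) (inj₂ (_ , _ , _ , y2 , _)) (inj₁ h3) =
      ⊥-elim ((p≢r) (trans (H-root (dart-sym H h0) x1) (≡-sym (H-root h3 y2))))
    go (inj₁ h0) (inj₂ (_ , _ , x1 , _ , _)) (inj₂ (_ , _ , _ , _ , _)) (inj₂ (_ , _ , _ , y3 , _)) =
      ⊥-elim ((dart-irrefl G vp ∘ ≡-sym) (trans (H-root (dart-sym H h0) x1) (≡-sym (H-root h0 y3))))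
    go (inj₂ (_ , _ , x0 , y0 , _)) (inj₁ h1) (inj₁ _) (inj₁ h3) =
      ⊥-elim ((dart-irrefl G vp ∘ ≡-sym) (trans (H-root h1 y0) (≡-sym (H-root (dart-sym H h3) x0))))
    go (inj₂ (_ , _ , _ , y0 , _)) (inj₁ h1) (inj₁ h2) (inj₂ (_ , _ , x3 , _ , _)) =
      ⊥-elim ((p≢r) (trans (H-root h1 y0) (≡-sym (H-root (dart-sym H h2) x3))))
    go (inj₂ (_ , _ , _ , y0 , _)) (inj₁ h1) (inj₂ (_ , _ , x2 , _ , _)) (inj₁ _) =
      ⊥-elim ((dart-irrefl G pq) (trans (H-root h1 y0) (≡-sym (H-root (dart-sym H h1) x2))))
    go (inj₂ (_ , _ , _ , y0 , _)) (inj₁ h1) (inj₂ (_ , _ , x2 , _ , _)) (inj₂ (_ , _ , _ , _ , _)) =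
      ⊥-elim ((dart-irrefl G pq) (trans (H-root h1 y0) (≡-sym (H-root (dart-sym H h1) x2))))
    go (inj₂ (_ , _ , x0 , _ , _)) (inj₂ (_ , _ , _ , y1 , _)) (inj₁ h2) (inj₁ h3) =
      ⊥-elim ((v≢q ∘ ≡-sym) (trans (H-root h2 y1) (≡-sym (H-root (dart-sym H h3) x0))))
    go (inj₂ (_ , _ , _ , _ , _)) (inj₂ (_ , _ , _ , y1 , _)) (inj₁ h2) (inj₂ (_ , _ , x3 , _ , _)) =
      ⊥-elim ((dart-irrefl G qr) (trans (H-root h2 y1) (≡-sym (H-root (dart-sym H h2) x3))))
    go (inj₂ (_ , _ , x0 , _ , _)) (inj₂ (_ , _ , _ , _ , _)) (inj₂ (_ , _ , _ , y2 , _)) (inj₁ h3) =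
      ⊥-elim ((dart-irrefl G rv) (trans (H-root h3 y2) (≡-sym (H-root (dart-sym H h3) x0))))

-- Exchanging a component for another graph.

module Attach {n k g} (H : Graph n) (RH : Rotation H) (surplusH : Surplus RH g)
  (L : Graph (suc (suc k))) (RL : Rotation L) (deficitL : Deficit RL g)
  (f : Fin (suc (suc k)) → Fin n) (f-inj : ∀ {i j} → f i ≡ f j → i ≡ j)
  (isolatedH : ∀ i v → adj H (f (suc i)) v ≡ false) (rooted : Rooted L) where

  open Glue H RH L RL f f-inj isolatedH rooted public
  open UnionEuler {n} {k} {g} {glued} {H} {L} gluedRotation RH RL faces+isolated-glued darts-union components-union deficitL public
  open UnionC4 H L f f-inj isolatedH rooted glued split H⊆glued L⊆glued public

  planar-glued : Planar glued
  planar-glued = gluedRotation , planar surplusH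

-- Vertex 0 is the root at which the piece is attached, so it brings `suc k` further vertices.
record Piece (k e g : ℕ) : Set where
  field
    L        : Graph (suc (suc k))
    RL       : Rotation L
    deficitL : Deficit RL g
    edgesL   : edges L ≡ e
    rootedL  : Rooted L

C4-free-eval : (L : Graph n) → isNo (C4-free? L) ≡ true → C4-free L
C4-free-eval L e i c with C4-free? L
... | no ¬c = ¬c (i , c)

planarBowtie : Piece 3 6 0
planarBowtie = record
  { L = bowtie ; RL = bowtieRotation ; deficitL = bowtie-deficit ; edgesL = refl
  ; rootedL = bowtie-rooted }

toroidalBowtie : Piece 3 6 2
toroidalBowtie = record
  { L = torusBowtie ; RL = torusBowtieRotation ; deficitL = torusBowtie-deficit ; edgesL = refl
  ; rootedL = torusBowtie-rooted }

-- A union of components of G is replaced by a connected graph embedded with the same genus, which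
-- keeps Euler's formula valid without knowing that the removed part is embedded in the sphere.
module Exchange {n k k' e g} (G : Graph n) (planarG : Planar G)
  (f : Fin (suc (suc k)) → Fin n) (f-inj : ∀ {i j} → f i ≡ f j → i ≡ j)
  (sep : Separation G (proj₁ planarG) f)
  (rootedK : Rooted (Separation.part sep)) (deficitK : Deficit (Separation.partRotation sep) g)
  (edgesK : edges (Separation.part sep) ≤ e) (piece : Piece k' e g)
  (C4-freeL : C4-free (Piece.L piece))
  (f' : Fin (suc (suc k')) → Fin n) (f'-inj : ∀ {i j} → f' i ≡ f' j → i ≡ j)
  (inside : ∀ i → Σ (Fin (suc (suc k))) λ j → f j ≡ f' (suc i)) where

  open Piece piece
  open Separation sep renaming (part to K; partRotation to RK)
  private
    K⊆G : ∀ {i j} → adj K i j ≡ true → adj G (f i) (f j) ≡ true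
    K⊆G {i} {j} e = trans (≡-sym (part≡G i j)) e
    RG : Rotation G
    RG = proj₁ planarG
    module U = Union rest K f f-inj (λ i → rest-isolated (suc i)) rootedK G splitG rest⊆G K⊆G
    fs : faces RG + isolated G + suc (suc k) ≡ faces restRotation + faces RK + isolated rest
    fs = U.Embedded.faces+isolated-union restRotation RK RG (U.none (rest-isolated zero)) agree
    module E = UnionEuler {n} {k} {g} {G} {rest} {K} RG restRotation RK
                 fs U.darts-union U.components-union deficitK

  inside-isolated : ∀ i v → adj rest (f' (suc i)) v ≡ false
  inside-isolated i v = let (j , eq) = inside i in subst (λ u → adj rest u v ≡ false) eq (rest-isolated j v)

  open Attach {n} {k'} {g} rest restRotation (E.surplus (proj₂ planarG)) L RL deficitL f' f'-inj inside-isolated rootedL public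

  edges≤ : edges G ≤ edges glued
  edges≤ = begin
    edges G                    ≡⟨ E.edges-union ⟩
    edges rest + edges K       ≤⟨ +-monoʳ-≤ (edges rest) edgesK ⟩
    edges rest + e             ≡⟨ cong (edges rest +_) edgesL ⟨
    edges rest + edges L       ≡⟨ edges-union ⟨
    edges glued ∎
    where open ≤-Reasoning

  C4-rest : ∀ {v p q r} → C4At glued v p q r → C4At rest v p q r
  C4-rest c = [ id , (λ { (i , ci) → ⊥-elim (C4-freeL i ci) }) ]′ (C4At-split c)

  C4-G : ∀ {v p q r} → C4At glued v p q r → C4At G v p q r
  C4-G c = C4At-mono rest⊆G (C4-rest c)

  ¬C4-f : ∀ i → ¬ InC4 glued (f i)
  ¬C4-f i (_ , _ , _ , c) = true≢false (C4At.vp (C4-rest c)) (rest-isolated i _)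

  -- The new part is C4-free, so each 4-cycle survives from `rest`. It cannot pass through a new
  -- edge's end: the root is on no 4-cycle of G, and the other vertices of the piece are isolated in
  -- `rest`.
  glued-closed : ¬ InC4 G (f' zero) → C4-closed G → C4-closed glued
  glued-closed root∉ G-closed {w = w} c e = case split e of λ where
    (inj₁ h) → G-closed (C4-G c) (rest⊆G h)
    (inj₂ (zero , j , refl , refl , _)) → ⊥-elim (root∉ (_ , _ , _ , C4-G c))
    (inj₂ (suc i , j , refl , refl , _)) → true≢false (C4At.vp (C4-rest c)) (inside-isolated i _)

  Exchanged : Set
  Exchanged = Σ (Graph n) λ G' → Planar G' × C4-closed G' × edges G ≤ edges G' ×
    (∀ u → InC4 G' u → InC4 G u) × (∀ i → ¬ InC4 G' (f i))

  exchanged : ¬ InC4 G (f' zero) → C4-closed G → Exchanged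
  exchanged root∉ G-closed = glued , planar-glued , glued-closed root∉ G-closed , edges≤ ,
    (λ { u (_ , _ , _ , c) → _ , _ , _ , C4-G c }) , ¬C4-f

-- The component of a 4-cycle, which has at most six edges, gives way to two triangles sharing x.
exchange : (G : Graph n) → Planar G → C4-closed G → ∀ {v p q r} (c : C4At G v p q r) → ∀ x → ¬ InC4 G x →
  Σ (Graph n) λ G' → Planar G' × C4-closed G' × edges G ≤ edges G' × (∀ u → InC4 G' u → InC4 G u) ×
    (∀ i → ¬ InC4 G' (square c i))
exchange {n} G planarG G-closed {v} {p} {q} {r} c x x∉ =
  given (separation G (proj₁ planarG) f (square-inj c) (square-closed c G-closed))
  where
  f : Fin 4 → Fin n
  f = square c

  inSquare : ∀ i → InC4 G (f i)
  inSquare 0F = p , q , r , c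
  inSquare 1F = q , r , v , rotate c
  inSquare 2F = r , v , p , rotate (rotate c)
  inSquare 3F = v , p , q , rotate (rotate (rotate c))

  f' : Fin 5 → Fin n
  f' zero    = x
  f' (suc i) = f i

  f'-inj : ∀ {i j} → f' i ≡ f' j → i ≡ j
  f'-inj {zero}  {zero}  e = refl
  -- The root `x` is on no 4-cycle, whereas all vertices of the square are on one.
  f'-inj {zero}  {suc j} e = ⊥-elim (x∉ (subst (InC4 G) (≡-sym e) (inSquare j)))
  f'-inj {suc i} {zero}  e = ⊥-elim (x∉ (subst (InC4 G) e (inSquare i)))
  f'-inj {suc i} {suc j} e = cong suc (square-inj c e)

  Result : Set
  Result = Σ (Graph n) λ G' → Planar G' × C4-closed G' × edges G ≤ edges G' ×
    (∀ u → InC4 G' u → InC4 G u) × (∀ i → ¬ InC4 G' (f i))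

  given : Separation G (proj₁ planarG) f → Result
  given sep = [ (λ d → with-piece {0} d planarBowtie (C4-free-eval bowtie refl)) , (λ d → with-piece {2} d toroidalBowtie (C4-free-eval torusBowtie refl)) ]′ (proj₁ deficits)
    where
    open Separation sep using () renaming (part to K; partRotation to RK; part≡G to K≡G)
    e₀₁ : adj K 0F 1F ≡ true
    e₀₁ = trans (K≡G 0F 1F) (C4At.vp c)
    e₁₂ : adj K 1F 2F ≡ true
    e₁₂ = trans (K≡G 1F 2F) (C4At.pq c)
    e₂₃ : adj K 2F 3F ≡ true
    e₂₃ = trans (K≡G 2F 3F) (C4At.qr c)
    e₃₀ : adj K 3F 0F ≡ true
    e₃₀ = trans (K≡G 3F 0F) (C4At.rv c)

    deficits : (Deficit RK 0 ⊎ Deficit RK 2) × edges K ≤ 6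
    deficits = FourVertices.deficit₀₂×edges≤6 K RK e₀₁ e₁₂ e₂₃ e₃₀

    with-piece : ∀ {g} → Deficit RK g → (piece : Piece 3 6 g) → C4-free (Piece.L piece) → Result
    with-piece {g} d piece free = Exchange.exchanged {n} {2} {3} {6} {g} G planarG f (square-inj c) sep
      (FourVertices.four-rooted K RK e₀₁ e₁₂ e₂₃ e₃₀) d (proj₂ deficits) piece free f' f'-inj (λ i → i , refl) x∉ G-closed

c4Count : Graph n → ℕ
c4Count G = countFin λ v → ⌊ inC4? G v ⌋

isYes-true : {P : Set} (d : Dec P) → P → ⌊ d ⌋ ≡ true
isYes-true (yes _) p = refl
isYes-true (no ¬p) p = ⊥-elim (¬p p)

isYes-sound : {P : Set} (d : Dec P) → ⌊ d ⌋ ≡ true → P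
isYes-sound (yes p) e = p

-- An exchange takes the four vertices of its square off all 4-cycles and puts no vertex on one, so
-- `c4Count` drops; `x` stays off them and can serve as the root again.
exchangeAll : (G : Graph n) → Planar G → C4-closed G → ∀ x → ¬ InC4 G x → Acc _<_ (c4Count G) →
  Σ (Graph n) λ G' → Planar G' × C4-free G' × edges G ≤ edges G'
exchangeAll {n} G pl cl x x∉ (acc rs) = case C4-free? G of λ where
    (no ¬c) → G , pl , (λ v c → ¬c (v , c)) , ≤-refl
    (yes (v , p , q , r , c)) → continue c (exchange G pl cl c x x∉)
  where
  continue : ∀ {v p q r} (c : C4At G v p q r) → (Σ (Graph n) λ G' → Planar G' × C4-closed G' × edges G ≤ edges G' ×
      (∀ u → InC4 G' u → InC4 G u) × (∀ i → ¬ InC4 G' (square c i))) →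
    Σ (Graph n) λ G' → Planar G' × C4-free G' × edges G ≤ edges G'
  continue {v} {p} {q} {r} c (G' , pl' , cl' , le , sub , gone) =
    let (G″ , pl″ , fr , le') = exchangeAll G' pl' cl' x (x∉ ∘ sub x) (rs fewer) in G″ , pl″ , fr , ≤-trans le le'
    where
    fewer : c4Count G' < c4Count G
    fewer = countFin-strict
      (λ u e → isYes-true (inC4? G u) (sub u (isYes-sound (inC4? G' u) e))) v
      (≢true λ e → gone 0F (isYes-sound (inC4? G' v) e))
      (isYes-true (inC4? G v) (p , q , r , c))

-- Graphs in which every vertex lies on a 4-cycle.

covered-≤ : (g : Fin m → Fin n) → (∀ {i j} → g i ≡ g j → i ≡ j) → (f : Fin k → Fin n) →
  (∀ i → Σ (Fin k) λ j → f j ≡ g i) → m ≤ k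
covered-≤ g g-inj f cov = injective⇒≤ {f = proj₁ ∘ cov} λ {i} {j} e →
  g-inj (trans (≡-sym (proj₂ (cov i))) (trans (cong f e) (proj₂ (cov j))))

module AllInC4 (G : Graph n) (closed : C4-closed G) (inC4 : ∀ v → InC4 G v) where

  degree≤3 : ∀ v → countFin (adj G v) ≤ 3
  degree≤3 v with inC4 v
  ... | p , q , r , c = covered-≤ rep (λ {i} {j} → uniq {i} {j}) nbr λ i → cover-nbr (rep i) (rep∈ i)
    where
    open Classes (countClasses (adj G v))
    nbr : Fin 3 → Fin n
    nbr 0F = p
    nbr 1F = q
    nbr 2F = r
    cover-nbr : ∀ w → adj G v w ≡ true → Σ (Fin 3) λ j → nbr j ≡ w
    cover-nbr w e with closed c e
    ... | inj₁ x        = 0F , ≡-sym x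
    ... | inj₂ (inj₁ x) = 1F , ≡-sym x
    ... | inj₂ (inj₂ x) = 2F , ≡-sym x

  record Closed (k : ℕ) : Set where
    field
      f     : Fin k → Fin n
      f-inj : ∀ {i j} → f i ≡ f j → i ≡ j
      f-adj : ∀ {i v} → adj G (f i) v ≡ true → Σ (Fin k) λ j → f j ≡ v

    spread : ∀ {u v} → Σ (Fin k) (λ j → f j ≡ u) → adj G u v ≡ true → Σ (Fin k) λ j → f j ≡ v
    spread (j , refl) e = f-adj e

  grow : Closed k → k < n → Closed (4 + k)
  grow {k} S k<n = case any? (λ w → ¬? (find f w)) of λ where
      (no h) → ⊥-elim (<⇒≱ k<n (covered-≤ {n} id id f λ w → case find f w of λ where
        (yes x) → x
        (no ¬x) → ⊥-elim (h (w , ¬x))))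
      (yes (w , ¬fw)) → let (p , q , r , c) = inC4 w in extend c ¬fw
    where
    open Closed S
    extend : ∀ {w p q r} → C4At G w p q r → ¬ (Σ (Fin k) λ j → f j ≡ w) → Closed (4 + k)
    extend {w} {p} {q} {r} c ¬fw = record
      { f     = h ∘ splitAt 4
      ; f-inj = λ {i} {j} e → trans (≡-sym (join-splitAt 4 k i))
                  (trans (cong (Fin.join 4 k) (h-inj (splitAt 4 i) (splitAt 4 j) e)) (join-splitAt 4 k j))
      ; f-adj = λ {i} e → let (s , eq) = h-adj (splitAt 4 i) e in
                  Fin.join 4 k s , trans (cong h (Finₚ.splitAt-join 4 k s)) eq
      }
      where
      open C4At c
      h : Fin 4 ⊎ Fin k → Fin n
      h = [ square c , f ]′
      -- The set chosen so far is closed under adjacency, so a vertex of the square in it would pull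
      -- `w` in along the cycle.
      apart : ∀ i j → square c i ≢ f j
      apart 0F j e = ¬fw (j , ≡-sym e)
      apart 1F j e = ¬fw (spread (j , ≡-sym e) (dart-sym G vp))
      apart 2F j e = ¬fw (spread (spread (j , ≡-sym e) (dart-sym G pq)) (dart-sym G vp))
      apart 3F j e = ¬fw (spread (j , ≡-sym e) rv)
      h-inj : ∀ s t → h s ≡ h t → s ≡ t
      h-inj (inj₁ i) (inj₁ j) e = cong inj₁ (square-inj c e)
      h-inj (inj₂ i) (inj₂ j) e = cong inj₂ (f-inj e)
      h-inj (inj₁ i) (inj₂ j) e = ⊥-elim (apart i j e)
      h-inj (inj₂ i) (inj₁ j) e = ⊥-elim (apart j i (≡-sym e))
      h-adj : ∀ s {v} → adj G (h s) v ≡ true → Σ (Fin 4 ⊎ Fin k) λ t → h t ≡ v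
      h-adj (inj₁ i) e = let (j , eq) = square-closed c closed e in inj₁ j , eq
      h-adj (inj₂ i) e = let (j , eq) = f-adj e in inj₂ j , eq

  tile : ∀ fuel a → Closed (a * 4) → n < fuel + a * 4 → Σ ℕ λ a → n ≡ a * 4
  tile fuel a S lt with a * 4 ≟ n
  ... | yes e = a , ≡-sym e
  -- Without fuel the bound reads n < a * 4, although a * 4 distinct vertices have been found.
  tile zero a S lt | no ne = ⊥-elim (<⇒≱ lt (injective⇒≤ (Closed.f-inj S)))
  tile (suc fuel) a S lt | no ne = tile fuel (suc a) (grow S (≤∧≢⇒< (injective⇒≤ (Closed.f-inj S)) ne))
    (≤-trans lt (≤-trans (s≤s (+-monoʳ-≤ fuel (m≤n+m (a * 4) 3))) (≤-reflexive (≡-sym (+-suc fuel (3 + a * 4))))))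

  4∣n : Σ ℕ λ a → n ≡ a * 4
  4∣n = tile (suc n) 0 (record { f = λ () ; f-inj = λ { {()} } ; f-adj = λ { {()} } }) (s≤s (m≤m+n n 0))

-- The extremal graphs.

emptyGraph : ∀ n → Graph n
emptyGraph n = record { adj = λ _ _ → false ; sym = λ _ _ → refl ; irrefl = λ _ → refl }

edges-empty : ∀ n → edges (emptyGraph n) ≡ 0
edges-empty n = double-injective (trans (≡-sym (darts≡2edges (emptyGraph n)))
  (classes-unique ≡-PER (dartClasses (emptyGraph n)) (noClasses λ ())))

-- The starting point of all examples: a table supplies only a deficit, and attaching it to the
-- empty graph on n vertices turns this into planarity.
emptyPlanar : ∀ n → Planar (emptyGraph n)
emptyPlanar n = R , (begin
    n + faces R + isolated E     ≡⟨ cong₂ (λ a b → n + a + b) no-faces all-isolated ⟩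
    n + 0 + n                    ≡⟨ cong (_+ n) (+-identityʳ n) ⟩
    n + n                        ≡⟨ cong (n +_) (+-identityʳ n) ⟨
    2 * n                        ≡⟨ cong₂ (λ a b → a + 2 * b) (edges-empty n) all-components ⟨
    edges E + 2 * components E   ∎)
  where
  open ≡-Reasoning
  E : Graph n
  E = emptyGraph n
  R : Rotation E
  R = rotation (λ _ → id) λ _ → cyclic-empty λ ()
  no-faces : faces R ≡ 0
  no-faces = classes-unique (Faces.orb-PER R) (Faces.faceClasses R) (noClasses λ ())
  all-isolated : isolated E ≡ n
  all-isolated = classes-unique ≡-PER (isolatedClasses E) (reClasses (finClasses n) (λ _ _ → refl) (λ _ → tt))
  all-components : components E ≡ n
  all-components = classes-unique walk-PER (componentClasses E) (record
    { rep = id ; rep∈ = λ _ → tt ; cover = λ {v} _ → v , here ; uniq = walk-isolated λ _ → refl })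

module _ {n k e} (H : Graph n) (planarH : Planar H) (piece : Piece k e 0)
  (f : Fin (suc (suc k)) → Fin n) (f-inj : ∀ {i j} → f i ≡ f j → i ≡ j)
  (isolatedH : ∀ i v → adj H (f (suc i)) v ≡ false) where
  open Piece piece

  record Attached : Set where
    field
      G : Graph n
      planarG : Planar G
      edgesG  : edges G ≡ edges H + e
      splitG  : ∀ {u v} → adj G u v ≡ true →
        adj H u v ≡ true ⊎ (Σ _ λ i → Σ _ λ j → u ≡ f i × v ≡ f j × adj L i j ≡ true)
      isolated-out : ∀ {v} → (∀ i → f i ≢ v) → (∀ u → adj H v u ≡ false) → ∀ u → adj G v u ≡ false
      free : C4-free H → C4-free L → C4-free G

  attach : Attached
  attach = record
    { G = glued ; planarG = planar-glued ; edgesG = trans edges-union (cong (edges H +_) edgesL) ; splitG = split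
    ; isolated-out = G-isolated
    ; free = λ freeH freeL v (_ , _ , _ , c) → case C4At-split c of λ where
        (inj₁ c')       → freeH v (_ , _ , _ , c')
        (inj₂ (i , c')) → freeL i c'
    }
    where
    open Attach {n} {k} {0} H (proj₁ planarH) (trans (proj₂ planarH) (≡-sym (+-identityʳ _)))
      L RL deficitL f f-inj isolatedH rootedL

truncatedTetrahedronPiece : Piece 10 18 0
truncatedTetrahedronPiece = record
  { L = truncatedTetrahedron ; RL = truncatedTetrahedronRotation ; deficitL = truncatedTetrahedron-deficit
  ; edgesL = refl ; rootedL = truncatedTetrahedron-rooted }

tetrahedronPiece : Piece 2 6 0
tetrahedronPiece = record
  { L = tetrahedron ; RL = tetrahedronRotation ; deficitL = tetrahedron-deficit ; edgesL = refl ; rootedL = tetrahedron-rooted }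

example8Piece : Piece 6 11 0
example8Piece = record
  { L = example8 ; RL = example8Rotation ; deficitL = example8-deficit ; edgesL = refl ; rootedL = example8-rooted }

empty-C4-free : C4-free (emptyGraph n)
empty-C4-free v (_ , _ , _ , c) = case C4At.vp c of λ ()

record Chain (n b : ℕ) : Set where
  field
    G       : Graph n
    planarG : Planar G
    freeG   : C4-free G
    edgesG  : edges G ≡ 18 + b * 6
    unused  : ∀ v → 12 + b * 4 ≤ toℕ v → ∀ u → adj G v u ≡ false

-- A truncated tetrahedron with b bowties at one of its vertices.
chain : ∀ n b → 12 + b * 4 ≤ n → Chain n b
chain n zero le = record
  { G = G ; planarG = planarG ; freeG = free empty-C4-free (C4-free-eval truncatedTetrahedron refl)
  ; edgesG = trans edgesG (cong (_+ 18) (edges-empty n))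
  ; unused = λ v 12≤v → isolated-out
      (λ i e → <⇒≱ (Finₚ.toℕ<n i) (≤-trans 12≤v (≤-reflexive (trans (cong toℕ (≡-sym e)) (Finₚ.toℕ-inject≤ i le))))) (λ _ → refl)
  }
  where
  open Attached (attach (emptyGraph n) (emptyPlanar n) truncatedTetrahedronPiece (λ i → Fin.inject≤ i le)
    (Finₚ.inject≤-injective le le _ _) (λ _ _ → refl))
chain n (suc b) le = record
  { G = A.G ; planarG = A.planarG ; freeG = A.free freeG (C4-free-eval bowtie refl)
  ; edgesG = trans A.edgesG (trans (cong (_+ 6) edgesG) (cong (18 +_) (+-comm (b * 6) 6)))
  ; unused = λ v old≤v → A.isolated-out
      (λ { zero e → <⇒≱ z<s (≤-trans old≤v (≤-reflexive (trans (cong toℕ (≡-sym e)) (toℕ-fromℕ< _))))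
         ; (suc i) e → <⇒≱ (+-monoʳ-< old (Finₚ.toℕ<n i))
             (≤-trans (≤-reflexive shift) (≤-trans old≤v (≤-reflexive (trans (cong toℕ (≡-sym e)) (toℕ-fromℕ< _))))) })
      (unused v (≤-trans (≤-trans (m≤m+n old 4) (≤-reflexive shift)) old≤v))
  }
  where
  old : ℕ
  old = 12 + b * 4
  shift : old + 4 ≡ 12 + suc b * 4
  shift = trans (+-assoc 12 (b * 4) 4) (cong (12 +_) (+-comm (b * 4) 4))
  room : old + 4 ≤ n
  room = ≤-trans (≤-reflexive shift) le
  open Chain (chain n b (≤-trans (m≤m+n old 4) room))
  bound : ∀ (i : Fin 4) → old + toℕ i < n
  bound i = <-≤-trans (+-monoʳ-< old (Finₚ.toℕ<n i)) room
  f : Fin 5 → Fin n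
  f zero    = fromℕ< {0} (≤-trans z<s room)
  f (suc i) = fromℕ< (bound i)
  f-inj : ∀ {i j} → f i ≡ f j → i ≡ j
  f-inj {i} {j} e = go i j (trans (≡-sym (index i)) (trans (cong toℕ e) (index j)))
    where
    position : Fin 5 → ℕ
    position zero    = 0
    position (suc i) = old + toℕ i
    index : ∀ i → toℕ (f i) ≡ position i
    index zero    = toℕ-fromℕ< _
    index (suc i) = toℕ-fromℕ< _
    go : ∀ i j → position i ≡ position j → i ≡ j
    go zero zero _ = refl
    go (suc i) (suc j) e = cong suc (toℕ-injective (+-cancelˡ-≡ old _ _ e))
  module A = Attached (attach G planarG planarBowtie f f-inj
    (λ i → unused (f (suc i)) (≤-trans (m≤m+n old (toℕ i)) (≤-reflexive (≡-sym (toℕ-fromℕ< (bound i)))))))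

example8-attains : Σ (Graph 8) λ G → Planar G × C4-free G × edges G ≡ 11
example8-attains = G , planarG , free empty-C4-free (C4-free-eval example8 refl) , trans edgesG (cong (_+ 11) (edges-empty 8))
  where
  open Attached (attach (emptyGraph 8) (emptyPlanar 8) example8Piece id id (λ _ _ → refl))

-- No edge joins the two images, and `C4⁺` is connected with five vertices, so it would have to fit
-- into four.
twoTetrahedra : (f₁ f₂ : Fin 4 → Fin n) → (∀ {i j} → f₁ i ≡ f₁ j → i ≡ j) → (∀ {i j} → f₂ i ≡ f₂ j → i ≡ j) →
  (∀ i j → f₁ i ≢ f₂ j) → (∀ u → Σ (Fin 4) (λ j → f₁ j ≡ u) ⊎ Σ (Fin 4) (λ j → f₂ j ≡ u)) →
  Σ (Graph n) λ G → Planar G × Free C4⁺ G × edges G ≡ 12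
twoTetrahedra {n} f₁ f₂ inj₁' inj₂' f₁≢f₂ cover = Two.G , Two.planarG , free ,
    trans Two.edgesG (cong (_+ 6) (trans One.edgesG (cong (_+ 6) (edges-empty n))))
  where
  module One = Attached (attach (emptyGraph n) (emptyPlanar n) tetrahedronPiece f₁ inj₁' (λ _ _ → refl))
  module Two = Attached (attach One.G One.planarG tetrahedronPiece f₂ inj₂'
    (λ i → One.isolated-out (λ j → f₁≢f₂ j (suc i)) λ _ → refl))
  stay₁ : ∀ {u v} → Σ (Fin 4) (λ j → f₁ j ≡ u) → adj Two.G u v ≡ true → Σ (Fin 4) (λ j → f₁ j ≡ v)
  stay₁ (k , refl) e = case Two.splitG e of λ where
    (inj₂ (i , j , eq , _ , _)) → ⊥-elim (f₁≢f₂ k i eq)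
    (inj₁ e') → case One.splitG e' of λ where
      (inj₂ (i , j , _ , refl , _)) → j , refl
  stay₂ : ∀ {u v} → Σ (Fin 4) (λ j → f₂ j ≡ u) → adj Two.G u v ≡ true → Σ (Fin 4) (λ j → f₂ j ≡ v)
  stay₂ (k , refl) e = case Two.splitG e of λ where
    (inj₂ (i , j , _ , refl , _)) → j , refl
    (inj₁ e') → case One.splitG e' of λ where
      (inj₂ (i , j , eq , _ , _)) → ⊥-elim (f₁≢f₂ i k (≡-sym eq))
  free : Free C4⁺ Two.G
  free (g , g-inj , h) = <⇒≱ (n<1+n 4) (case cover (g 0F) of λ where
      (inj₁ x) → covered-≤ g g-inj f₁ (all stay₁ x)
      (inj₂ x) → covered-≤ g g-inj f₂ (all stay₂ x))
    where
    all : ∀ {P : Fin n → Set} → (∀ {u v} → P u → adj Two.G u v ≡ true → P v) → P (g 0F) → ∀ i → P (g i)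
    all st p 0F = p
    all st p 1F = st p (h 0F 1F refl)
    all st p 2F = st (st p (h 0F 1F refl)) (h 1F 2F refl)
    all st p 3F = st (st (st p (h 0F 1F refl)) (h 1F 2F refl)) (h 2F 3F refl)
    all st p 4F = st p (h 0F 4F refl)

-- Decidability of planarity

-- Functions are enumerated by their codes. A given function agrees only pointwise with the one
-- decoded from its code, hence the condition that `P` respects pointwise equality.
searchFun : {P : (Fin k → Fin n) → Set} → (∀ f → Dec (P f)) →
  (∀ {f g} → (∀ i → f i ≡ g i) → P f → P g) → Dec (Σ _ P)
searchFun P? resp with any? (P? ∘ Fin.finToFun)
... | yes (c , p) = yes (Fin.finToFun c , p)
... | no ¬p = no λ { (f , p) → ¬p (Fin.funToFin f , resp (λ i → ≡-sym (Finₚ.finToFun-funToFin f i)) p) }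

searchFun₂ : ∀ {k l n} {P : (Fin k → Fin l → Fin n) → Set} → (∀ f → Dec (P f)) →
  (∀ {f g} → (∀ i j → f i j ≡ g i j) → P f → P g) → Dec (Σ _ P)
searchFun₂ {k} {l} {n} {P} P? resp = map′
  (λ { (f , p) → _ , p })
  (λ { (f , p) → (λ i → f (proj₁ (remQuot {k} l i)) (proj₂ (remQuot {k} l i))) ,
       resp (λ i j → ≡-sym (cong (λ x → f (proj₁ x) (proj₂ x)) (Finₚ.remQuot-combine i j))) p })
  (searchFun {k * l} {n} {P = λ f → P λ i j → f (combine i j)} (λ f → P? _) λ e → resp λ i j → e _)

-- `transit` asks for an unbounded number of steps. Once `σ` is known to be injective on the
-- neighbours, orbits close up within n steps and a bounded test decides it.
cyclicOn? : (N : Fin n → Bool) (σ : Fin n → Fin n) → Dec (CyclicOn (λ u → N u ≡ true) σ)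
cyclicOn? {n} N σ with all? (λ u → (N u ≟ᵇ true) →-dec (N (σ u) ≟ᵇ true))
... | no ¬p = no λ c → ¬p λ u → stays c
... | yes st with all? (λ u → all? (λ w → (N u ≟ᵇ true) →-dec ((N w ≟ᵇ true) →-dec ((σ u Fin.≟ σ w) →-dec (u Fin.≟ w)))))
...   | no ¬p = no λ c → ¬p λ u w → injective c
...   | yes ij with all? (λ u → all? (λ w → (N u ≟ᵇ true) →-dec ((N w ≟ᵇ true) →-dec
                     any? (λ (k : Fin n) → iter σ (toℕ k) u Fin.≟ w))))
...     | yes tr = yes (record { stays = st _ ; injective = ij _ _ ; transit = λ {u} {w} p q → let (k , e) = tr u w p q in toℕ k , e })
...     | no ¬p = no λ c → ¬p λ u w p q → P.orb-bounded p (CyclicOn.transit c p q)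
  where
  module P = Permutation n id id σ (λ u → N u ≡ true) (st _) (ij _ _)

module _ {G G' : Graph n} (e : ∀ u v → adj G u v ≡ adj G' u v) where

  edges-cong : edges G ≡ edges G'
  edges-cong = edgesOf-cong G e

  isolated-cong : isolated G ≡ isolated G'
  isolated-cong = countFin-cong λ v → allFinᵇ-cong λ u → cong not (e v u)

  components-cong : components G ≡ components G'
  components-cong = classes-unique walk-PER (record
    { rep = rep ; rep∈ = rep∈ ; cover = λ p → let (i , w) = cover p in i , to w ; uniq = uniq ∘ from }) (componentClasses G')
    where
    open Classes (componentClasses G)
    to : ∀ {u v} → Walk G u v → Walk G' u v
    to = walk-map id λ {u} {v} h → here ▷ trans (≡-sym (e u v)) h
    from : ∀ {u v} → Walk G' u v → Walk G u v
    from = walk-map id λ {u} {v} h → here ▷ trans (e u v) h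

  module _ (R : Rotation G) {τ : Fin n → Fin n → Fin n} (eτ : ∀ v u → ρ R v u ≡ τ v u) where

    cyclic-cong : ∀ v → CyclicOn (Nbr G' v) (τ v)
    cyclic-cong v = cyclic-image id (cyclicAt R v) (λ {a} _ → ≡-sym (eτ v a)) id
      (λ q → _ , refl , trans (e v _) q) (λ p → trans (≡-sym (e v _)) p)

    faces-cong : faces R ≡ faces (rotation {G = G'} τ cyclic-cong)
    faces-cong = trans (facesOf-cong R {adj G'} {τ} e λ {v} {u} _ → eτ v u)
      (≡-sym (facesOf-cong (rotation {G = G'} τ cyclic-cong) {adj G'} {τ} (λ _ _ → refl) λ _ → refl))

    euler-cong : n + faces R + isolated G ≡ edges G + 2 * components G →
      n + faces (rotation {G = G'} τ cyclic-cong) + isolated G' ≡ edges G' + 2 * components G'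
    euler-cong h = trans (≡-sym (cong₂ (λ a b → n + a + b) faces-cong isolated-cong))
      (trans h (cong₂ (λ a b → a + 2 * b) edges-cong components-cong))

  -- The search for a maximum meets a graph only up to pointwise equality of adjacency, and with
  -- varying proofs of symmetry and irreflexivity.
  Planar-cong : Planar G → Planar G'
  Planar-cong (R , h) = rotation (ρ R) (cyclic-cong R λ _ _ → refl) , euler-cong R (λ _ _ → refl) h

  C4-free-cong : C4-free G → C4-free G'
  C4-free-cong free v (_ , _ , _ , c) = free v (_ , _ , _ , C4At-mono (λ {u} {v} h → trans (e u v) h) c)

Planar? : (G : Graph n) → Dec (Planar G)
Planar? {n} G = map′
  (λ { (σ , c , h) → rotation σ c , h })
  (λ { (R , h) → ρ R , cyclicAt R , h })
  (searchFun₂ {P = P} P? λ { {σ} {τ} e (c , h) →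
    cyclic-cong {G = G} {G} (λ _ _ → refl) (rotation σ c) e , euler-cong {G = G} {G} (λ _ _ → refl) (rotation σ c) e h })
  where
  P : (Fin n → Fin n → Fin n) → Set
  P σ = Σ (∀ v → CyclicOn (Nbr G v) (σ v)) λ c →
          n + faces {G = G} (rotation σ c) + isolated G ≡ edges G + 2 * components G
  P? : ∀ σ → Dec (P σ)
  P? σ with all? (λ v → cyclicOn? (adj G v) (σ v))
  ... | no ¬c = no (¬c ∘ proj₁)
  ... | yes c = map′ (c ,_) proj₂ (_ ≟ _)

Attains : ℕ → ℕ → Set
Attains n m = Σ (Graph n) λ G → Planar G × C4-free G × edges G ≡ m

Attains? : ∀ n m → Dec (Attains n m)
Attains? n m = map′
  (λ { (a , s , i , p) → record { adj = λ u v → bool (a u v) ; sym = s ; irrefl = i } , p })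
  (λ { (G , p , f , e) →
     let s = λ u v → trans (bool-bit _) (trans (sym G u v) (≡-sym (bool-bit _)))
         i = λ v → trans (bool-bit _) (irrefl G v)
         G' = graph (λ u v → bit (adj G u v)) s i
         same = λ u v → ≡-sym (bool-bit (adj G u v))
     in (λ u v → bit (adj G u v)) , s , i , Planar-cong {G = G} {G'} same p , C4-free-cong {G = G} {G'} same f ,
        trans (≡-sym (edges-cong {G = G} {G'} same)) e })
  (searchFun₂ {P = P} P? λ { {a} {b} h (s , i , p , f , e) →
     let same = λ u v → cong bool (h u v)
         s' = λ u v → trans (≡-sym (same u v)) (trans (s u v) (same v u))
         i' = λ v → trans (≡-sym (same v v)) (i v)
     in s' , i' , Planar-cong {G = graph a s i} {graph b s' i'} same p ,
        C4-free-cong {G = graph a s i} {graph b s' i'} same f ,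
        trans (≡-sym (edges-cong {G = graph a s i} {graph b s' i'} same)) e })
  where
  bool : Fin 2 → Bool
  bool 0F = false
  bool 1F = true
  bit : Bool → Fin 2
  bit false = 0F
  bit true  = 1F
  bool-bit : ∀ b → bool (bit b) ≡ b
  bool-bit false = refl
  bool-bit true  = refl
  graph : (a : Fin n → Fin n → Fin 2) → (∀ u v → bool (a u v) ≡ bool (a v u)) → (∀ v → bool (a v v) ≡ false) → Graph n
  graph a s i = record { adj = λ u v → bool (a u v) ; sym = s ; irrefl = i }
  P : (Fin n → Fin n → Fin 2) → Set
  P a = Σ (∀ u v → bool (a u v) ≡ bool (a v u)) λ s → Σ (∀ v → bool (a v v) ≡ false) λ i →
        Planar (graph a s i) × C4-free (graph a s i) × edges (graph a s i) ≡ m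
  P? : ∀ a → Dec (P a)
  P? a with all? (λ u → all? (λ v → bool (a u v) ≟ᵇ bool (a v u))) | all? (λ v → bool (a v v) ≟ᵇ false)
  ... | no ¬s | _     = no (¬s ∘ proj₁)
  ... | yes _ | no ¬i = no (¬i ∘ proj₁ ∘ proj₂)
  ... | yes s | yes i with Planar? (graph a s i)
  ...   | no ¬p = no λ { (s' , i' , p , _) → ¬p (Planar-cong {G = graph a s' i'} (λ _ _ → refl) p) }
  ...   | yes p with C4-free? (graph a s i)
  ...     | yes (v , c) = no λ { (s' , i' , _ , f , _) → C4-free-cong {G = graph a s' i'} {graph a s i} (λ _ _ → refl) f v c }
  ...     | no ¬c with edges (graph a s i) ≟ m
  ...       | yes e = yes (s , i , p , (λ v c → ¬c (v , c)) , e)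
  ...       | no ¬e = no λ { (s' , i' , _ , _ , e) → ¬e e }

edges≤n² : (G : Graph n) → edges G ≤ n * n
edges≤n² {n} G = begin
  edges G             ≤⟨ m≤m+n (edges G) (edges G) ⟩
  edges G + edges G   ≡⟨ darts≡2edges G ⟨
  darts G             ≤⟨ sumFin-mono (λ u → countFin-≤ (adj G u)) ⟩
  sumFin {n} (λ _ → n) ≡⟨ sumFin-const n n ⟩
  n * n               ∎
  where open ≤-Reasoning

maximum : (P : ℕ → Set) → (∀ m → Dec (P m)) → ∀ b → (∀ m → P m → m ≤ b) → ∀ {m₀} → P m₀ →
  Σ ℕ λ m → P m × (∀ m' → P m' → m' ≤ m)
maximum P P? b bound p₀ with P? b
... | yes p = b , p , bound
maximum P P? zero    bound {m₀} p₀ | no ¬p = ⊥-elim (¬p (subst P (n≤0⇒n≡0 (bound m₀ p₀)) p₀))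
maximum P P? (suc b) bound p₀ | no ¬p =
  maximum P P? b (λ m p → s≤s⁻¹ (≤∧≢⇒< (bound m p) λ { refl → ¬p p })) p₀

maxC4-free : ∀ n → Σ ℕ λ m → Attains n m × (∀ (G : Graph n) → Planar G → C4-free G → edges G ≤ m)
maxC4-free n = let (m , a , top) = maximum (Attains n) (Attains? n) (n * n)
                     (λ { _ (G , _ , _ , refl) → edges≤n² G }) (emptyGraph n , emptyPlanar n , empty-C4-free , edges-empty n)
               in m , a , λ G p f → top (edges G) (G , p , f , refl)

-- Search for C4-free graphs on eight vertices.

-- A graph whose vertices are added one at a time; the newest vertex is zero.
data Rows : ℕ → Set where
  []  : Rows 0
  _▹_ : Rows n → Vec Bool n → Rows (suc n)

adjR : Rows n → Fin n → Fin n → Bool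
adjR (R ▹ r) zero    zero    = false
adjR (R ▹ r) zero    (suc v) = Vec.lookup r v
adjR (R ▹ r) (suc u) zero    = Vec.lookup r u
adjR (R ▹ r) (suc u) (suc v) = adjR R u v

weight : Rows n → ℕ
weight []      = 0
weight (R ▹ r) = countFin (Vec.lookup r) + weight R

tailGraph : Graph (suc n) → Graph n
tailGraph H = record
  { adj = λ u v → adj H (suc u) (suc v) ; sym = λ u v → sym H (suc u) (suc v) ; irrefl = λ v → irrefl H (suc v) }

rowsOf : Graph n → Rows n
rowsOf {zero}  H = []
rowsOf {suc n} H = rowsOf (tailGraph H) ▹ Vec.tabulate (λ v → adj H zero (suc v))

adjR-rowsOf : (H : Graph n) → ∀ u v → adjR (rowsOf H) u v ≡ adj H u v
adjR-rowsOf H zero    zero    = ≡-sym (irrefl H zero)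
adjR-rowsOf H zero    (suc v) = lookup∘tabulate (λ v → adj H zero (suc v)) v
adjR-rowsOf H (suc u) zero    = trans (lookup∘tabulate (λ v → adj H zero (suc v)) u) (sym H zero (suc u))
adjR-rowsOf H (suc u) (suc v) = adjR-rowsOf (tailGraph H) u v

weight-rowsOf : (H : Graph n) → weight (rowsOf H) ≡ edges H
weight-rowsOf {zero}  H = refl
weight-rowsOf {suc n} H = cong₂ _+_ (countFin-cong (lookup∘tabulate (λ v → adj H zero (suc v)))) (weight-rowsOf (tailGraph H))

tail-C4-free : (H : Graph (suc n)) → C4-free H → C4-free (tailGraph H)
tail-C4-free H free v (p , q , r , c4At a b c d e f) =
  free (suc v) (suc p , suc q , suc r , c4At a b c d (e ∘ Finₚ.suc-injective) (f ∘ Finₚ.suc-injective))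

-- The 2^28 graphs on eight vertices are too many to list. A row is chosen entry by entry and given
-- up as soon as a new neighbour conflicts with one in `chosen`. `f` names the vertices still to be
-- decided, and the continuation `p` receives the finished row.
choose : ∀ k → (Fin j → Fin j → Bool) → (Fin j → Bool → Bool) → (Fin k → Fin j) → List (Fin j) → (Vec Bool k → Bool) → Bool
allOk : (Fin j → Bool) → List (Fin j) → Bool
allOk ok []       = true
allOk ok (a ∷ as) = ok a ∧ allOk ok as
choose zero    ok allow f chosen p = p []
choose (suc k) ok allow f chosen p =
  (allow (f zero) false ⇒ᵇ choose k ok allow (f ∘ suc) chosen λ r → p (false ∷ r)) ∧
  ((allow (f zero) true ∧ allOk (λ a → ok a (f zero)) chosen) ⇒ᵇ
    choose k ok allow (f ∘ suc) (f zero ∷ chosen) λ r → p (true ∷ r))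

allOk-complete : (ok : Fin j → Bool) → ∀ {as} → All (λ a → ok a ≡ true) as → allOk ok as ≡ true
allOk-complete ok []       = refl
allOk-complete ok (p ∷ ps) = ∧-intro p (allOk-complete ok ps)

choose-sound : ∀ k (ok : Fin j → Fin j → Bool) (allow : Fin j → Bool → Bool) (f : Fin k → Fin j) chosen p →
  choose k ok allow f chosen p ≡ true → ∀ r → (∀ i → allow (f i) (Vec.lookup r i) ≡ true) →
  (∀ i → Vec.lookup r i ≡ true → All (λ a → ok a (f i) ≡ true) chosen) →
  (∀ i i' → i ≢ i' → Vec.lookup r i ≡ true → Vec.lookup r i' ≡ true → ok (f i) (f i') ≡ true) → p r ≡ true
choose-sound zero    ok allow f chosen p e []          al ch pw = e
choose-sound (suc k) ok allow f chosen p e (false ∷ r) al ch pw =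
  choose-sound k ok allow (f ∘ suc) chosen (λ r → p (false ∷ r)) (⇒ᵇ-elim {allow (f zero) false} (proj₁ (∧-true e)) (al zero))
    r (al ∘ suc) (ch ∘ suc) (λ i i' ne → pw (suc i) (suc i') (ne ∘ Finₚ.suc-injective))
choose-sound (suc k) ok allow f chosen p e (true ∷ r) al ch pw =
  choose-sound k ok allow (f ∘ suc) (f zero ∷ chosen) (λ r → p (true ∷ r))
    (⇒ᵇ-elim {allow (f zero) true ∧ allOk (λ a → ok a (f zero)) chosen}
      (proj₂ (∧-true {allow (f zero) false ⇒ᵇ choose k ok allow (f ∘ suc) chosen (λ r → p (false ∷ r))} e))
      (∧-intro (al zero) (allOk-complete (λ a → ok a (f zero)) (ch zero refl))))
    r (al ∘ suc) (λ i e → pw zero (suc i) (λ ()) refl e ∷ ch (suc i) e)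
    (λ i i' ne → pw (suc i) (suc i') (ne ∘ Finₚ.suc-injective))

-- A new vertex may be joined to both a and b without closing a 4-cycle.
compatible : Rows n → Fin n → Fin n → Bool
compatible R a b = not (anyFinᵇ λ c → adjR R a c ∧ adjR R c b)

-- New vertices enter at `zero`, so the oldest one keeps the greatest index; in the application it
-- has maximal degree.
lastFin : ∀ m → Fin (m + 1)
lastFin m = m ↑ʳ 0F

-- A flag records whether a vertex is adjacent to the oldest one.
obeys : ∀ {m} → Bool → Fin (m + 1) → Bool → Bool
obeys {m} b i x = (i == lastFin m) ⇒ᵇ (x ≡ᵇᵇ b)

-- The older vertices are treated first and their graph is passed to the continuation, so a conflict
-- among them cuts off all extensions.
run : ∀ {m} → Vec Bool m → (Rows (m + 1) → Bool) → Bool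
run []              leaf = leaf ([] ▹ [])
run {suc m} (b ∷ bs) leaf =
  run bs λ R → choose (m + 1) (compatible R) (obeys b) id [] λ r → leaf (R ▹ r)

run-sound : ∀ {m} (bs : Vec Bool m) leaf → run bs leaf ≡ true → (H : Graph (m + 1)) → C4-free H →
  (∀ i → adj H (i ↑ˡ 1) (lastFin m) ≡ Vec.lookup bs i) → leaf (rowsOf H) ≡ true
run-sound []       leaf e H free flags = e
run-sound {suc m} (b ∷ bs) leaf e H free flags =
  choose-sound (m + 1) (compatible R) (obeys b) id [] (λ r → leaf (R ▹ r))
    (run-sound bs (λ R → choose (m + 1) (compatible R) (obeys b) id [] λ r → leaf (R ▹ r)) e
      (tailGraph H) (tail-C4-free H free) (λ i → flags (suc i)))
    row obeyed (λ _ _ → []) fits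
  where
  R : Rows (m + 1)
  R = rowsOf (tailGraph H)
  row : Vec Bool (m + 1)
  row = Vec.tabulate (λ v → adj H zero (suc v))
  row-adj : ∀ i → Vec.lookup row i ≡ adj H zero (suc i)
  row-adj = lookup∘tabulate (λ v → adj H zero (suc v))
  ≡ᵇᵇ-refl : ∀ x → (x ≡ᵇᵇ x) ≡ true
  ≡ᵇᵇ-refl true  = refl
  ≡ᵇᵇ-refl false = refl
  obeyed : ∀ i → obeys b i (Vec.lookup row i) ≡ true
  obeyed i with i Fin.≟ lastFin m
  ... | no _     = refl
  ... | yes refl = trans (cong (_≡ᵇᵇ b) (trans (row-adj i) (flags zero))) (≡ᵇᵇ-refl b)
  fits : ∀ i i' → i ≢ i' → Vec.lookup row i ≡ true → Vec.lookup row i' ≡ true → compatible R i i' ≡ true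
  fits i i' ne p p' = cong not (≢true λ h →
    let (c , x) = anyFinᵇ-true (λ c → adjR R i c ∧ adjR R c i') h
        (ic , ci') = ∧-true {adjR R i c} x
    in free zero (suc i , suc c , suc i' , c4At (trans (≡-sym (row-adj i)) p)
         (trans (≡-sym (adjR-rowsOf (tailGraph H) i c)) ic) (trans (≡-sym (adjR-rowsOf (tailGraph H) c i')) ci')
         (dart-sym H (trans (≡-sym (row-adj i')) p')) (λ ()) (ne ∘ Finₚ.suc-injective)))

-- Graphs with a vertex of degree above Δ are let through, since the oldest vertex, of degree Δ, is
-- meant to have maximal degree.
sparseᵇ : ℕ → Rows n → Bool
sparseᵇ Δ R = (weight R ≤ᵇ 11) ∨ anyFinᵇ λ u → suc Δ ≤ᵇ countFin (adjR R u)

-- In order of addition, the neighbours of the oldest vertex follow directly after it. This removes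
-- much of the symmetry, and as they all share the oldest vertex, any other vertex can be joined to
-- at most one of them.
flagsOf : ∀ k l → Vec Bool (k + l)
flagsOf k l = Vec.tabulate λ i → [ (λ _ → false) , (λ _ → true) ]′ (splitAt k i)

-- The flags of seven vertices, Δ of them true, and the oldest vertex make eight. For Δ below 3 the
-- degree sum is at most 16 and no search is called for.
sparse₃ : run (flagsOf 4 3) (sparseᵇ 3) ≡ true
sparse₃ = refl

sparse₄ : run (flagsOf 3 4) (sparseᵇ 4) ≡ true
sparse₄ = refl

sparse₅ : run (flagsOf 2 5) (sparseᵇ 5) ≡ true
sparse₅ = refl

sparse₆ : run (flagsOf 1 6) (sparseᵇ 6) ≡ true
sparse₆ = refl

sparse₇ : run (flagsOf 0 7) (sparseᵇ 7) ≡ true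
sparse₇ = refl

sparse-edges : ∀ {m} Δ (bs : Vec Bool m) → run bs (sparseᵇ Δ) ≡ true → (H : Graph (m + 1)) → C4-free H →
  (∀ i → adj H (i ↑ˡ 1) (lastFin m) ≡ Vec.lookup bs i) → (∀ u → countFin (adj H u) ≤ Δ) → edges H ≤ 11
sparse-edges Δ bs e H free flags degree =
  [ (λ h → subst (_≤ 11) (weight-rowsOf H) (≤ᵇ-sound {weight (rowsOf H)} h)) , large ]′
    (∨-true {weight (rowsOf H) ≤ᵇ 11} (run-sound bs (sparseᵇ Δ) e H free flags))
  where
  large : anyFinᵇ (λ u → suc Δ ≤ᵇ countFin (adjR (rowsOf H) u)) ≡ true → edges H ≤ 11
  large h = let (u , x) = anyFinᵇ-true (λ u → suc Δ ≤ᵇ countFin (adjR (rowsOf H) u)) h in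
    ⊥-elim (<⇒≱ (≤ᵇ-sound {suc Δ} x) (≤-trans (≤-reflexive (countFin-cong (adjR-rowsOf H u))) (degree u)))

few-edges : ∀ {m} Δ c → (H : Graph m) → (∀ u → countFin (adj H u) ≤ Δ) → m * Δ ≤ c + c → edges H ≤ c
few-edges {m} Δ c H degree le = ≮⇒≥ λ lt → <⇒≱ (+-mono-< lt lt) (begin
  edges H + edges H    ≡⟨ darts≡2edges H ⟨
  darts H              ≤⟨ sumFin-mono degree ⟩
  sumFin {m} (λ _ → Δ) ≡⟨ sumFin-const m Δ ⟩
  m * Δ                ≤⟨ le ⟩
  c + c                ∎)
  where open ≤-Reasoning

-- The vertices of G listed as non-neighbours of v, neighbours of v, and v.
record Ordered {n} (G : Graph n) (v : Fin n) (Δ : ℕ) : Set where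
  field
    far#       : ℕ
    size    : (far# + Δ) + 1 ≡ n
    H       : Graph ((far# + Δ) + 1)
    free    : C4-free H
    flags   : ∀ i → adj H (i ↑ˡ 1) (lastFin (far# + Δ)) ≡ Vec.lookup (flagsOf far# Δ) i
    degree  : ∀ u → Σ (Fin n) λ w → countFin (adj H u) ≡ countFin (adj G w)
    edgesH  : edges H ≡ edges G

module _ {G : Graph n} (free : C4-free G) (v : Fin n) where
  private
    far : Fin n → Bool
    far u = not (adj G v u) ∧ not (v == u)
    Δ far# : ℕ
    Δ = countFin (adj G v)
    far# = countFin far

    -- `glueClasses` serves as an enumeration: its representatives list non-neighbours before
    -- neighbours, in the order of `flagsOf`.
    others : Classes (λ u → u ≢ v) _≡_ (far# + Δ)
    others = glueClasses (countClasses far) (countClasses (adj G v)) id id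
      (λ {u} e e' → true≢false (trans (cong (v ==_) e') (==-refl v)) (not-true (proj₂ (∧-true {not (adj G v u)} e))))
      (λ e e' → dart-irrefl G e (≡-sym e'))
      (λ {u} ne → side u ne)
      (λ _ _ e → e) (λ _ _ e → e)
      (λ { p q refl → true≢false q (not-true (proj₁ (∧-true p))) })
      (λ { p q refl → true≢false q (not-true (proj₁ (∧-true p))) })
      where
      side : ∀ u → u ≢ v → (Σ _ λ a → far a ≡ true × (∀ {r} → far r ≡ true → a ≡ r → u ≡ r)) ⊎
                           (Σ _ λ a → adj G v a ≡ true × (∀ {r} → adj G v r ≡ true → a ≡ r → u ≡ r))
      side u ne with adj G v u in e
      ... | true  = inj₂ (u , e , λ _ x → x)
      ... | false = inj₁ (u , ∧-intro (cong not e) (cong not (≢true λ q → ne (≡-sym (==-sound v u q)))) , λ _ x → x)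

    single : Classes {Fin 1} (λ _ → ⊤) _≡_ 1
    single = finClasses 1

    -- Being a system of representatives for equality, `π` is a bijection onto the vertices of G,
    -- with `v` at the index `lastFin`.
    everything : Classes {Fin n} (λ _ → ⊤) _≡_ ((far# + Δ) + 1)
    everything = glueClasses others single id (λ _ → v) (λ _ → tt) (λ _ → tt)
      (λ {u} _ → side u)
      (λ _ _ e → e) (λ { {0F} {0F} _ _ _ → refl }) (λ ne _ e → ne e) (λ ne _ e → ne (≡-sym e))
      where
      side : ∀ u → (Σ _ λ a → a ≢ v × (∀ {r} → r ≢ v → a ≡ r → u ≡ r)) ⊎
                   (Σ (Fin 1) λ a → ⊤ × (∀ {r} → ⊤ → a ≡ r → u ≡ v))
      side u with u Fin.≟ v
      ... | yes e = inj₂ (0F , tt , λ _ _ → e)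
      ... | no ne = inj₁ (u , ne , λ _ x → x)

    open Classes everything renaming (rep to π)

    H : Graph ((far# + Δ) + 1)
    H = record { adj = λ a b → adj G (π a) (π b) ; sym = λ a b → sym G (π a) (π b) ; irrefl = λ a → irrefl G (π a) }

    π-old : ∀ i → π (i ↑ˡ 1) ≡ Classes.rep others i
    π-old i = cong [ _ , _ ]′ (splitAt-↑ˡ (far# + Δ) i 1)

    π-last : π (lastFin (far# + Δ)) ≡ v
    π-last = cong [ _ , _ ]′ (splitAt-↑ʳ (far# + Δ) 1 0F)

    π-inj : ∀ {a b} → π a ≡ π b → a ≡ b
    π-inj = uniq

    flag : ∀ i → adj G (Classes.rep others i) v ≡ Vec.lookup (flagsOf far# Δ) i
    flag i = trans (sym G _ v) (trans (byside (splitAt far# i)) (≡-sym (lookup∘tabulate _ i)))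
      where
      byside : ∀ s → adj G v ([ id ∘ Classes.rep (countClasses far) , id ∘ Classes.rep (countClasses (adj G v)) ]′ s) ≡
                     [ (λ _ → false) , (λ _ → true) ]′ s
      byside (inj₁ a) = not-true (proj₁ (∧-true (Classes.rep∈ (countClasses far) a)))
      byside (inj₂ a) = Classes.rep∈ (countClasses (adj G v)) a

    pulled : ∀ u → countFin (adj H u) ≡ countFin (adj G (π u))
    pulled u = classes-unique ≡-PER (mapClasses (countClasses (adj H u)) π id
      (λ {w} e → let (i , eq) = cover {w} tt in i , subst (λ s → adj G (π u) s ≡ true) eq e , eq)
      (λ _ _ → π-inj)) (countClasses (adj G (π u)))

    edgesπ : edges H ≡ edges G
    edgesπ = double-injective (trans (≡-sym (darts≡2edges H)) (trans
      (classes-unique ≡-PER (mapClasses (dartClasses H) (λ { (a , b) → π a , π b }) id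
        (λ { {x , y} e → let (i , eq) = cover {x} tt ; (j , eq') = cover {y} tt in
             (i , j) , subst (λ s → adj G s (π j) ≡ true) eq (subst (λ s → adj G x s ≡ true) eq' e) , cong₂ _,_ eq eq' })
        (λ _ _ e → cong₂ _,_ (π-inj (cong proj₁ e)) (π-inj (cong proj₂ e)))) (dartClasses G))
      (darts≡2edges G)))

  ordered : Ordered G v Δ
  ordered = record
    { far# = far# ; size = classes-unique ≡-PER everything (finClasses n) ; H = H
    ; free = λ { u (_ , _ , _ , c4At a b c d e f) → free _ (_ , _ , _ , c4At a b c d (e ∘ π-inj) (f ∘ π-inj)) }
    ; flags = λ i → trans (cong₂ (adj G) (π-old i) π-last) (flag i)
    ; degree = λ u → π u , pulled u
    ; edgesH = edgesπ }

argmax : (f : Fin (suc n) → ℕ) → Σ (Fin (suc n)) λ v → ∀ u → f u ≤ f v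
argmax {zero}  f = 0F , λ { 0F → ≤-refl }
argmax {suc n} f with argmax (f ∘ suc)
... | v , top with ≤-total (f zero) (f (suc v))
...   | inj₁ le = suc v , λ { zero → le ; (suc u) → top u }
...   | inj₂ ge = zero , λ { zero → ≤-refl ; (suc u) → ≤-trans (top u) ge }

eleven : ∀ Δ k → (k + Δ) + 1 ≡ 8 → (H : Graph ((k + Δ) + 1)) → C4-free H →
  (∀ i → adj H (i ↑ˡ 1) (lastFin (k + Δ)) ≡ Vec.lookup (flagsOf k Δ) i) →
  (∀ u → countFin (adj H u) ≤ Δ) → edges H ≤ 11
eleven Δ k size H free flags degree = go Δ k size≡ (≤-trans (m≤n+m Δ k) (≤-reflexive k+Δ≡7)) H free flags degree
  where
  k+Δ≡7 : k + Δ ≡ 7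
  k+Δ≡7 = +-cancelʳ-≡ 1 (k + Δ) 7 size
  size≡ : k ≡ 7 ∸ Δ
  size≡ = trans (≡-sym (m+n∸n≡m k Δ)) (cong (_∸ Δ) k+Δ≡7)
  -- In this form of the equation, matching on Δ determines `k` and with it the type of H.
  go : ∀ Δ k → k ≡ 7 ∸ Δ → Δ ≤ 7 → (H : Graph ((k + Δ) + 1)) → C4-free H →
    (∀ i → adj H (i ↑ˡ 1) (lastFin (k + Δ)) ≡ Vec.lookup (flagsOf k Δ) i) →
    (∀ u → countFin (adj H u) ≤ Δ) → edges H ≤ 11
  go 0 _ refl _ H _ _ degree = few-edges 0 11 H degree z≤n
  go 1 _ refl _ H _ _ degree = few-edges 1 11 H degree (≤ᵇ-sound {8} refl)
  go 2 _ refl _ H _ _ degree = few-edges 2 11 H degree (≤ᵇ-sound {16} refl)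
  go 3 _ refl _ = sparse-edges 3 (flagsOf 4 3) sparse₃
  go 4 _ refl _ = sparse-edges 4 (flagsOf 3 4) sparse₄
  go 5 _ refl _ = sparse-edges 5 (flagsOf 2 5) sparse₅
  go 6 _ refl _ = sparse-edges 6 (flagsOf 1 6) sparse₆
  go 7 _ refl _ = sparse-edges 7 (flagsOf 0 7) sparse₇
  go (suc (suc (suc (suc (suc (suc (suc (suc _)))))))) _ _ (s≤s (s≤s (s≤s (s≤s (s≤s (s≤s (s≤s ())))))))

edges₈≤11 : (G : Graph n) → n ≡ 8 → C4-free G → edges G ≤ 11
edges₈≤11 {suc n} G n≡8 free = subst (_≤ 11) edgesH
    (eleven (countFin (adj G v)) far# (trans size n≡8) H freeH flags λ u →
      let (w , e) = degree u in ≤-trans (≤-reflexive e) (proj₂ maximal w))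
  where
  maximal : Σ (Fin (suc n)) λ v → ∀ u → countFin (adj G u) ≤ countFin (adj G v)
  maximal = argmax (λ u → countFin (adj G u))
  v : Fin (suc n)
  v = proj₁ maximal
  open Ordered (ordered free v) renaming (free to freeH)

-- Comparison of the two extremal numbers.

C4-closed⇒edges≤ : (G : Graph n) → 5 ≤ n → n ≢ 8 → Planar G → C4-closed G →
  Σ (Graph n) λ G' → Planar G' × C4-free G' × edges G ≤ edges G'
C4-closed⇒edges≤ {n} G 5≤n n≢8 planarG closedG with any? (λ x → ¬? (inC4? G x))
... | yes (x , x∉) = exchangeAll G planarG closedG x x∉ (<-wellFounded _)
... | no h = chained (A.4∣n)
  where
  inC4 : ∀ v → InC4 G v
  inC4 v with inC4? G v
  ... | yes c = c
  ... | no ¬c = ⊥-elim (h (v , ¬c))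
  module A = AllInC4 G closedG inC4
  chained : (Σ ℕ λ a → n ≡ a * 4) → Σ (Graph n) λ G' → Planar G' × C4-free G' × edges G ≤ edges G'
  chained (0 , refl) = case 5≤n of λ ()
  chained (1 , refl) = ⊥-elim (<⇒≱ 5≤n ≤-refl)
  chained (2 , refl) = ⊥-elim (n≢8 refl)
  -- On n = 12 + 4b vertices, degrees of at most three allow 3n/2 = 18 + 6b edges, exactly the
  -- number in the chain.
  chained (suc (suc (suc b)) , refl) = C.G , C.planarG , C.freeG , ≤-trans (few-edges 3 (18 + b * 6) G A.degree≤3 count) (≤-reflexive (≡-sym C.edgesG))
    where
    module C = Chain (chain n b ≤-refl)
    count : (12 + b * 4) * 3 ≤ (18 + b * 6) + (18 + b * 6)
    count = ≤-reflexive (solve 1 (λ b → (con 12 :+ b :* con 4) :* con 3 :=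
      (con 18 :+ b :* con 6) :+ (con 18 :+ b :* con 6)) refl b)

theorem3p4 : (∀ (n : ℕ) → 5 ≤ n → n ≢ 8 →
    Σ ℕ (λ m → IsExP n C4⁺ m × IsExP n C4 m))
    × (Σ ℕ (λ m → IsExP 8 C4 m × IsExP 8 C4⁺ (m + 1)) × IsExP 8 C4⁺ 12)
theorem3p4 = general , (11 , c4-at-8 , c4⁺-at-8) , c4⁺-at-8
  where
  general : ∀ n → 5 ≤ n → n ≢ 8 → Σ ℕ (λ m → IsExP n C4⁺ m × IsExP n C4 m)
  general n 5≤n n≢8 =
    -- The maximum over C4-free graphs serves as both numbers; for `C4⁺` each competitor is first
    -- replaced by a C4-free graph.
    let (m , (G , planarG , freeG , edgesG) , top) = maxC4-free n
    in m , ((G , planarG , C4-free⇒Free⁺ freeG , edgesG) , λ G' planarG' freeG' →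
             let (G″ , planarG″ , freeG″ , le) = C4-closed⇒edges≤ G' 5≤n n≢8 planarG' (Free⇒C4-closed freeG')
             in ≤-trans le (top G″ planarG″ freeG″))
         , ((G , planarG , C4-free⇒Free freeG , edgesG) , λ G' planarG' freeG' → top G' planarG' (Free⇒C4-free freeG'))

  c4-at-8 : IsExP 8 C4 11
  c4-at-8 = let (G , planarG , freeG , edgesG) = example8-attains in
    (G , planarG , C4-free⇒Free freeG , edgesG) , λ G _ freeG → edges₈≤11 G refl (Free⇒C4-free freeG)

  bound : ∀ {n} (G : Graph n) → n ≡ 8 → Planar G → C4-closed G → edges G ≤ 12
  bound {n} G n≡8 planarG closedG with any? (λ x → ¬? (inC4? G x))
  ... | yes (x , x∉) =
    let (G' , _ , freeG' , le) = exchangeAll G planarG closedG x x∉ (<-wellFounded _)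
    in ≤-trans le (≤-trans (edges₈≤11 G' n≡8 freeG') (n≤1+n 11))
  -- Degrees of at most three on eight vertices give the bound 24 / 2 = 12, the value for two
  -- disjoint copies of K₄.
  ... | no h = few-edges 3 12 G (AllInC4.degree≤3 G closedG inC4) (≤-reflexive (cong (_* 3) n≡8))
    where
    inC4 : ∀ v → InC4 G v
    inC4 v with inC4? G v
    ... | yes c = c
    ... | no ¬c = ⊥-elim (h (v , ¬c))

  c4⁺-at-8 : IsExP 8 C4⁺ 12
  c4⁺-at-8 = twoTetrahedra (_↑ˡ 4) (4 ↑ʳ_) (Finₚ.↑ˡ-injective 4 _ _) (Finₚ.↑ʳ-injective 4 _ _)
      (λ i j e → case trans (≡-sym (splitAt-↑ˡ 4 i 4)) (trans (cong (splitAt 4) e) (splitAt-↑ʳ 4 4 j)) of λ ())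
      (λ u → cover u)
    , λ G planarG freeG → bound G refl planarG (Free⇒C4-closed freeG)
    where
    cover : ∀ u → Σ (Fin 4) (λ j → j ↑ˡ 4 ≡ u) ⊎ Σ (Fin 4) (λ j → 4 ↑ʳ j ≡ u)
    cover u with splitAt 4 u in e
    ... | inj₁ j = inj₁ (j , splitAt⁻¹-↑ˡ e)
    ... | inj₂ j = inj₂ (j , splitAt⁻¹-↑ʳ e)
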